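{- Let $L$ be an alternating oriented link diagram, let $C$ be a type 2 Seifert circle of $L$, and let $L=L'*_CL''$ be the corresponding diagrammatic Murasugi sum. Then $\widetilde\Delta_L$ and $\widetilde\Delta_{L'}\widetilde\Delta_{L''}$ have the same support.
   Context: **Diagrams.** An oriented link diagram $L$ is drawn on $S^2$, with over/under information at crossings. A region of $L$ is a connected component of $S^2\setminus L$. A segment is an arc of $L$ between two consecutive crossings (a closed component without crossings counts as one segment). $L$ is alternating if, tracing along any strand, one alternates between going over and under at crossings. Draw a crossing with both strands oriented upward; its four corners are called top (between the two outgoing ends), bottom (between the two incoming ends), left and right. **Symmetrized Alexander polynomial.** Fix a segment $i$ of $L$. The two regions adjacent to $i$ are absent, all others are present. Weights of corners: left and right corners have weight $1$; if the overstrand goes from bottom-left to top-right, the top corner has weight $t^{1/2}$ and the bottom corner $-t^{ -1/2}$; if the overstrand goes from bottom-right to top-left, the top corner has weight $t^{ -1/2}$ and the bottom corner $-t^{1/2}$. A state assigns to each crossing one of its corners lying in a present region, so that every present region is used exactly once; its weight is the product of the weights of the chosen corners. $\widetilde{\Delta}_L\in\mathbb{Z}[t^{\pm 1/2}]$ is the sum of the weights of all states; by a theorem of Kauffman it does not depend on $i$. **Support.** The support of $f\in\mathbb{Z}[t^{1/2},t^{ -1/2}]$ is the set of $s\in\frac12\mathbb{Z}$ such that $t^s$ has nonzero coefficient in $f$. **Seifert circles.** Smoothing every crossing of $L$ according to orientation (connecting bottom-left to top-left, and bottom-right to top-right) gives a collection of oriented circles; each specifies a collection of segments of $L$, called a Seifert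 circle (a simple closed curve in $S^2$ that turns at each of its crossings). A Seifert circle is type 1 if it bounds a region of $L$ and type 2 otherwise. **Diagrammatic Murasugi sum.** Let $C$ be a type 2 Seifert circle; $S^2\setminus C$ has two components $R',R''$. A crossing belongs to $R'$ (resp. $R''$) if at least two of the regions adjacent to it are contained in $R'$ (resp. $R''$). (Each crossing belongs to exactly one of them; for a crossing on $C$ three of its corners lie on the side it belongs to.) $L'$ is the diagram obtained by smoothing the crossings of $C$ that do not belong to $R'$ and then removing the portion of the resulting diagram contained in $R''$; $L''$ is defined analogously with $R',R''$ exchanged. One writes $L=L'*_CL''$. -}

module Defs where

open import Data.Fin.Base using (Fin)
open import Data.Fin.Properties using (any?; all?) renaming (_≟_ to _≟ᶠ_)
open import Data.Integer.Base using (ℤ; 0ℤ; 1ℤ; -1ℤ) renaming (_+_ to _+ℤ_; _*_ to _*ℤ_)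
open import Data.Integer.Properties using () renaming (_≟_ to _≟ℤ_)
open import Data.List.Base
  using (List; []; _∷_; [_]; map; filter; foldr; cartesianProductWith)
open import Data.Nat.Base using (ℕ; zero; suc; _+_; _*_)
open import Data.Nat.GeneralisedArithmetic using (iterate)
open import Data.Product.Base using (∃; ∃₂; _×_; _,_; proj₁; proj₂; map₁)
open import Data.Product using (∃!)
open import Data.Sum.Base using (_⊎_; inj₁; inj₂; [_,_]′)
open import Data.Vec.Base using (Vec; []; _∷_; lookup; tabulate)
import Data.Vec.Base as Vec
open import Function.Bundles using (_↔_; _⇔_; Inverse)
open import Function.Definitions using (Injective; StrictlySurjective)
open import Relation.Binary.Construct.Closure.Equivalence using (EqClosure)
open import Relation.Binary.PropositionalEquality using (_≡_; _≢_)
open import Relation.Nullary using (¬_; Dec)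
open import Relation.Nullary.Decidable using (map′; ¬?; _×-dec_; _→-dec_)
open import Relation.Unary using (Pred; Decidable)

------------------------------------------------------------------------
-- Laurent polynomials in t^{1/2}

-- The exponent s ∈ ½ℤ is stored as the integer 2s, so (a , e) stands for
-- the monomial a · t^{e/2}.
Monomial : Set
Monomial = ℤ × ℤ

-- A formal sum in which exponents may be repeated; it is only ever
-- observed through `coeff`.
Laurent : Set
Laurent = List Monomial

_·_ : Monomial → Monomial → Monomial
(a , e) · (b , f) = (a *ℤ b) , (e +ℤ f)

_⊛_ : Laurent → Laurent → Laurent
_⊛_ = cartesianProductWith _·_

coeff : Laurent → ℤ → ℤ
coeff p e = foldr _+ℤ_ 0ℤ (map proj₁ (filter (λ m → proj₂ m ≟ℤ e) p))

Support : Laurent → Pred ℤ _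
Support p e = coeff p e ≢ 0ℤ

------------------------------------------------------------------------
-- Oriented link diagrams on the (oriented) sphere

-- Every crossing is viewed with both strands oriented upward.

data Side : Set where
  left right : Side

opposite : Side → Side
opposite left  = right
opposite right = left

data Corner : Set where
  top bottom left right : Corner

-- ↗ : the overstrand goes from bottom-left to top-right;
-- ↖ : the overstrand goes from bottom-right to top-left.
data Overstrand : Set where
  ↗ ↖ : Overstrand

-- The strands of a diagram, regardless of the sphere.  A diagram may be
-- disconnected and may have components without crossings.
record Strands : Set where
  field
    crossings : ℕ
    circles   : ℕ                    -- components without crossings
    over      : Fin crossings → Overstrand

  Crossing : Set
  Crossing = Fin crossings

  -- (c , left) is the left one of the two outgoing ends of c, or of its two
  -- incoming ends, depending on the context.
  End : Set
  End = Crossing × Side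

  field
    -- The segment that leaves c through the outgoing end (c , x) arrives
    -- through the incoming end `to arc (c , x)`.
    arc : End ↔ End

  open Inverse arc public using (to; from)

  -- A segment which is not a circle is named by the outgoing end at which
  -- it starts.
  Segment : Set
  Segment = End ⊎ Fin circles

  outgoing incoming : Crossing → Side → Segment
  outgoing c x = inj₁ (c , x)
  incoming c x = inj₁ (from (c , x))

  -- (s , left) and (s , right) are the two sides of the segment s, as seen
  -- when travelling along the orientation.
  Flank : Set
  Flank = Segment × Side

  cornerFlanks : Crossing → Corner → Flank × Flank
  cornerFlanks c top    = (outgoing c left  , right) , (outgoing c right , left)
  cornerFlanks c bottom = (incoming c left  , right) , (incoming c right , left)
  cornerFlanks c left   = (incoming c left  , left)  , (outgoing c left  , left)
  cornerFlanks c right  = (incoming c right , right) , (outgoing c right , right)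

  AtCorner : Flank → Flank → Set
  AtCorner f g = ∃₂ λ c k → cornerFlanks c k ≡ (f , g)

record Diagram : Set where
  field
    strands : Strands

  open Strands strands public

  field
    -- `boundary` numbers the closed walks that the flanks form when one
    -- turns at every corner.  A region of a disconnected diagram can have
    -- several of these walks as boundary components.
    boundaries          : ℕ
    boundary            : Flank → Fin boundaries
    boundary-surjective : StrictlySurjective _≡_ boundary
    boundary-walk       : ∀ f g → (boundary f ≡ boundary g) ⇔ EqClosure AtCorner f g

    regions         : ℕ
    boundaryRegion  : Fin boundaries → Fin regions

  Region : Set
  Region = Fin regions

  region : Flank → Region
  region f = boundaryRegion (boundary f)

  cornerRegion : Crossing → Corner → Region
  cornerRegion c k = region (proj₁ (cornerFlanks c k))

  Adjacent : Region → Region → Set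
  Adjacent ρ ρ′ = ∃ λ s → region (s , left) ≡ ρ × region (s , right) ≡ ρ′

  field
    -- Regard a region with b boundary walks as a sphere with b holes, of
    -- Euler characteristic 2 - b, and glue the regions along the diagram.
    -- The result is a closed oriented surface; it is a sphere if and only if
    -- it is connected and has Euler characteristic 2.  There are
    -- 2 * crossings segments apart from the circles, whose Euler
    -- characteristic is 0, so the latter condition reads
    --   crossings - 2 * crossings + (2 * regions - boundaries) = 2.
    connected : ∀ ρ ρ′ → EqClosure Adjacent ρ ρ′
    euler     : 2 * regions ≡ crossings + boundaries + 2

open Diagram using (Segment; Region)

------------------------------------------------------------------------
-- Alternating diagrams

overTail overHead : Overstrand → Side
overTail ↗ = left
overTail ↖ = right
overHead ↗ = right
overHead ↖ = left

module _ (L : Diagram) where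
  open Diagram L hiding (Segment; Region)

  LeavesOver ArrivesOver : End → Set
  LeavesOver  (c , x) = x ≡ overHead (over c)
  ArrivesOver (c , x) = x ≡ overTail (over c)

  Alternating : Set
  Alternating = ∀ e → LeavesOver e ⇔ (¬ ArrivesOver (to e))

------------------------------------------------------------------------
-- The symmetrized Alexander polynomial

cornerWeight : Overstrand → Corner → Monomial
cornerWeight ↗ top    = 1ℤ  , 1ℤ
cornerWeight ↗ bottom = -1ℤ , -1ℤ
cornerWeight ↖ top    = 1ℤ  , -1ℤ
cornerWeight ↖ bottom = -1ℤ , 1ℤ
cornerWeight _ left   = 1ℤ  , 0ℤ
cornerWeight _ right  = 1ℤ  , 0ℤ

cornerAssignments : ∀ n → List (Vec Corner n)
cornerAssignments zero    = [ [] ]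
cornerAssignments (suc n) =
  cartesianProductWith _∷_ (top ∷ bottom ∷ left ∷ right ∷ []) (cornerAssignments n)

module _ (L : Diagram) (i : Segment L) where
  open Diagram L hiding (Segment; Region)

  Present : Region L → Set
  Present ρ = ρ ≢ region (i , left) × ρ ≢ region (i , right)

  present? : Decidable Present
  present? ρ = ¬? (ρ ≟ᶠ region (i , left)) ×-dec ¬? (ρ ≟ᶠ region (i , right))

  usedRegion : Vec Corner crossings → Crossing → Region L
  usedRegion v c = cornerRegion c (lookup v c)

  IsState : Vec Corner crossings → Set
  IsState v = (∀ c → Present (usedRegion v c))
            × (∀ ρ → Present ρ → ∃! _≡_ λ c → usedRegion v c ≡ ρ)

  isState? : Decidable IsState
  isState? v = all? (λ c → present? (usedRegion v c))
         ×-dec all? (λ ρ → present? ρ →-dec any? (λ c →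
                 (usedRegion v c ≟ᶠ ρ) ×-dec
                 map′ (λ h {c′} → h c′) (λ h c′ → h {c′})
                   (all? (λ c′ → (usedRegion v c′ ≟ᶠ ρ) →-dec (c ≟ᶠ c′)))))

  stateWeight : Vec Corner crossings → Monomial
  stateWeight v =
    Vec.foldr′ _·_ (1ℤ , 0ℤ) (tabulate λ c → cornerWeight (over c) (lookup v c))

  -- The state sum in which the two regions adjacent to i are absent.
  Δ̃ : Laurent
  Δ̃ = map stateWeight (filter isState? (cornerAssignments crossings))

------------------------------------------------------------------------
-- Seifert circles

-- A Seifert circle is given by any one of its segments.
record SeifertCircle (L : Diagram) : Set where
  constructor circleThrough
  field
    base : Segment L

module _ {L : Diagram} where
  open Diagram L hiding (Segment; Region)

  -- Smoothing joins the incoming left (right) end of a crossing to its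
  -- outgoing left (right) end, so an incoming end and the outgoing end
  -- joined to it have the same name.
  nextSegment : Segment L → Segment L
  nextSegment (inj₁ e) = inj₁ (to e)
  nextSegment (inj₂ j) = inj₂ j

  _∈ᶜ_ : Segment L → SeifertCircle L → Set
  s ∈ᶜ C = ∃ λ k → iterate nextSegment (SeifertCircle.base C) k ≡ s

  Bounds : SeifertCircle L → Region L → Set
  Bounds C ρ = ∀ s → (s ∈ᶜ C) ⇔ (region (s , left) ≡ ρ ⊎ region (s , right) ≡ ρ)

  Type1 Type2 : SeifertCircle L → Set
  Type1 C = ∃ (Bounds C)
  Type2 C = ¬ Type1 C

  module _ (C : SeifertCircle L) where

    AdjacentOffC : Region L → Region L → Set
    AdjacentOffC ρ ρ′ =
      ∃ λ s → ¬ (s ∈ᶜ C) × region (s , left) ≡ ρ × region (s , right) ≡ ρ′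

    -- The component of S² ∖ C on the side d of C, as a set of regions.  Two
    -- regions lie in the same component if one can pass from one to the
    -- other across segments not in C; passing through a crossing not on C,
    -- or through a crossing at which C turns, adds nothing to this.
    Component : Side → Pred (Region L) _
    Component d = EqClosure AdjacentOffC (region (SeifertCircle.base C , d))

    BelongsTo : Side → Crossing → Set
    BelongsTo d c = ∃₂ λ k k′ → cornerRegion c k ≢ cornerRegion c k′
      × Component d (cornerRegion c k) × Component d (cornerRegion c k′)

    OnC : Crossing → Set
    OnC c = ∃ λ x → outgoing c x ∈ᶜ C

    -- Once the crossings of C that do not belong to the side d are smoothed,
    -- the strand that starts at the outgoing end e arrives at the next
    -- crossing through the incoming end f.
    data SmoothedArc (d : Side) (e : End) : End → Set where
      arrive : BelongsTo d (proj₁ (to e)) → SmoothedArc d e (to e)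
      smooth : ∀ {f} → OnC (proj₁ (to e)) → ¬ BelongsTo d (proj₁ (to e)) →
               SmoothedArc d (to e) f → SmoothedArc d e f

    -- The segments lying on curves that have no crossing after the smoothing
    -- and are not removed: the circles of L contained in the side d, and C
    -- itself if all of its crossings are smoothed.
    OnKeptCircle : Side → Segment L → Set
    OnKeptCircle d s =
        (∃ λ j → s ≡ inj₂ j × Component d (region (s , left))
                            × Component d (region (s , right)))
      ⊎ (s ∈ᶜ C × (∀ c → OnC c → ¬ BelongsTo d c))

------------------------------------------------------------------------
-- The diagrammatic Murasugi sum

module _ (L L′ : Diagram) where
  private
    module L  = Diagram L
    module L′ = Diagram L′

  -- L′ is the diagram obtained from L by smoothing the crossings of C that
  -- do not belong to the side d and removing what is then contained in the
  -- other side.  (This determines L′ up to the naming of its crossings,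
  -- circles, boundary walks and regions.)
  record Part (C : SeifertCircle L) (d : Side) : Set where
    field
      crossingOf           : L′.Crossing → L.Crossing
      crossingOf-injective : Injective _≡_ _≡_ crossingOf
      crossingOf-image     : ∀ c → BelongsTo C d c ⇔ (∃ λ c′ → crossingOf c′ ≡ c)
      over-preserved       : ∀ c′ → L′.over c′ ≡ L.over (crossingOf c′)

    endOf : L′.End → L.End
    endOf = map₁ crossingOf

    field
      arc-smoothed : ∀ e′ → SmoothedArc C d (endOf e′) (endOf (L′.to e′))

      -- A segment of L on each circle of L′.
      circleOf           : Fin L′.circles → L.Segment
      circleOf-kept      : ∀ j → OnKeptCircle C d (circleOf j)
      circleOf-injective : ∀ j j′ → circleOf j′ ∈ᶜ circleThrough {L} (circleOf j) → j ≡ j′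
      circleOf-onto      : ∀ s → OnKeptCircle C d s →
                           ∃ λ j → s ∈ᶜ circleThrough {L} (circleOf j)

    segmentOf : L′.Segment → L.Segment
    segmentOf = [ (λ e′ → inj₁ (endOf e′)) , circleOf ]′

    field
      -- The regions on the side d survive; those on the other side merge.
      regionOf            : L.Region → L′.Region
      regionOf-surjective : StrictlySurjective _≡_ regionOf
      regionOf-merges     : ∀ ρ₁ ρ₂ → (regionOf ρ₁ ≡ regionOf ρ₂) ⇔
        (ρ₁ ≡ ρ₂ ⊎ (Component C (opposite d) ρ₁ × Component C (opposite d) ρ₂))
      region-preserved    : ∀ s′ x →
        L′.region (s′ , x) ≡ regionOf (L.region (segmentOf s′ , x))

-- L = L′ *_C L″.  Either of the two sides of C may play the role of R′.
record IsMurasugiSum (L : Diagram) (C : SeifertCircle L) (L′ L″ : Diagram) : Set where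
  field
    side   : Side
    first  : Part L L′ C side
    second : Part L L″ C (opposite side)

{-# OPTIONS --safe #-}

{-
For a connected alternating diagram with n crossings, the exponents of the
states are exactly the numbers a − b with a + b = m, where m = n + 1 − s and s
is the number of Seifert circles; and the sign of a state is determined by its
exponent.  Hence nothing cancels, supports are sets of exponents, and the
theorem reduces to the additivity of m (and of connectedness) under the Murasugi
sum.

Colouring the corners by the checkerboard pattern, which alternation provides
for free, shows that a state of sign (−1)^β has exponent κ − 2β with a constant
κ.  The number m enters as the rank of the graph on the regions whose edges
are the crossings, each joining its top to its bottom corner.  By a tree–cotree
argument and the Euler characteristic, the components of this graph and the
Seifert circles form a tree; in particular every Seifert circle separates.

States are grown from the two absent regions: as long as possible one covers a
new region by a vertical corner, whose sign can be chosen freely because the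
crossings of one sign form an Eulerian digraph, and otherwise one crosses a
Seifert circle by a horizontal corner.  This yields all a − b with a + b = m.
The depth of a region in the tree of components is a dual solution showing that
no state has more than m vertical corners.
-}

module Submission where

open import Defs
open import Algebra.Bundles using (AbelianGroup)
open import Data.Empty using (⊥; ⊥-elim)
open import Data.Fin.Base using (Fin; zero; suc; toℕ; punchIn; punchOut; _↑ˡ_; _↑ʳ_)
open import Data.Fin.Properties
  using (any?; punchOut-injective; punchOut-punchIn; punchOut-cong; punchInᵢ≢i; injective⇒≤; +↔⊎; *↔×; 0≢1+n
        ; suc-injective; pigeonhole; splitAt-↑ˡ; splitAt-↑ʳ)
  renaming (_≟_ to _≟ᶠ_)
open import Data.Integer.Base as ℤ using (ℤ; 0ℤ; 1ℤ; -1ℤ; -[1+_]; _⊖_) renaming (+_ to ⁺_)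
import Data.Integer.Properties as ℤₚ
import Data.Integer.Tactic.RingSolver as ℤ-Solver
open import Data.List.Base using (List; []; _∷_; [_]; map; filter; length; lookup; _++_; allFin; foldr)
open import Data.List.Properties using (length-++; length-map)
open import Data.List.Membership.Propositional using (_∈_; _∉_)
open import Data.List.Membership.Propositional.Properties
  using (∈-allFin; ∈-lookup; ∈-filter⁺; ∈-filter⁻; ∈-map⁺; ∈-map⁻; ∈-++⁺ˡ; ∈-++⁺ʳ
        ; ∈-cartesianProductWith⁺; ∈-cartesianProductWith⁻)
open import Data.List.Relation.Unary.All as All using (All; []; _∷_)
open import Data.List.Relation.Unary.All.Properties using (¬Any⇒All¬)
open import Data.List.Relation.Unary.Any as Any using (here; there)
open import Data.List.Relation.Unary.Any.Properties using (lookup-index)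
open import Data.List.Relation.Unary.AllPairs using ([]; _∷_)
open import Data.List.Relation.Unary.Unique.Propositional using (Unique)
open import Data.List.Relation.Unary.Unique.Propositional.Properties
  using (allFin⁺; filter⁺; ++⁺) renaming (map⁺ to unique-map⁺)
open import Data.Maybe.Base using (Maybe; just; nothing)
open import Data.Maybe.Properties using (just-injective)
open import Data.Nat.Base using (ℕ; zero; suc; _+_; _*_; _≤_; z≤n; s≤s)
open import Data.Nat.GeneralisedArithmetic using (iterate)
import Data.Nat.Properties as ℕₚ
open import Data.Nat.Tactic.RingSolver using (solve-∀)
open import Data.Product.Base using (∃; ∃₂; _×_; _,_; proj₁; proj₂)
open import Data.Product.Function.NonDependent.Propositional using (_×-↔_)
open import Data.Sum.Base using (_⊎_; inj₁; inj₂; [_,_]′)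
open import Data.Sum.Function.Propositional using (_⊎-↔_)
open import Data.Sum.Properties using (inj₁-injective; inj₂-injective)
open import Data.Vec.Base as Vec using (Vec; tabulate)
open import Data.Vec.Properties using (lookup∘tabulate)
open import Function.Base using (_∘_; id)
open import Function.Bundles using (_↔_; _⇔_; Inverse; Equivalence; mk⇔; mk↔ₛ′)
open import Function.Construct.Composition using (_↔-∘_)
open import Function.Construct.Identity using (↔-id)
open import Function.Construct.Symmetry using (↔-sym)
open import Function.Definitions using (Injective)
open import Relation.Binary.Construct.Closure.Equivalence as Eq using (EqClosure)
open import Relation.Binary.Construct.Closure.ReflexiveTransitive using (ε; _◅_)
open import Relation.Binary.Construct.Closure.Symmetric using (fwd; bwd)
open import Relation.Binary.PropositionalEquality hiding ([_])
open import Relation.Nullary using (¬_; Dec; yes; no; contradiction)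
open import Relation.Nullary.Decidable using (¬?; _×-dec_; _→-dec_; decidable-stable)
open import Relation.Unary using (_≐_)

open import Algebra.Properties.CommutativeMonoid.Sum ℤₚ.+-0-commutativeMonoid using () renaming
  ( sum to sumℤ; sum-cong-≗ to sumℤ-cong; ∑-distrib-+ to sumℤ-+; sum-permute to sumℤ-permute
  ; sum-replicate-zero to sumℤ-0 )
open import Algebra.Properties.CommutativeMonoid.Sum ℕₚ.+-0-commutativeMonoid using () renaming
  ( sum to sumℕ; sum-cong-≗ to sumℕ-cong; ∑-distrib-+ to sumℕ-+; sum-permute to sumℕ-permute )
open import Algebra.Properties.Group (AbelianGroup.group ℤₚ.+-0-abelianGroup) using () renaming
  ( ∙-cancelˡ to ℤ-cancelˡ; ∙-cancelʳ to ℤ-cancelʳ )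

-- Finite lists and spanning forests

-- The sphere enters the definitions only through `connected` and `euler`, so every separation
-- statement has to be extracted from a count. The tool is that a forest carries no circulation. Any
-- function on the Seifert circles yields a circulation on the graph of bands: beside a circle the
-- region changes only from the bottom to the top corner of a crossing, and these changes sum to
-- zero around the circle. If two such functions agree on the two strands of every crossing outside
-- a forest, they therefore agree at all crossings. This argument is used twice, to separate the
-- sphere along a Seifert circle and to show that a growth which cannot be continued covers
-- everything.
--
-- A disconnected diagram has no states. Conversely a state forces `regions ≡ 2 + crossings`, so
-- each inclusion of supports obtains connectedness from a nonzero coefficient and passes it on to
-- the other diagrams.
--
-- A state may have fewer than m vertical corners, but the deficit is even. Adding half of it to the
-- numbers of both kinds of vertical corners writes its exponent as a - b with a + b = m.

↔-injective : ∀ {A B : Set} (f : A ↔ B) {x y} → Inverse.to f x ≡ Inverse.to f y → x ≡ y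
↔-injective f {x} {y} eq =
    trans (sym (Inverse.strictlyInverseʳ f x)) (trans (cong (Inverse.from f) eq) (Inverse.strictlyInverseʳ f y))

_∈ᶠ?_ : ∀ {n} (k : Fin n) (xs : List (Fin n)) → Dec (k ∈ xs)
k ∈ᶠ? xs = Any.any? (k ≟ᶠ_) xs

lookup-injective : ∀ {A : Set} {xs : List A} → Unique xs → ∀ {i j} → lookup xs i ≡ lookup xs j → i ≡ j
lookup-injective (x≢ ∷ u) {zero}  {zero}  eq = refl
lookup-injective (x≢ ∷ u) {zero}  {suc j} eq = contradiction eq (All.lookup x≢ (∈-lookup j))
lookup-injective (x≢ ∷ u) {suc i} {zero}  eq = contradiction (sym eq) (All.lookup x≢ (∈-lookup i))
lookup-injective (x≢ ∷ u) {suc i} {suc j} eq = cong suc (lookup-injective u eq)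

∉⇒All≢ : ∀ {A : Set} {x : A} {xs} → x ∉ xs → All (x ≢_) xs
∉⇒All≢ = ¬Any⇒All¬ _

unique⇒length≤ : ∀ {n} {xs : List (Fin n)} → Unique xs → length xs ≤ n
unique⇒length≤ u = injective⇒≤ (lookup-injective u)

exhaustive⇒≤length : ∀ {n} {xs : List (Fin n)} → (∀ k → k ∈ xs) → n ≤ length xs
exhaustive⇒≤length {xs = xs} all∈ = injective⇒≤ {f = λ k → Any.index (all∈ k)} λ {k} {l} eq →
  trans (lookup-index (all∈ k)) (trans (cong (lookup xs) eq) (sym (lookup-index (all∈ l))))

unique∧exhaustive⇒length≡ : ∀ {n} {xs : List (Fin n)} → Unique xs → (∀ k → k ∈ xs) → length xs ≡ n
unique∧exhaustive⇒length≡ u all∈ = ℕₚ.≤-antisym (unique⇒length≤ u) (exhaustive⇒≤length all∈)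

unique∧length≡⇒exhaustive : ∀ {n} {xs : List (Fin n)} → Unique xs → length xs ≡ n → ∀ k → k ∈ xs
unique∧length≡⇒exhaustive {xs = xs} u len k with k ∈ᶠ? xs
... | yes k∈ = k∈
... | no  k∉ = contradiction (unique⇒length≤ (∉⇒All≢ k∉ ∷ u)) (ℕₚ.<⇒≱ (ℕₚ.≤-reflexive (cong suc (sym len))))

length-allFin : ∀ n → length (allFin n) ≡ n
length-allFin n = unique∧exhaustive⇒length≡ (allFin⁺ n) ∈-allFin

missing : ∀ {n} → List (Fin n) → List (Fin n)
missing {n} xs = filter (λ k → ¬? (k ∈ᶠ? xs)) (allFin n)

∈-missing : ∀ {n} {xs : List (Fin n)} {k} → k ∉ xs → k ∈ missing xs
∈-missing {xs = xs} k∉ = ∈-filter⁺ (λ k → ¬? (k ∈ᶠ? xs)) (∈-allFin _) k∉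

length-missing : ∀ {n} {xs : List (Fin n)} → Unique xs → length xs + length (missing xs) ≡ n
length-missing {n} {xs} u = trans (sym (length-++ xs)) (unique∧exhaustive⇒length≡
  (++⁺ u (filter⁺ (λ k → ¬? (k ∈ᶠ? xs)) (allFin⁺ n))
    λ (k∈xs , k∈m) → proj₂ (∈-filter⁻ (λ k → ¬? (k ∈ᶠ? xs)) {xs = allFin n} k∈m) k∈xs) all∈)
  where
  all∈ : ∀ k → k ∈ xs ++ missing xs
  all∈ k with k ∈ᶠ? xs
  ... | yes k∈ = ∈-++⁺ˡ k∈
  ... | no  k∉ = ∈-++⁺ʳ xs (∈-missing k∉)

injective⇒surjective : ∀ {m n} {f : Fin m → Fin n} → m ≡ n → Injective _≡_ _≡_ f → ∀ y → ∃ λ x → f x ≡ y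
injective⇒surjective {n} {f = f} refl f-inj y =
  let (x , _ , eq) = ∈-map⁻ f (unique∧length≡⇒exhaustive {xs = map f (allFin n)} (unique-map⁺ f-inj (allFin⁺ n))
        (trans (length-map f (allFin n)) (length-allFin n)) y)
  in x , sym eq

merge : ∀ {c} {x y : Fin (suc c)} → y ≢ x → Fin (suc c) → Fin c
merge {y = y} y≢x k with y ≟ᶠ k
... | yes _   = punchOut y≢x
... | no  y≢k = punchOut y≢k

merge-glues : ∀ {c} {x y : Fin (suc c)} (y≢x : y ≢ x) → merge y≢x x ≡ merge y≢x y
merge-glues {x = x} {y} y≢x with y ≟ᶠ x | y ≟ᶠ y
... | yes eq | _      = contradiction eq y≢x
... | no _   | yes _  = punchOut-cong y refl
... | no _   | no y≢y = contradiction refl y≢y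

merge-reflects : ∀ {c} {x y : Fin (suc c)} (y≢x : y ≢ x) {k l} → merge y≢x k ≡ merge y≢x l →
                 k ≡ l ⊎ (k ≡ x × y ≡ l) ⊎ (y ≡ k × l ≡ x)
merge-reflects {y = y} y≢x {k} {l} eq with y ≟ᶠ k | y ≟ᶠ l
... | yes p   | yes q   = inj₁ (trans (sym p) q)
... | yes p   | no  y≢l = inj₂ (inj₂ (p , sym (punchOut-injective y≢x y≢l eq)))
... | no  y≢k | yes q   = inj₂ (inj₁ (punchOut-injective y≢k y≢x eq , q))
... | no  y≢k | no  y≢l = inj₁ (punchOut-injective y≢k y≢l eq)

merge-surjective : ∀ {c} {x y : Fin (suc c)} (y≢x : y ≢ x) k → ∃ λ l → merge y≢x l ≡ k
merge-surjective {y = y} y≢x k = punchIn y k , lem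
  where
  lem : merge y≢x (punchIn y k) ≡ k
  lem with y ≟ᶠ punchIn y k
  ... | yes eq = contradiction (sym eq) (punchInᵢ≢i y k)
  ... | no  _  = trans (punchOut-cong y refl) (punchOut-punchIn y)

module Forests {A E : Set} {N : ℕ} (enum : A ↔ Fin N) (src tgt : E → A) where

  Via : List E → A → A → Set
  Via T a b = ∃ λ e → e ∈ T × src e ≡ a × tgt e ≡ b

  -- `Forest T c f`: the edges T form a forest, and f maps each vertex to
  -- one of its c components.
  data Forest : List E → (c : ℕ) → (A → Fin c) → Set where
    empty : Forest [] N (Inverse.to enum)
    link  : ∀ {T c f} {e} → Forest T (suc c) f → (ne : f (tgt e) ≢ f (src e)) →
            Forest (e ∷ T) c (merge ne ∘ f)

  forest-count : ∀ {T c f} → Forest T c f → length T + c ≡ N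
  forest-count empty = refl
  forest-count (link {T} {c} F ne) = trans (sym (ℕₚ.+-suc (length T) c)) (forest-count F)

  forest-sound : ∀ {T c f e} → Forest T c f → e ∈ T → f (src e) ≡ f (tgt e)
  forest-sound (link F ne) (here refl) = merge-glues ne
  forest-sound (link F ne) (there e∈)  = cong (merge ne) (forest-sound F e∈)

  forest-unique : ∀ {T c f} → Forest T c f → Unique T
  forest-unique empty = []
  forest-unique (link F ne) = ∉⇒All≢ (λ e∈ → ne (sym (forest-sound F e∈))) ∷ forest-unique F

  forest-surjective : ∀ {T c f} → Forest T c f → ∀ k → ∃ λ a → f a ≡ k
  forest-surjective empty k = Inverse.from enum k , Inverse.strictlyInverseˡ enum k
  forest-surjective (link F ne) k with merge-surjective ne k
  ... | l , refl with forest-surjective F l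
  ... | a , refl = a , refl

  forest-complete : ∀ {T c f} → Forest T c f → ∀ {a b} → f a ≡ f b → EqClosure (Via T) a b
  forest-complete empty {a} {b} eq with refl ← ↔-injective enum eq = Eq.reflexive _
  forest-complete (link {T} {f = f} {e} F ne) eq = cases (merge-reflects ne eq)
    where
    weaken : ∀ {a b} → f a ≡ f b → EqClosure (Via (e ∷ T)) a b
    weaken eq = Eq.map (λ (e′ , e′∈ , p , q) → e′ , there e′∈ , p , q) (forest-complete F eq)
    edge : EqClosure (Via (e ∷ T)) (src e) (tgt e)
    edge = Eq.return (e , here refl , refl , refl)
    cases : ∀ {a b} → f a ≡ f b ⊎ (f a ≡ f (src e) × f (tgt e) ≡ f b) ⊎ (f (tgt e) ≡ f a × f b ≡ f (src e)) →
        EqClosure (Via (e ∷ T)) a b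
    cases (inj₁ p) = weaken p
    cases (inj₂ (inj₁ (p , q))) = Eq.transitive _ (weaken p) (Eq.transitive _ edge (weaken q))
    cases (inj₂ (inj₂ (p , q))) =
        Eq.transitive _ (weaken (sym p)) (Eq.transitive _ (Eq.symmetric _ edge) (weaken (sym q)))

  -- `size` is what the counting arguments use: a list of edges cannot lower the number of
  -- components by more than its length.
  record SpanningForest (es : List E) : Set where
    field
      tree       : List E
      components : ℕ
      component  : A → Fin components
      forest     : Forest tree components component
      joins      : ∀ {e} → e ∈ es → component (src e) ≡ component (tgt e)
      tree⊆      : ∀ {e} → e ∈ tree → e ∈ es
      size       : length tree ≤ length es

  abstract
    kruskal : ∀ es → SpanningForest es
    kruskal [] = record { tree = [] ; components = N ; component = Inverse.to enum ; forest = empty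
                        ; joins = λ () ; tree⊆ = λ () ; size = z≤n }
    kruskal (e ∷ es) with kruskal es
    ... | S with SpanningForest.component S (tgt e) ≟ᶠ SpanningForest.component S (src e)
    ... | yes eq = record { SpanningForest S hiding (joins; tree⊆; size)
                          ; joins = λ { (here refl) → sym eq ; (there e∈) → SpanningForest.joins S e∈ }
                          ; tree⊆ = there ∘ SpanningForest.tree⊆ S
                          ; size = ℕₚ.m≤n⇒m≤1+n (SpanningForest.size S) }
    kruskal (e ∷ es) | record { tree = T ; components = suc c ; component = f ; forest = F ; joins = J ; tree⊆ = ⊆es ; size = sz } | no ne =
      record { tree = e ∷ T ; components = c ; component = merge ne ∘ f ; forest = link F ne
             ; joins = λ { (here refl) → merge-glues ne ; (there e∈) → cong (merge ne) (J e∈) }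
             ; tree⊆ = λ { (here refl) → here refl ; (there e∈) → there (⊆es e∈) }
             ; size = s≤s sz }
    kruskal (e ∷ es) | record { components = zero ; component = f } | no ne with () ← f (src e)

-- Circulations on finite graphs

indicator : ∀ {P : Set} → Dec P → ℤ
indicator (yes _) = 1ℤ
indicator (no  _) = 0ℤ

indicator-yes : ∀ {P : Set} (P? : Dec P) → P → indicator P? ≡ 1ℤ
indicator-yes (yes _) p = refl
indicator-yes (no ¬p) p = contradiction p ¬p

indicator-no : ∀ {P : Set} (P? : Dec P) → ¬ P → indicator P? ≡ 0ℤ
indicator-no (yes p) ¬p = contradiction p ¬p
indicator-no (no _)  ¬p = refl

indicator⁻ : ∀ {P : Set} (P? : Dec P) → indicator P? ≡ 1ℤ → P
indicator⁻ (yes p) _ = p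

indicator-⇔ : ∀ {P Q : Set} (P? : Dec P) (Q? : Dec Q) → (P → Q) → (Q → P) → indicator P? ≡ indicator Q?
indicator-⇔ (yes p) Q? to from = sym (indicator-yes Q? (to p))
indicator-⇔ (no ¬p) Q? to from = sym (indicator-no Q? (¬p ∘ from))

sumℤ-single : ∀ {n} (f : Fin n → ℤ) i → (∀ j → j ≢ i → f j ≡ 0ℤ) → sumℤ f ≡ f i
sumℤ-single {suc n} f zero z =
    trans (cong (ℤ._+_ (f zero)) (trans (sumℤ-cong (λ j → z (suc j) λ ())) (sumℤ-0 n))) (ℤₚ.+-identityʳ _)
sumℤ-single {suc n} f (suc i) z =
    trans (cong₂ ℤ._+_ (z zero λ ()) (sumℤ-single (f ∘ suc) i λ j ne → z (suc j) (ne ∘ suc-injective))) (ℤₚ.+-identityˡ _)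

sumℤ-neg : ∀ {n} (f : Fin n → ℤ) → sumℤ (λ i → ℤ.- f i) ≡ ℤ.- sumℤ f
sumℤ-neg {zero}  f = refl
sumℤ-neg {suc n} f =
    trans (cong (ℤ._+_ (ℤ.- f zero)) (sumℤ-neg (f ∘ suc))) (sym (ℤₚ.neg-distrib-+ (f zero) (sumℤ (f ∘ suc))))

-- Kirchhoff's law for the edge weights `δ`, tested against all potentials at once. The indicator of
-- a vertex gives the law at that vertex; the proofs also test with indicators of larger sets of
-- vertices.
Balanced : ∀ {n} {A : Set} (src tgt : Fin n → A) → (Fin n → ℤ) → Set
Balanced {A = A} src tgt δ = ∀ (g : A → ℤ) → sumℤ (λ e → (g (src e) ℤ.- g (tgt e)) ℤ.* δ e) ≡ 0ℤ

-- Only the term of `e` survives in the sum, because every other edge has weight zero or no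
-- potential difference.
balanced-at : ∀ {n} {A : Set} {src tgt : Fin n → A} {δ} → Balanced src tgt δ → ∀ (g : A → ℤ) e →
              (∀ e′ → e′ ≢ e → δ e′ ≡ 0ℤ ⊎ g (src e′) ≡ g (tgt e′)) → g (src e) ≢ g (tgt e) → δ e ≡ 0ℤ
balanced-at {src = src} {tgt} {δ} bal g e others ne =
  [ (λ eq → contradiction (ℤₚ.i-j≡0⇒i≡j (g (src e)) (g (tgt e)) eq) ne) , id ]′
  (ℤₚ.i*j≡0⇒i≡0∨j≡0 (g (src e) ℤ.- g (tgt e)) (trans (sym (sumℤ-single _ e zeros)) (bal g)))
  where
  zeros : ∀ e′ → e′ ≢ e → (g (src e′) ℤ.- g (tgt e′)) ℤ.* δ e′ ≡ 0ℤ
  zeros e′ e′≢e with others e′ e′≢e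
  ... | inj₁ z = trans (cong ((g (src e′) ℤ.- g (tgt e′)) ℤ.*_) z) (ℤₚ.*-zeroʳ (g (src e′) ℤ.- g (tgt e′)))
  ... | inj₂ q = trans (cong (ℤ._* δ e′) (ℤₚ.i≡j⇒i-j≡0 {g (src e′)} q)) (ℤₚ.*-zeroˡ (δ e′))

-- A forest carries no circulation. Among the edges of the forest, the potential that is 1 on the
-- component of `src e₀` before linking changes across the last edge `e₀` alone. So `e₀` has weight
-- zero and can be removed.
forest-flow : ∀ {n N} {A : Set} (enum : A ↔ Fin N) (src tgt : Fin n → A) → let open Forests enum src tgt in
              ∀ {T c f} → Forest T c f → ∀ {δ} → Balanced src tgt δ → (∀ e → e ∉ T → δ e ≡ 0ℤ) → ∀ e → δ e ≡ 0ℤ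
forest-flow enum src tgt Forests.empty bal off e = off e λ ()
forest-flow enum src tgt (Forests.link {T} {f = f} {e₀} F ne) {δ} bal off =
  forest-flow enum src tgt F bal off′
  where
  open Forests enum src tgt
  g : _ → ℤ
  g a = indicator (f a ≟ᶠ f (src e₀))
  δe₀ : δ e₀ ≡ 0ℤ
  δe₀ =
      balanced-at bal g e₀ others λ eq → ne (indicator⁻ (f (tgt e₀) ≟ᶠ f (src e₀)) (trans (sym eq) (indicator-yes (f (src e₀) ≟ᶠ f (src e₀)) refl)))
    where
    others : ∀ e → e ≢ e₀ → δ e ≡ 0ℤ ⊎ g (src e) ≡ g (tgt e)
    others e e≢ with e ∈ᶠ? T
    ... | yes e∈ = inj₂ (cong (λ k → indicator (k ≟ᶠ f (src e₀))) (forest-sound F e∈))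
    ... | no  e∉ = inj₁ (off e λ { (here p) → e≢ p ; (there q) → e∉ q })
  off′ : ∀ e → e ∉ T → δ e ≡ 0ℤ
  off′ e e∉ with e ≟ᶠ e₀
  ... | yes refl = δe₀
  ... | no  e≢   = off e λ { (here p) → e≢ p ; (there q) → e∉ q }

sumℤ-++ : ∀ m {n} (f : Fin (m + n) → ℤ) → sumℤ f ≡ sumℤ (f ∘ (_↑ˡ n)) ℤ.+ sumℤ (f ∘ (m ↑ʳ_))
sumℤ-++ zero    f = sym (ℤₚ.+-identityˡ _)
sumℤ-++ (suc m) f = trans (cong (ℤ._+_ (f zero)) (sumℤ-++ m (f ∘ suc))) (sym (ℤₚ.+-assoc (f zero) _ _))

-- Strands, boundary walks and Seifert circles

opposite-involutive : ∀ x → opposite (opposite x) ≡ x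
opposite-involutive left  = refl
opposite-involutive right = refl

side↔Fin2 : Side ↔ Fin 2
side↔Fin2 = mk↔ₛ′ (λ { left → zero ; right → suc zero }) (λ { zero → left ; (suc _) → right })
  (λ { zero → refl ; (suc zero) → refl }) (λ { left → refl ; right → refl })

finite×side : ∀ {A : Set} {k} → A ↔ Fin k → (A × Side) ↔ Fin (k * 2)
finite×side A↔ = ↔-sym *↔× ↔-∘ (A↔ ×-↔ side↔Fin2)

module DiagramFacts (L : Diagram) where
  open Diagram L

  arc-sum : ∀ (F : End → ℤ) → sumℤ (λ c → F (c , left)) ℤ.+ sumℤ (λ c → F (c , right)) ≡
                              sumℤ (λ c → F (from (c , left))) ℤ.+ sumℤ (λ c → F (from (c , right)))
  arc-sum F = begin
    sumℤ (λ c → F (c , left)) ℤ.+ sumℤ (λ c → F (c , right))                 ≡⟨ split F ⟨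
    sumℤ (F ∘ end)                                                            ≡⟨ sumℤ-permute (F ∘ end) π ⟩
    sumℤ (λ k → F (end (Inverse.to ends (from (end k)))))                     ≡⟨ sumℤ-cong (λ k → cong F (Inverse.strictlyInverseʳ ends (from (end k)))) ⟩
    sumℤ (F ∘ from ∘ end)                                                     ≡⟨ split (F ∘ from) ⟩
    sumℤ (λ c → F (from (c , left))) ℤ.+ sumℤ (λ c → F (from (c , right)))    ∎
    where
    open ≡-Reasoning
    pair : Crossing ⊎ Crossing → End
    pair (inj₁ c) = c , left
    pair (inj₂ c) = c , right
    ends : End ↔ Fin (crossings + crossings)
    ends = ↔-sym +↔⊎ ↔-∘ mk↔ₛ′ (λ { (c , left) → inj₁ c ; (c , right) → inj₂ c }) pair
      (λ { (inj₁ c) → refl ; (inj₂ c) → refl }) (λ { (c , left) → refl ; (c , right) → refl })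
    end : Fin (crossings + crossings) → End
    end = Inverse.from ends
    π : Fin (crossings + crossings) ↔ Fin (crossings + crossings)
    π = ends ↔-∘ (↔-sym arc ↔-∘ ↔-sym ends)
    split : ∀ (G : End → ℤ) → sumℤ (G ∘ end) ≡ sumℤ (λ c → G (c , left)) ℤ.+ sumℤ (λ c → G (c , right))
    split G = trans (sumℤ-++ crossings (G ∘ end)) (cong₂ ℤ._+_
      (sumℤ-cong λ c → cong (G ∘ pair) (splitAt-↑ˡ crossings c crossings))
      (sumℤ-cong λ c → cong (G ∘ pair) (splitAt-↑ʳ crossings crossings c)))

  strand-sum : ∀ x (Q : Segment → ℤ) → (∀ c → Q (incoming c (opposite x)) ≡ Q (outgoing c (opposite x))) →
               sumℤ (λ c → Q (outgoing c x)) ≡ sumℤ (λ c → Q (incoming c x))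
  strand-sum left  Q eq = ℤ-cancelʳ (sumℤ λ c → Q (outgoing c right)) _ _
    (trans (arc-sum (Q ∘ inj₁)) (cong (ℤ._+_ (sumℤ λ c → Q (incoming c left))) (sumℤ-cong eq)))
  strand-sum right Q eq = ℤ-cancelˡ (sumℤ λ c → Q (outgoing c left)) _ _
    (trans (arc-sum (Q ∘ inj₁)) (cong (λ z → z ℤ.+ (sumℤ λ c → Q (incoming c right))) (sumℤ-cong eq)))

  walk-corner : ∀ c k → boundary (proj₁ (cornerFlanks c k)) ≡ boundary (proj₂ (cornerFlanks c k))
  walk-corner c k = Equivalence.from (boundary-walk _ _) (Eq.return (c , k , refl))

  walk-invariant : ∀ {X : Set} (q : Flank → X) →
      (∀ c k → q (proj₁ (cornerFlanks c k)) ≡ q (proj₂ (cornerFlanks c k))) →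
                   ∀ {f g} → boundary f ≡ boundary g → q f ≡ q g
  walk-invariant q inv {f} {g} eq = Eq.gfold isEquivalence q
    (λ { (c , k , eq) → trans (cong q (sym (cong proj₁ eq))) (trans (inv c k) (cong q (cong proj₂ eq))) })
    (Equivalence.to (boundary-walk f g) eq)

  topWalk bottomWalk : Crossing → Fin boundaries
  topWalk    c = boundary (outgoing c left , right)
  bottomWalk c = boundary (incoming c left , right)

  inner-top : ∀ c x → boundary (outgoing c x , opposite x) ≡ topWalk c
  inner-top c left  = refl
  inner-top c right = sym (walk-corner c top)

  inner-bottom : ∀ c x → boundary (incoming c x , opposite x) ≡ bottomWalk c
  inner-bottom c left  = refl
  inner-bottom c right = sym (walk-corner c bottom)

  outer : ∀ c x → boundary (incoming c x , x) ≡ boundary (outgoing c x , x)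
  outer c left  = walk-corner c left
  outer c right = walk-corner c right

  CircleInvariant : ∀ {X : Set} → (Segment → X) → Set
  CircleInvariant q = ∀ c x → q (incoming c x) ≡ q (outgoing c x)

  -- On the side `opposite x` of a Seifert circle, the boundary walk jumps from `bottomWalk` to
  -- `topWalk` wherever the circle is the strand `x` of a crossing, and stays the same where it is
  -- the other strand. Hence the differences of `g` telescope around each circle, on which `q` is
  -- constant.
  strand-balanced : ∀ x (q : Segment → ℤ) → CircleInvariant q → Balanced topWalk bottomWalk (λ c → q (outgoing c x))
  strand-balanced x q inv g = begin
    sumℤ (λ c → (g (topWalk c) ℤ.- g (bottomWalk c)) ℤ.* q (outgoing c x))   ≡⟨ sumℤ-cong (λ c → expand (g (topWalk c)) (g (bottomWalk c)) (q (outgoing c x))) ⟩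
    sumℤ (λ c → g (topWalk c) ℤ.* q (outgoing c x) ℤ.+ ℤ.- (g (bottomWalk c) ℤ.* q (outgoing c x)))
                                                                             ≡⟨ sumℤ-cong (λ c → cong₂ (λ a b → a ℤ.+ ℤ.- b)
                                                                                  (cong (λ β → g β ℤ.* q (outgoing c x)) (sym (inner-top c x)))
                                                                                  (cong₂ ℤ._*_ (cong g (sym (inner-bottom c x))) (sym (inv c x)))) ⟩
    sumℤ (λ c → Q (outgoing c x) ℤ.+ ℤ.- Q (incoming c x))                   ≡⟨ sumℤ-+ (λ c → Q (outgoing c x)) (λ c → ℤ.- Q (incoming c x)) ⟩
    sumℤ (λ c → Q (outgoing c x)) ℤ.+ sumℤ (λ c → ℤ.- Q (incoming c x))      ≡⟨ cong (ℤ._+_ (sumℤ (λ c → Q (outgoing c x)))) (sumℤ-neg (λ c → Q (incoming c x))) ⟩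
    sumℤ (λ c → Q (outgoing c x)) ℤ.- sumℤ (λ c → Q (incoming c x))          ≡⟨ ℤₚ.i≡j⇒i-j≡0 (strand-sum x Q λ c → cong₂ ℤ._*_ (cong g (outer c (opposite x))) (inv c (opposite x))) ⟩
    0ℤ                                                                       ∎
    where
    open ≡-Reasoning
    Q : Segment → ℤ
    Q s = g (boundary (s , opposite x)) ℤ.* q s
    expand : ∀ a b d → (a ℤ.- b) ℤ.* d ≡ a ℤ.* d ℤ.+ ℤ.- (b ℤ.* d)
    expand = ℤ-Solver.solve-∀

  -- Subtracting the two strands makes the circulation vanish at every crossing where `q₁` and `q₂`
  -- agree. This is how it comes to be supported on a forest.
  band-balanced : ∀ (q₁ q₂ : Segment → ℤ) → CircleInvariant q₁ → CircleInvariant q₂ →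
                  Balanced topWalk bottomWalk (λ c → q₁ (outgoing c right) ℤ.- q₂ (outgoing c left))
  band-balanced q₁ q₂ inv₁ inv₂ g = begin
    sumℤ (λ c → G c ℤ.* (q₁ (outgoing c right) ℤ.- q₂ (outgoing c left)))    ≡⟨ sumℤ-cong (λ c → expand (G c) (q₁ (outgoing c right)) (q₂ (outgoing c left))) ⟩
    sumℤ (λ c → G c ℤ.* q₁ (outgoing c right) ℤ.+ ℤ.- (G c ℤ.* q₂ (outgoing c left)))
                                                                             ≡⟨ sumℤ-+ (λ c → G c ℤ.* q₁ (outgoing c right)) (λ c → ℤ.- (G c ℤ.* q₂ (outgoing c left))) ⟩
    _                                                                        ≡⟨ cong₂ ℤ._+_ (strand-balanced right q₁ inv₁ g)
                                                                                  (trans (sumℤ-neg (λ c → G c ℤ.* q₂ (outgoing c left))) (cong ℤ.-_ (strand-balanced left q₂ inv₂ g))) ⟩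
    0ℤ                                                                       ∎
    where
    open ≡-Reasoning
    G : Crossing → ℤ
    G c = g (topWalk c) ℤ.- g (bottomWalk c)
    expand : ∀ a b d → a ℤ.* (b ℤ.- d) ≡ a ℤ.* b ℤ.+ ℤ.- (a ℤ.* d)
    expand = ℤ-Solver.solve-∀

  segments : Segment ↔ Fin (crossings * 2 + circles)
  segments = ↔-sym +↔⊎ ↔-∘ (finite×side (↔-id _) ⊎-↔ ↔-id _)

  -- With every segment serving as the edge to its successor, the connected components are the
  -- Seifert circles.
  module Circles = Forests segments id (nextSegment {L})

  abstract
    circleForest : Circles.SpanningForest (map (Inverse.from segments) (allFin _))
    circleForest = Circles.kruskal _

  open Circles.SpanningForest circleForest public using () renaming (components to seifertCircles; component to circle)

  circle-invariant : CircleInvariant circle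
  circle-invariant c x = trans
    (Circles.SpanningForest.joins circleForest {incoming c x}
      (subst (_∈ map (Inverse.from segments) (allFin _)) (Inverse.strictlyInverseʳ segments _) (∈-map⁺ (Inverse.from segments) (∈-allFin _))))
    (cong (circle ∘ inj₁) (Inverse.strictlyInverseˡ arc (c , x)))

  next-invariant : ∀ {X : Set} (q : Segment → X) → CircleInvariant q → ∀ s → q s ≡ q (nextSegment {L} s)
  next-invariant q inv (inj₁ e) = trans (cong (q ∘ inj₁) (sym (Inverse.strictlyInverseʳ arc e))) (inv _ _)
  next-invariant q inv (inj₂ j) = refl

  circle-connected : ∀ {X : Set} (q : Segment → X) → CircleInvariant q → ∀ {s s′} → circle s ≡ circle s′ → q s ≡ q s′
  circle-connected q inv eq = Eq.gfold isEquivalence q (λ { (s , _ , refl , refl) → next-invariant q inv s })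
    (Circles.forest-complete (Circles.SpanningForest.forest circleForest) eq)

-- Every Seifert circle separates the sphere

module Planarity (L : Diagram) (base : Diagram.Segment L) where
  open Diagram L
  open DiagramFacts L public

  abstract
    -- A region without flanks would be adjacent to nothing, hence the only region; the flanks of
    -- `base` exclude this.
    flank-in : ∀ ρ → ∃ λ f → region f ≡ ρ
    flank-in ρ = walk (connected (region (base , left)) ρ) ((base , left) , refl)
      where
      walk : ∀ {ρ ρ′} → EqClosure Adjacent ρ ρ′ → (∃ λ f → region f ≡ ρ) → ∃ λ f → region f ≡ ρ′
      walk ε hyp = hyp
      walk (fwd (s , _ , eq) ◅ p) _ = walk p ((s , right) , eq)
      walk (bwd (s , eq , _) ◅ p) _ = walk p ((s , left) , eq)

  walkIn : Region → Fin boundaries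
  walkIn ρ = boundary (proj₁ (flank-in ρ))

  boundaryRegion-walkIn : ∀ ρ → boundaryRegion (walkIn ρ) ≡ ρ
  boundaryRegion-walkIn ρ = proj₂ (flank-in ρ)

  walkIn-injective : Injective _≡_ _≡_ walkIn
  walkIn-injective {ρ} {ρ′} eq =
      trans (sym (boundaryRegion-walkIn ρ)) (trans (cong boundaryRegion eq) (boundaryRegion-walkIn ρ′))

  -- Every region has a boundary walk, so `regions ≤ boundaries`, and `euler` does the rest.
  -- Equality means one walk per region, that is, a connected diagram.
  2+crossings≤regions : 2 + crossings ≤ regions
  2+crossings≤regions = ℕₚ.+-cancelʳ-≤ regions _ _ (begin
    2 + crossings + regions       ≤⟨ ℕₚ.+-monoʳ-≤ (2 + crossings) (injective⇒≤ walkIn-injective) ⟩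
    2 + crossings + boundaries    ≡⟨ shuffle crossings boundaries ⟩
    crossings + boundaries + 2    ≡⟨ euler ⟨
    2 * regions                   ≡⟨ cong (regions +_) (ℕₚ.+-identityʳ regions) ⟩
    regions + regions             ∎)
    where
    open ℕₚ.≤-Reasoning
    shuffle : ∀ n b → 2 + n + b ≡ n + b + 2
    shuffle = solve-∀

  -- `Bands` and `Cotree` are dual. A crossing joins the walks at its top and bottom corners; after
  -- smoothing, the arc across this band joins the right side of the left circle to the left side of
  -- the right circle. The crossings outside a spanning forest of `Bands` should then connect as
  -- much of `Cotree` as all crossings do, which is the content of `circleSide-band`.
  module Bands = Forests (↔-id (Fin boundaries)) topWalk bottomWalk
  module Cotree = Forests (finite×side (↔-id (Fin seifertCircles)))
                          (λ c → circle (outgoing c left) , right) (λ c → circle (outgoing c right) , left)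

  private
    abstract
      bands : Bands.SpanningForest (allFin crossings)
      bands = Bands.kruskal _

    open Bands.SpanningForest bands using (tree; forest; joins) renaming (components to v; component to f)

    abstract
      cotree : Cotree.SpanningForest (missing tree)
      cotree = Cotree.kruskal _

    module C = Cotree.SpanningForest cotree

    circleSide : Flank → Fin C.components
    circleSide (s , x) = C.component (circle s , x)

    circleSide-invariant : ∀ x → CircleInvariant (λ s → circleSide (s , x))
    circleSide-invariant x c y = cong (λ k → C.component (k , x)) (circle-invariant c y)

    -- A band of the tree cuts its tree in two, and the flow of the two
    -- strands through the regions of either part must vanish.
    circleSide-band : ∀ c → circleSide (outgoing c left , right) ≡ circleSide (outgoing c right , left)
    circleSide-band c = sym (indicator⁻ (circleSide (outgoing c right , left) ≟ᶠ k)
      (trans (ℤₚ.i-j≡0⇒i≡j _ _ (δ≡0 c)) (indicator-yes (k ≟ᶠ k) refl)))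
      where
      k = circleSide (outgoing c left , right)
      q₁ q₂ : Segment → ℤ
      q₁ s = indicator (circleSide (s , left) ≟ᶠ k)
      q₂ s = indicator (circleSide (s , right) ≟ᶠ k)
      δ≡0 : ∀ c → q₁ (outgoing c right) ℤ.- q₂ (outgoing c left) ≡ 0ℤ
      δ≡0 = forest-flow (↔-id _) topWalk bottomWalk forest
        (band-balanced q₁ q₂ (λ c x → cong (λ l → indicator (l ≟ᶠ k)) (circleSide-invariant left c x))
                             (λ c x → cong (λ l → indicator (l ≟ᶠ k)) (circleSide-invariant right c x)))
        (λ c c∉ → ℤₚ.i≡j⇒i-j≡0 (cong (λ l → indicator (l ≟ᶠ k)) (sym (C.joins (∈-missing c∉)))))

    circleSide-corner : ∀ c k → circleSide (proj₁ (cornerFlanks c k)) ≡ circleSide (proj₂ (cornerFlanks c k))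
    circleSide-corner c top    = circleSide-band c
    circleSide-corner c bottom =
        trans (circleSide-invariant right c left) (trans (circleSide-band c) (sym (circleSide-invariant left c right)))
    circleSide-corner c left   = circleSide-invariant left c left
    circleSide-corner c right  = circleSide-invariant right c right

    circleSide-component : ∀ g h → f (boundary g) ≡ f (boundary h) → circleSide g ≡ circleSide h
    circleSide-component g h eq =
      trans (sym (onWalk-boundary g)) (trans (Eq.gfold isEquivalence onWalk edge (Bands.forest-complete forest eq)) (onWalk-boundary h))
      where
      onWalk : Fin boundaries → Fin C.components
      onWalk β = circleSide (proj₁ (boundary-surjective β))
      onWalk-boundary : ∀ g → onWalk (boundary g) ≡ circleSide g
      onWalk-boundary g = walk-invariant circleSide circleSide-corner (proj₂ (boundary-surjective (boundary g)))
      edge : ∀ {β β′} → Bands.Via tree β β′ → onWalk β ≡ onWalk β′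
      edge (c , _ , refl , refl) =
          trans (onWalk-boundary _) (trans (sym (circleSide-invariant right c left)) (sym (onWalk-boundary _)))

    -- Each class of circle sides is that of some flank, and flanks in one component of `Bands` have
    -- the same class. So different classes select different components.
    cotree≤bands : C.components ≤ v
    cotree≤bands = injective⇒≤ {f = λ k → f (boundary (flank k))} λ {k} {l} eq →
      trans (sym (circleSide-flank k)) (trans (circleSide-component _ _ eq) (circleSide-flank l))
      where
      onCircle : ∀ k → ∃ λ s → circle s ≡ k
      onCircle = Circles.forest-surjective (Circles.SpanningForest.forest circleForest)
      flank : Fin C.components → Flank
      flank k = let (k′ , x) = proj₁ (Cotree.forest-surjective C.forest k) in proj₁ (onCircle k′) , x
      circleSide-flank : ∀ k → circleSide (flank k) ≡ k
      circleSide-flank k = let ((k′ , x) , eq) = Cotree.forest-surjective C.forest k in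
        trans (cong (λ l → C.component (l , x)) (proj₂ (onCircle k′))) eq

  -- Past a crossing, a fixed side of a Seifert circle either follows a horizontal corner and stays
  -- in its region, or moves from the bottom to the top region.
  band-invariant : ∀ {X : Set} (q : Region → X) → (∀ c → q (cornerRegion c top) ≡ q (cornerRegion c bottom)) →
                   ∀ x → CircleInvariant (λ s → q (region (s , x)))
  band-invariant q band left  c left  = cong (q ∘ boundaryRegion) (outer c left)
  band-invariant q band right c right = cong (q ∘ boundaryRegion) (outer c right)
  band-invariant q band left  c right = trans (cong (q ∘ boundaryRegion) (inner-bottom c right))
    (trans (sym (band c)) (cong (q ∘ boundaryRegion) (sym (inner-top c right))))
  band-invariant q band right c left  = sym (band c)

  -- A combinatorial Jordan curve theorem: the labels can change only across the Seifert circle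
  -- through `s`, and there they do.
  record Separation (s : Segment) : Set where
    field
      parts     : ℕ
      part      : Region → Fin parts
      part-band : ∀ c → part (cornerRegion c top) ≡ part (cornerRegion c bottom)
      part-off  : ∀ s′ → circle s′ ≢ circle s → part (region (s′ , left)) ≡ part (region (s′ , right))
      part-on   : part (region (s , left)) ≢ part (region (s , right))

  private
    -- The estimate is j + s′ + 2 ≤ v, where 1 + s′ is the number of Seifert
    -- circles and j that of the surplus boundary walks of disconnected
    -- diagrams; so w ≥ 2 components are left of the v when the walks of each
    -- region are joined and all circles but one are crossed.
    v-bound : ∀ {t m t₂ c₂ j s′ q w} → t + v ≡ boundaries → t + m ≡ crossings → t₂ + c₂ ≡ (1 + s′) * 2 → t₂ ≤ m →
              c₂ ≤ v → regions + j ≡ boundaries → q + w ≡ v → q ≤ j + s′ → 2 ≤ w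
    v-bound {t} {m} {t₂} {c₂} {j} {s′} {q} {w} e₁ e₂ e₃ l₁ l₂ e₄ e₅ l₃ =
      ℕₚ.*-cancelˡ-≤ 2 (ℕₚ.+-cancelʳ-≤ (v + (m + 2 * j)) (2 * 2) (2 * w) (begin
        4 + (v + (m + 2 * j))              ≡⟨ r₃ v m j ⟩
        2 + (v + (m + 2 * j + 2))          ≡⟨ cong (λ a → 2 + (v + a)) v≡ ⟨
        2 + (v + v)                        ≡⟨ cong (λ a → 2 + (a + a)) e₅ ⟨
        2 + ((q + w) + (q + w))            ≤⟨ ℕₚ.+-monoʳ-≤ 2 (ℕₚ.+-mono-≤ (ℕₚ.+-monoˡ-≤ w l₃) (ℕₚ.+-monoˡ-≤ w l₃)) ⟩
        2 + ((j + s′ + w) + (j + s′ + w))  ≡⟨ r₄ j s′ w ⟩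
        2 * w + 2 * j + (1 + s′) * 2       ≡⟨ cong (2 * w + 2 * j +_) e₃ ⟨
        2 * w + 2 * j + (t₂ + c₂)          ≤⟨ ℕₚ.+-monoʳ-≤ (2 * w + 2 * j) (ℕₚ.+-mono-≤ l₁ l₂) ⟩
        2 * w + 2 * j + (m + v)            ≡⟨ r₅ w j m v ⟩
        2 * w + (v + (m + 2 * j))          ∎))
      where
      open ℕₚ.≤-Reasoning
      r₁ : ∀ r j n → n + (r + j) + 2 ≡ r + (n + j + 2)
      r₁ = solve-∀
      r₂ : ∀ t m j → t + m + j + 2 + j ≡ t + (m + 2 * j + 2)
      r₂ = solve-∀
      r₃ : ∀ v m j → 4 + (v + (m + 2 * j)) ≡ 2 + (v + (m + 2 * j + 2))
      r₃ = solve-∀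
      r₄ : ∀ j s w → 2 + ((j + s + w) + (j + s + w)) ≡ 2 * w + 2 * j + (1 + s) * 2
      r₄ = solve-∀
      r₅ : ∀ w j m v → 2 * w + 2 * j + (m + v) ≡ 2 * w + (v + (m + 2 * j))
      r₅ = solve-∀
      regions≡ : regions ≡ crossings + j + 2
      regions≡ = ℕₚ.+-cancelˡ-≡ regions _ _ (trans (cong (regions +_) (sym (ℕₚ.+-identityʳ regions))) (trans euler
        (trans (cong (λ a → crossings + a + 2) (sym e₄)) (r₁ regions j crossings))))
      v≡ : v ≡ m + 2 * j + 2
      v≡ = ℕₚ.+-cancelˡ-≡ t _ _ (trans e₁ (trans (sym e₄) (trans (cong (_+ j) regions≡)
        (trans (cong (λ a → a + j + 2 + j) (sym e₂)) (r₂ t m j)))))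

  separation : ∀ s → Separation s
  separation s = record
    { parts = K.components
    ; part = part
    ; part-band = part-band
    ; part-off = part-off
    ; part-on = λ eq → ≤1⇒⊥ K.components (part-constant eq) part-surjective 2≤components
    }
    where
    module Quotient = Forests (↔-id (Fin v)) (proj₁ {B = λ _ → Fin v}) proj₂
    nonRoots : List (Fin boundaries)
    nonRoots = missing (map walkIn (allFin regions))
    otherCircles : List (Fin seifertCircles)
    otherCircles = missing [ circle s ]
    onCircle : ∀ k → ∃ λ s → circle s ≡ k
    onCircle = Circles.forest-surjective (Circles.SpanningForest.forest circleForest)
    join-edge : Fin boundaries → Fin v × Fin v
    join-edge β = f β , f (walkIn (boundaryRegion β))
    circle-edge : Fin seifertCircles → Fin v × Fin v
    circle-edge k = let s = proj₁ (onCircle k) in f (boundary (s , left)) , f (boundary (s , right))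
    edges : List (Fin v × Fin v)
    edges = map join-edge nonRoots ++ map circle-edge otherCircles
    K : Quotient.SpanningForest edges
    K = Quotient.kruskal edges
    module K = Quotient.SpanningForest K

    2≤components : 2 ≤ K.components
    2≤components = v-bound {s′ = length otherCircles}
      (Bands.forest-count forest) (length-missing (Bands.forest-unique forest))
      (trans (Cotree.forest-count C.forest) (cong (_* 2) (sym (length-missing {xs = [ circle s ]} ([] ∷ [])))))
      C.size cotree≤bands
      (trans (cong (_+ length nonRoots) (sym (trans (length-map walkIn (allFin regions)) (length-allFin regions))))
             (length-missing (unique-map⁺ walkIn-injective (allFin⁺ regions))))
      (Quotient.forest-count K.forest)
      (ℕₚ.≤-trans K.size (ℕₚ.≤-reflexive (trans (length-++ (map join-edge nonRoots))
        (cong₂ _+_ (length-map join-edge nonRoots) (length-map circle-edge otherCircles)))))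

    part : Region → Fin K.components
    part ρ = K.component (f (walkIn ρ))

    part-walk : ∀ β → part (boundaryRegion β) ≡ K.component (f β)
    part-walk β with β ∈ᶠ? map walkIn (allFin regions)
    ... | no  β∉ = sym (K.joins (∈-++⁺ˡ (∈-map⁺ join-edge (∈-missing β∉))))
    ... | yes β∈ with ∈-map⁻ walkIn β∈
    ... | ρ , _ , refl = cong part (boundaryRegion-walkIn ρ)

    part-band : ∀ c → part (cornerRegion c top) ≡ part (cornerRegion c bottom)
    part-band c = trans (part-walk _) (trans (cong K.component (joins (∈-allFin c))) (sym (part-walk _)))

    part-invariant : ∀ x → CircleInvariant (λ s → part (region (s , x)))
    part-invariant = band-invariant part part-band

    part-off : ∀ s′ → circle s′ ≢ circle s → part (region (s′ , left)) ≡ part (region (s′ , right))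
    part-off s′ ne = trans (sym (rep left)) (trans joined (rep right))
      where
      r = proj₁ (onCircle (circle s′))
      rep : ∀ x → part (region (r , x)) ≡ part (region (s′ , x))
      rep x = circle-connected (λ s → part (region (s , x))) (part-invariant x) (proj₂ (onCircle (circle s′)))
      joined : part (region (r , left)) ≡ part (region (r , right))
      joined = trans (part-walk _) (trans (K.joins (∈-++⁺ʳ (map join-edge nonRoots)
        (∈-map⁺ circle-edge (∈-missing λ { (here eq) → ne eq })))) (sym (part-walk _)))

    part-constant : part (region (s , left)) ≡ part (region (s , right)) → ∀ ρ ρ′ → part ρ ≡ part ρ′
    part-constant eq ρ ρ′ = Eq.gfold isEquivalence part (λ { (s′ , refl , refl) → across s′ }) (connected ρ ρ′)
      where
      across : ∀ s′ → part (region (s′ , left)) ≡ part (region (s′ , right))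
      across s′ with circle s′ ≟ᶠ circle s
      ... | no ne = part-off s′ ne
      ... | yes same = trans (circle-connected (λ s → part (region (s , left))) (part-invariant left) same)
        (trans eq (circle-connected (λ s → part (region (s , right))) (part-invariant right) (sym same)))

    part-surjective : ∀ k → ∃ λ ρ → part ρ ≡ k
    part-surjective k with Quotient.forest-surjective K.forest k
    ... | l , refl with Bands.forest-surjective forest l
    ... | β , refl = boundaryRegion β , part-walk β

    ≤1⇒⊥ : ∀ w {p : Region → Fin w} → (∀ ρ ρ′ → p ρ ≡ p ρ′) → (∀ k → ∃ λ ρ → p ρ ≡ k) → 2 ≤ w → ⊥
    ≤1⇒⊥ (suc (suc w)) const surj _ with surj zero | surj (suc zero)
    ... | ρ , eq | ρ′ , eq′ = 0≢1+n (trans (sym eq) (trans (const ρ ρ′) eq′))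
    ≤1⇒⊥ (suc zero) _ _ (s≤s ())

-- Weights of states

alternating : ℕ → ℤ
alternating zero    = 1ℤ
alternating (suc n) = ℤ.- alternating n

sgn : ℤ → ℤ
sgn (⁺ n)    = alternating n
sgn -[1+ n ] = alternating (suc n)

alternating-+ : ∀ m n → alternating (m + n) ≡ alternating m ℤ.* alternating n
alternating-+ zero    n = sym (ℤₚ.*-identityˡ _)
alternating-+ (suc m) n = trans (cong ℤ.-_ (alternating-+ m n)) (ℤₚ.neg-distribˡ-* (alternating m) (alternating n))

sgn-⊖ : ∀ m n → sgn (m ⊖ n) ≡ alternating m ℤ.* alternating n
sgn-⊖ m       zero    = sym (ℤₚ.*-identityʳ _)
sgn-⊖ zero    (suc n) = sym (ℤₚ.*-identityˡ _)
sgn-⊖ (suc m) (suc n) =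
    trans (cong sgn (ℤₚ.[1+m]⊖[1+n]≡m⊖n m n)) (trans (sgn-⊖ m n) (negate (alternating m) (alternating n)))
  where
  negate : ∀ a b → a ℤ.* b ≡ (ℤ.- a) ℤ.* (ℤ.- b)
  negate = ℤ-Solver.solve-∀

sgn-+ : ∀ i j → sgn (i ℤ.+ j) ≡ sgn i ℤ.* sgn j
sgn-+ (⁺ m)    (⁺ n)    = alternating-+ m n
sgn-+ (⁺ m)    -[1+ n ] = sgn-⊖ m (suc n)
sgn-+ -[1+ m ] (⁺ n)    = trans (sgn-⊖ n (suc m)) (ℤₚ.*-comm (alternating n) (alternating (suc m)))
sgn-+ -[1+ m ] -[1+ n ] = trans (cong (alternating ∘ suc) (sym (ℕₚ.+-suc m n))) (alternating-+ (suc m) (suc n))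

alternating-unit : ∀ n → alternating n ≡ 1ℤ ⊎ alternating n ≡ -1ℤ
alternating-unit zero = inj₁ refl
alternating-unit (suc n) with alternating-unit n
... | inj₁ eq = inj₂ (cong ℤ.-_ eq)
... | inj₂ eq = inj₁ (cong ℤ.-_ eq)

sgn-unit : ∀ i → sgn i ≡ 1ℤ ⊎ sgn i ≡ -1ℤ
sgn-unit (⁺ n)    = alternating-unit n
sgn-unit -[1+ n ] = alternating-unit (suc n)

-- Corners that contribute t^{1/2} and t^{-1/2}.
plus minus : Overstrand → Corner → ℕ
plus ↗ top    = 1
plus ↖ bottom = 1
plus _ _      = 0
minus ↗ bottom = 1
minus ↖ top    = 1
minus _ _      = 0

vertical : Corner → ℕ
vertical top    = 1
vertical bottom = 1
vertical left   = 0
vertical right  = 0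

plus+minus : ∀ o k → plus o k + minus o k ≡ vertical k
plus+minus ↗ top    = refl
plus+minus ↗ bottom = refl
plus+minus ↗ left   = refl
plus+minus ↗ right  = refl
plus+minus ↖ top    = refl
plus+minus ↖ bottom = refl
plus+minus ↖ left   = refl
plus+minus ↖ right  = refl

-- At the bottom of ↖ both 1 and -1 would give the right sign. With -1, the exponent of a corner
-- plus twice this number depends only on the crossing and the colour of the corner, as
-- `exponent-colour` records.
signExponent : Overstrand → Corner → ℤ
signExponent ↗ bottom = 1ℤ
signExponent ↖ bottom = -1ℤ
signExponent _ _      = 0ℤ

cornerWeight≡ : ∀ o k → cornerWeight o k ≡ (sgn (signExponent o k) , ⁺ plus o k ℤ.- ⁺ minus o k)
cornerWeight≡ ↗ top    = refl
cornerWeight≡ ↗ bottom = refl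
cornerWeight≡ ↗ left   = refl
cornerWeight≡ ↗ right  = refl
cornerWeight≡ ↖ top    = refl
cornerWeight≡ ↖ bottom = refl
cornerWeight≡ ↖ left   = refl
cornerWeight≡ ↖ right  = refl

other : Overstrand → Overstrand
other ↗ = ↖
other ↖ = ↗

_≟ᵒ_ : ∀ (o o′ : Overstrand) → Dec (o ≡ o′)
↗ ≟ᵒ ↗ = yes refl
↗ ≟ᵒ ↖ = no λ ()
↖ ≟ᵒ ↗ = no λ ()
↖ ≟ᵒ ↖ = yes refl

-- The checkerboard colour of a corner, named so that the vertical corners of
-- a crossing have the colour `over c`.
cornerColour : Overstrand → Corner → Overstrand
cornerColour o top    = o
cornerColour o bottom = o
cornerColour o left   = other o
cornerColour o right  = other o

exponent-colour : ∀ o k → (⁺ plus o k ℤ.- ⁺ minus o k) ℤ.+ (signExponent o k ℤ.+ signExponent o k) ≡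
                          indicator (cornerColour o k ≟ᵒ ↗) ℤ.- indicator (o ≟ᵒ ↖)
exponent-colour ↗ top    = refl
exponent-colour ↗ bottom = refl
exponent-colour ↗ left   = refl
exponent-colour ↗ right  = refl
exponent-colour ↖ top    = refl
exponent-colour ↖ bottom = refl
exponent-colour ↖ left   = refl
exponent-colour ↖ right  = refl

sumℤ-pos : ∀ {n} (f : Fin n → ℕ) → sumℤ (λ i → ⁺ f i) ≡ ⁺ sumℕ f
sumℤ-pos {zero}  f = refl
sumℤ-pos {suc n} f = cong (ℤ._+_ (⁺ f zero)) (sumℤ-pos (f ∘ suc))

sumℤ-minus : ∀ {n} (f g : Fin n → ℤ) → sumℤ (λ i → f i ℤ.- g i) ≡ sumℤ f ℤ.- sumℤ g
sumℤ-minus f g = trans (sumℤ-+ f (λ i → ℤ.- g i)) (cong (ℤ._+_ (sumℤ f)) (sumℤ-neg g))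

product-weight : ∀ {n} (β e : Fin n → ℤ) (w : Fin n → Monomial) → (∀ c → w c ≡ (sgn (β c) , e c)) →
                 Vec.foldr′ _·_ (1ℤ , 0ℤ) (tabulate w) ≡ (sgn (sumℤ β) , sumℤ e)
product-weight {zero}  β e w eq = refl
product-weight {suc n} β e w eq =
    trans (cong₂ _·_ (eq zero) (product-weight (β ∘ suc) (e ∘ suc) (w ∘ suc) (eq ∘ suc)))
  (cong (_, (e zero ℤ.+ sumℤ (e ∘ suc))) (sym (sgn-+ (β zero) (sumℤ (β ∘ suc)))))

module States (L : Diagram) (i : Diagram.Segment L) where
  open Diagram L

  plusCount minusCount verticalCount : Vec Corner crossings → ℕ
  plusCount     σ = sumℕ λ c → plus (over c) (Vec.lookup σ c)
  minusCount    σ = sumℕ λ c → minus (over c) (Vec.lookup σ c)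
  verticalCount σ = sumℕ λ c → vertical (Vec.lookup σ c)

  plusCount+minusCount : ∀ σ → plusCount σ + minusCount σ ≡ verticalCount σ
  plusCount+minusCount σ =
      trans (sym (sumℕ-+ (λ c → plus (over c) (Vec.lookup σ c)) (λ c → minus (over c) (Vec.lookup σ c))))
                                 (sumℕ-cong λ c → plus+minus (over c) (Vec.lookup σ c))

  signSum : Vec Corner crossings → ℤ
  signSum σ = sumℤ λ c → signExponent (over c) (Vec.lookup σ c)

  stateWeight≡ : ∀ σ → stateWeight L i σ ≡ (sgn (signSum σ) , ⁺ plusCount σ ℤ.- ⁺ minusCount σ)
  stateWeight≡ σ = trans (product-weight _ (λ c → ⁺ p c ℤ.- ⁺ m c) _ (λ c → cornerWeight≡ (over c) (Vec.lookup σ c)))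
    (cong (sgn (signSum σ) ,_) (trans (sumℤ-minus (λ c → ⁺ p c) (λ c → ⁺ m c)) (cong₂ ℤ._-_ (sumℤ-pos p) (sumℤ-pos m))))
    where
    p m : Crossing → ℕ
    p c = plus (over c) (Vec.lookup σ c)
    m c = minus (over c) (Vec.lookup σ c)

  State : Set
  State = ∃ (IsState L i)

  used : State → Crossing → Region
  used (σ , _) = usedRegion L i σ

  private
    partner : State → State → Crossing → Crossing
    partner (_ , present , _) (_ , _ , unique) c = proj₁ (unique _ (present c))

    used-partner : ∀ S T c → used T (partner S T c) ≡ used S c
    used-partner (_ , present , _) (_ , _ , unique) c = proj₁ (proj₂ (unique _ (present c)))

    partner-partner : ∀ S T c → partner T S (partner S T c) ≡ c
    partner-partner S@(_ , _ , unique) T@(_ , present , _) c =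
      proj₂ (proj₂ (unique _ (present (partner S T c)))) (sym (used-partner S T c))

    state-permutation : State → State → Fin crossings ↔ Fin crossings
    state-permutation S T = mk↔ₛ′ (partner S T) (partner T S) (partner-partner T S) (partner-partner S T)

  -- Both states use exactly the present regions, each once, so matching crossings that use the same
  -- region is a permutation.
  sum-used : ∀ S T (h : Region → ℕ) → sumℕ (h ∘ used S) ≡ sumℕ (h ∘ used T)
  sum-used S T h = trans (sumℕ-cong (λ c → cong h (sym (used-partner S T c))))
                         (sym (sumℕ-permute (h ∘ used T) (state-permutation S T)))

  sum-usedℤ : ∀ S T (h : Region → ℤ) → sumℤ (h ∘ used S) ≡ sumℤ (h ∘ used T)
  sum-usedℤ S T h = trans (sumℤ-cong (λ c → cong h (sym (used-partner S T c))))
                          (sym (sumℤ-permute (h ∘ used T) (state-permutation S T)))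

sumℤ-nonPositive : ∀ {n} (f : Fin n → ℤ) → (∀ c → f c ℤ.≤ 0ℤ) → sumℤ f ℤ.≤ 0ℤ
sumℤ-nonPositive {zero}  f neg = ℤₚ.≤-refl
sumℤ-nonPositive {suc n} f neg = ℤₚ.+-mono-≤ (neg zero) (sumℤ-nonPositive (f ∘ suc) (neg ∘ suc))

sumℤ-nonPositive-zero : ∀ {n} (f : Fin n → ℤ) → (∀ c → f c ℤ.≤ 0ℤ) → sumℤ f ≡ 0ℤ → ∀ c → f c ≡ 0ℤ
sumℤ-nonPositive-zero {suc n} f neg eq = λ { zero → f₀≡0 ; (suc c) → sumℤ-nonPositive-zero (f ∘ suc) (neg ∘ suc) rest≡0 c }
  where
  rest≤0 = sumℤ-nonPositive (f ∘ suc) (neg ∘ suc)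
  f₀≡0 : f zero ≡ 0ℤ
  f₀≡0 = ℤₚ.≤-antisym (neg zero) (subst (ℤ._≤ f zero) eq
    (ℤₚ.≤-trans (ℤₚ.+-monoʳ-≤ (f zero) rest≤0) (ℤₚ.≤-reflexive (ℤₚ.+-identityʳ (f zero)))))
  rest≡0 : sumℤ (f ∘ suc) ≡ 0ℤ
  rest≡0 = trans (sym (ℤₚ.+-identityˡ _)) (trans (cong (ℤ._+ sumℤ (f ∘ suc)) (sym f₀≡0)) eq)

sumℤ-positive-term : ∀ {n} (f : Fin n → ℤ) → sumℤ f ≡ 0ℤ → ∀ c → f c ≢ 0ℤ → ∃ λ c′ → 0ℤ ℤ.< f c′
sumℤ-positive-term f eq c ne with any? (λ c′ → 0ℤ ℤₚ.<? f c′)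
... | yes found = found
... | no  none  = contradiction (sumℤ-nonPositive-zero f (λ c′ → ℤₚ.≮⇒≥ (λ lt → none (c′ , lt))) eq c) ne

sumℤ-negative-term : ∀ {n} (f : Fin n → ℤ) → sumℤ f ≡ 0ℤ → ∀ c → f c ≢ 0ℤ → ∃ λ c′ → f c′ ℤ.< 0ℤ
sumℤ-negative-term f eq c ne =
  let (c′ , lt) = sumℤ-positive-term (ℤ.-_ ∘ f) (trans (sumℤ-neg f) (cong ℤ.-_ eq)) c (ne ∘ λ z → trans (sym (ℤₚ.neg-involutive (f c))) (cong ℤ.-_ z))
  in c′ , subst (ℤ._< 0ℤ) (ℤₚ.neg-involutive (f c′)) (ℤₚ.neg-mono-< lt)

-- The two vertical regions of a crossing lie in the same component of the
-- complement of the Seifert circles, and each such component is a vertical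
-- component.
module VerticalGraph (L : Diagram) where
  open Diagram L

  module Vertical = Forests (↔-id (Fin regions)) (λ c → cornerRegion c top) (λ c → cornerRegion c bottom)

  abstract
    verticalForest : Vertical.SpanningForest (allFin crossings)
    verticalForest = Vertical.kruskal _

  open Vertical.SpanningForest verticalForest public using () renaming (components to verticalComponents; component to verticalComponent)

  vertical-rank : ∃ λ m → m + verticalComponents ≡ regions
  vertical-rank =
      length (Vertical.SpanningForest.tree verticalForest) , Vertical.forest-count (Vertical.SpanningForest.forest verticalForest)

  verticalComponent-band : ∀ c → verticalComponent (cornerRegion c top) ≡ verticalComponent (cornerRegion c bottom)
  verticalComponent-band c = Vertical.SpanningForest.joins verticalForest (∈-allFin c)

  verticalComponent-connected : ∀ {X : Set} (q : Region → X) →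
      (∀ c → q (cornerRegion c top) ≡ q (cornerRegion c bottom)) →
                                ∀ {ρ ρ′} → verticalComponent ρ ≡ verticalComponent ρ′ → q ρ ≡ q ρ′
  verticalComponent-connected q band eq = Eq.gfold isEquivalence q (λ { (c , _ , refl , refl) → band c })
    (Vertical.forest-complete (Vertical.SpanningForest.forest verticalForest) eq)

-- The checkerboard colouring

flankColour : Overstrand → Side → Side → Overstrand
flankColour o left  left  = other o
flankColour o left  right = o
flankColour o right left  = o
flankColour o right right = other o

-- The colour of the flank y of a segment that leaves a crossing as overstrand.
leavingColour : Side → Overstrand
leavingColour left  = ↗
leavingColour right = ↖

flankColour-over : ∀ o y → flankColour o (overHead o) y ≡ leavingColour y
flankColour-over ↗ left  = refl
flankColour-over ↗ right = refl
flankColour-over ↖ left  = refl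
flankColour-over ↖ right = refl

flankColour-under : ∀ o y → flankColour o (overTail o) y ≡ other (leavingColour y)
flankColour-under ↗ left  = refl
flankColour-under ↗ right = refl
flankColour-under ↖ left  = refl
flankColour-under ↖ right = refl

overHead⊎overTail : ∀ o x → x ≡ overHead o ⊎ x ≡ overTail o
overHead⊎overTail ↗ left  = inj₂ refl
overHead⊎overTail ↗ right = inj₁ refl
overHead⊎overTail ↖ left  = inj₁ refl
overHead⊎overTail ↖ right = inj₂ refl

overHead≢overTail : ∀ o → overHead o ≢ overTail o
overHead≢overTail ↗ ()
overHead≢overTail ↖ ()

-- The colour depends only on `y` and on whether the outgoing end belongs to the overstrand. In an
-- alternating diagram this property passes to the next segment of the Seifert circle: a segment
-- leaving over arrives under, and smoothing continues it by the leaving overstrand.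
flankColour-alternating : ∀ {o x o′ x′} → (x ≡ overHead o ⇔ (¬ (x′ ≡ overTail o′))) → ∀ y →
    flankColour o x y ≡ flankColour o′ x′ y
flankColour-alternating {o} {x} {o′} {x′} alt y with overHead⊎overTail o x | overHead⊎overTail o′ x′
... | inj₁ refl | inj₁ refl = trans (flankColour-over o y) (sym (flankColour-over o′ y))
... | inj₂ refl | inj₂ refl = trans (flankColour-under o y) (sym (flankColour-under o′ y))
... | inj₁ refl | inj₂ refl = contradiction refl (Equivalence.to alt refl)
... | inj₂ refl | inj₁ refl = contradiction (sym (Equivalence.from alt (overHead≢overTail o′))) (overHead≢overTail o)

-- `tight` says that the diagram is connected.
module Checkerboard (L : Diagram) (i : Diagram.Segment L) (alt : Alternating L)
                    (tight : Diagram.regions L ≡ 2 + Diagram.crossings L) where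
  open Diagram L
  open Planarity L i public
  open States L i public

  -- Tightness and `euler` give as many walks as regions, so the injection `walkIn` is a bijection
  -- and `boundaryRegion` is its inverse.
  boundaryRegion-injective : ∀ {β β′} → boundaryRegion β ≡ boundaryRegion β′ → β ≡ β′
  boundaryRegion-injective {β} {β′} eq with injective⇒surjective regions≡boundaries walkIn-injective β | injective⇒surjective regions≡boundaries walkIn-injective β′
    where
    shuffle : ∀ n → (2 + n) + ((2 + n) + 0) ≡ n + (2 + n) + 2
    shuffle = solve-∀
    regions≡boundaries : regions ≡ boundaries
    regions≡boundaries = ℕₚ.+-cancelˡ-≡ crossings _ _ (ℕₚ.+-cancelʳ-≡ 2 _ _
      (trans (cong (λ r → crossings + r + 2) tight) (trans (sym (shuffle crossings)) (trans (cong (λ r → r + (r + 0)) (sym tight)) euler))))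
  ... | ρ , refl | ρ′ , refl =
      cong walkIn (trans (sym (boundaryRegion-walkIn ρ)) (trans eq (boundaryRegion-walkIn ρ′)))

  region-invariant : ∀ {X : Set} (q : Flank → X) →
      (∀ c k → q (proj₁ (cornerFlanks c k)) ≡ q (proj₂ (cornerFlanks c k))) →
                     ∀ {f g} → region f ≡ region g → q f ≡ q g
  region-invariant q inv eq = walk-invariant q inv (boundaryRegion-injective eq)

  private
    colourFlank : Flank → Overstrand
    colourFlank (inj₁ (c , x) , y) = flankColour (over c) x y
    -- A circle without crossings meets no corner, so its colour is arbitrary.
    colourFlank (inj₂ j , y)       = ↗

    colourFlank-invariant : ∀ y → CircleInvariant (λ s → colourFlank (s , y))
    colourFlank-invariant y c x = trans (flankColour-alternating (alt (from (c , x))) y)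
      (cong (λ (c , x) → flankColour (over c) x y) (Inverse.strictlyInverseˡ arc (c , x)))

    colourFlank-corner : ∀ c k → colourFlank (proj₁ (cornerFlanks c k)) ≡ colourFlank (proj₂ (cornerFlanks c k))
    colourFlank-corner c top    = refl
    colourFlank-corner c bottom =
        trans (colourFlank-invariant right c left) (sym (colourFlank-invariant left c right))
    colourFlank-corner c left   = colourFlank-invariant left c left
    colourFlank-corner c right  = colourFlank-invariant right c right

  colour : Region → Overstrand
  colour ρ = colourFlank (proj₁ (flank-in ρ))

  colour-corner : ∀ c k → colour (cornerRegion c k) ≡ cornerColour (over c) k
  colour-corner c k =
      trans (region-invariant colourFlank colourFlank-corner (proj₂ (flank-in (cornerRegion c k)))) (corner k)
    where
    corner : ∀ k → colourFlank (proj₁ (cornerFlanks c k)) ≡ cornerColour (over c) k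
    corner top    = refl
    corner bottom = colourFlank-invariant right c left
    corner left   = colourFlank-invariant left c left
    corner right  = colourFlank-invariant right c right

  exponent : State → ℤ
  exponent (σ , _) = ⁺ plusCount σ ℤ.- ⁺ minusCount σ

  -- By `exponent-colour` both sides are a sum over the colours of the used regions, minus a sum
  -- over the crossings. Neither depends on the state.
  exponent-sign : ∀ S T →
      exponent S ℤ.+ (signSum (proj₁ S) ℤ.+ signSum (proj₁ S)) ≡ exponent T ℤ.+ (signSum (proj₁ T) ℤ.+ signSum (proj₁ T))
  exponent-sign S T =
      trans (total S) (trans (cong (ℤ._- N) (sum-usedℤ S T (λ ρ → indicator (colour ρ ≟ᵒ ↗)))) (sym (total T)))
    where
    N = sumℤ λ c → indicator (over c ≟ᵒ ↖)
    total : ∀ S →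
        exponent S ℤ.+ (signSum (proj₁ S) ℤ.+ signSum (proj₁ S)) ≡ sumℤ (λ c → indicator (colour (used S c) ≟ᵒ ↗)) ℤ.- N
    total (σ , _) = begin
      ⁺ sumℕ p ℤ.- ⁺ sumℕ m ℤ.+ (sumℤ β ℤ.+ sumℤ β)                    ≡⟨ cong₂ ℤ._+_ (cong₂ ℤ._-_ (sumℤ-pos p) (sumℤ-pos m)) refl ⟨
      sumℤ (λ c → ⁺ p c) ℤ.- sumℤ (λ c → ⁺ m c) ℤ.+ (sumℤ β ℤ.+ sumℤ β) ≡⟨ cong₂ ℤ._+_ (sumℤ-minus (λ c → ⁺ p c) (λ c → ⁺ m c)) (sumℤ-+ β β) ⟨
      sumℤ (λ c → ⁺ p c ℤ.- ⁺ m c) ℤ.+ sumℤ (λ c → β c ℤ.+ β c)        ≡⟨ sumℤ-+ (λ c → ⁺ p c ℤ.- ⁺ m c) (λ c → β c ℤ.+ β c) ⟨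
      sumℤ (λ c → (⁺ p c ℤ.- ⁺ m c) ℤ.+ (β c ℤ.+ β c))                 ≡⟨ sumℤ-cong (λ c → trans (exponent-colour (over c) (Vec.lookup σ c))
                                                                            (cong (λ o → indicator (o ≟ᵒ ↗) ℤ.- indicator (over c ≟ᵒ ↖)) (sym (colour-corner c (Vec.lookup σ c))))) ⟩
      sumℤ (λ c → indicator (colour (usedRegion L i σ c) ≟ᵒ ↗) ℤ.- indicator (over c ≟ᵒ ↖))
                                                                       ≡⟨ sumℤ-minus (λ c → indicator (colour (usedRegion L i σ c) ≟ᵒ ↗)) (λ c → indicator (over c ≟ᵒ ↖)) ⟩
      sumℤ (λ c → indicator (colour (usedRegion L i σ c) ≟ᵒ ↗)) ℤ.- N   ∎
      where
      open ≡-Reasoning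
      p m : Crossing → ℕ
      p c = plus (over c) (Vec.lookup σ c)
      m c = minus (over c) (Vec.lookup σ c)
      β : Crossing → ℤ
      β c = signExponent (over c) (Vec.lookup σ c)

-- Growing a state

horizontal : Side → Corner
horizontal left  = left
horizontal right = right

data IsVertical : Corner → Set where
  top    : IsVertical top
  bottom : IsVertical bottom

opposed : ∀ {k} → IsVertical k → Corner
opposed top    = bottom
opposed bottom = top

both-vertical : ∀ (P : Corner → Set) {k} (V : IsVertical k) → P k → P (opposed V) → P top × P bottom
both-vertical P top    p q = p , q
both-vertical P bottom p q = q , p

data CornerView : Corner → Set where
  vert  : ∀ {k} → IsVertical k → CornerView k
  horiz : ∀ x → CornerView (horizontal x)

cornerView : ∀ k → CornerView k
cornerView top    = vert top
cornerView bottom = vert bottom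
cornerView left   = horiz left
cornerView right  = horiz right

verticalCorner : ∀ {k} → IsVertical k → vertical k ≡ 1
verticalCorner top    = refl
verticalCorner bottom = refl

plusCorner minusCorner : Overstrand → Corner
plusCorner ↗ = top
plusCorner ↖ = bottom
minusCorner ↗ = bottom
minusCorner ↖ = top

module Growing (L : Diagram) (i : Diagram.Segment L) (alt : Alternating L)
               (tight : Diagram.regions L ≡ 2 + Diagram.crossings L) where
  open Diagram L
  open Checkerboard L i alt tight public
  open VerticalGraph L public

  Step : Set
  Step = Crossing × Corner

  stepRegion : Step → Region
  stepRegion (c , k) = cornerRegion c k

  covered : List Step → List Region
  covered []       = region (i , left) ∷ region (i , right) ∷ []
  covered (s ∷ xs) = stepRegion s ∷ covered xs

  usedCrossings : List Step → List Crossing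
  usedCrossings = map proj₁

  verticalCrossings : List Step → List Crossing
  verticalCrossings [] = []
  verticalCrossings ((c , k) ∷ xs) with cornerView k
  ... | vert _  = c ∷ verticalCrossings xs
  ... | horiz _ = verticalCrossings xs

  -- The circle of `i` counts as crossed from the start because the regions on both sides of `i` are
  -- covered.
  crossedCircles : List Step → List (Fin seifertCircles)
  crossedCircles [] = circle i ∷ []
  crossedCircles ((c , k) ∷ xs) with cornerView k
  ... | vert _  = crossedCircles xs
  ... | horiz x = circle (outgoing c x) ∷ crossedCircles xs

  rootComponents : List Step → List (Fin verticalComponents)
  rootComponents [] = verticalComponent (region (i , left)) ∷ verticalComponent (region (i , right)) ∷ []
  rootComponents ((c , k) ∷ xs) with cornerView k
  ... | vert _  = rootComponents xs
  ... | horiz x = verticalComponent (cornerRegion c k) ∷ rootComponents xs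

  -- The number of Seifert circles crossed on the way from i to a component.
  depth : List Step → Fin verticalComponents → ℕ
  depth [] _ = 0
  depth ((c , k) ∷ xs) l with cornerView k
  ... | vert _  = depth xs l
  ... | horiz _ with l ≟ᶠ verticalComponent (cornerRegion c k)
  ...   | yes _ = suc (depth xs (verticalComponent (cornerRegion c top)))
  ...   | no  _ = depth xs l

  Saturated : List Step → Set
  Saturated xs = ∀ c → (cornerRegion c top ∈ covered xs → cornerRegion c bottom ∈ covered xs)
                     × (cornerRegion c bottom ∈ covered xs → cornerRegion c top ∈ covered xs)

  -- A partial state, each step assigning to a crossing one of its corners so
  -- as to cover a new region: a vertical corner if possible, and otherwise the
  -- last uncovered corner of a crossing that has not been used.
  data Growth : List Step → Set where
    start : Growth []
    vert  : ∀ {xs c k} → Growth xs → (V : IsVertical k) → cornerRegion c k ∉ covered xs →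
            cornerRegion c (opposed V) ∈ covered xs → Growth ((c , k) ∷ xs)
    horiz : ∀ {xs c} x → Growth xs → Saturated xs → c ∉ verticalCrossings xs →
            cornerRegion c top ∈ covered xs → cornerRegion c (horizontal (opposite x)) ∈ covered xs →
            cornerRegion c (horizontal x) ∉ covered xs → Growth ((c , horizontal x) ∷ xs)

  cornerView-vertical : ∀ {k} (V : IsVertical k) → cornerView k ≡ vert V
  cornerView-vertical top    = refl
  cornerView-vertical bottom = refl

  cornerView-horizontal : ∀ x → cornerView (horizontal x) ≡ horiz x
  cornerView-horizontal left  = refl
  cornerView-horizontal right = refl

  ends-covered : ∀ {xs} → Growth xs → region (i , left) ∈ covered xs × region (i , right) ∈ covered xs
  ends-covered start = here refl , there (here refl)
  ends-covered (vert G _ _ _)        = let (p , q) = ends-covered G in there p , there q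
  ends-covered (horiz _ G _ _ _ _ _) = let (p , q) = ends-covered G in there p , there q

  step-covered : ∀ {s xs} → s ∈ xs → stepRegion s ∈ covered xs
  step-covered (here refl) = here refl
  step-covered (there s∈)  = there (step-covered s∈)

  used⇒covered : ∀ {xs c} → Growth xs → c ∈ usedCrossings xs →
                 cornerRegion c top ∈ covered xs × cornerRegion c bottom ∈ covered xs
  used⇒covered (vert {xs} {c} {k} G V _ opp∈) (here refl) =
    both-vertical (λ l → cornerRegion c l ∈ covered ((c , k) ∷ xs)) V (here refl) (there opp∈)
  used⇒covered (vert G V _ _)    (there c∈)  = let (p , q) = used⇒covered G c∈ in there p , there q
  used⇒covered (horiz {c = c} x G sat _ top∈ _ _) (here refl) = there top∈ , there (proj₁ (sat c) top∈)
  used⇒covered (horiz x G _ _ _ _ _) (there c∈) = let (p , q) = used⇒covered G c∈ in there p , there q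

  used⇒vertical⊎covered : ∀ {xs c} → Growth xs → c ∈ usedCrossings xs →
                          c ∈ verticalCrossings xs ⊎ (∀ x → cornerRegion c (horizontal x) ∈ covered xs)
  used⇒vertical⊎covered (vert G V _ _) c∈ rewrite cornerView-vertical V with c∈
  ... | here refl = inj₁ (here refl)
  ... | there c∈′ with used⇒vertical⊎covered G c∈′
  ... | inj₁ v∈ = inj₁ (there v∈)
  ... | inj₂ h  = inj₂ (there ∘ h)
  used⇒vertical⊎covered {c = c} (horiz {xs} x G _ _ _ opp∈ _) c∈ rewrite cornerView-horizontal x with c∈
  ... | here refl = inj₂ (both x opp∈)
    where
    both : ∀ x → cornerRegion c (horizontal (opposite x)) ∈ covered xs → ∀ y →
        cornerRegion c (horizontal y) ∈ cornerRegion c (horizontal x) ∷ covered xs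
    both left  p left  = here refl
    both left  p right = there p
    both right p left  = there p
    both right p right = here refl
  ... | there c∈′ with used⇒vertical⊎covered G c∈′
  ... | inj₁ v∈ = inj₁ v∈
  ... | inj₂ h  = inj₂ (there ∘ h)

  -- Once a crossing is used, both its vertical regions are covered, which excludes a later vertical
  -- step. A later horizontal step is excluded by its side condition after a vertical use, and by
  -- the lack of an uncovered horizontal corner after a horizontal one.
  usedCrossings-unique : ∀ {xs} → Growth xs → Unique (usedCrossings xs)
  usedCrossings-unique start = []
  usedCrossings-unique (vert {xs} {c} G V new _) =
      ∉⇒All≢ (λ c∈ → new (vertical∈ V (used⇒covered G c∈))) ∷ usedCrossings-unique G
    where
    vertical∈ : ∀ {k} → IsVertical k → cornerRegion c top ∈ covered xs × cornerRegion c bottom ∈ covered xs →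
        cornerRegion c k ∈ covered xs
    vertical∈ top    = proj₁
    vertical∈ bottom = proj₂
  usedCrossings-unique (horiz x G _ c∉ _ _ new) =
      ∉⇒All≢ (λ c∈ → [ c∉ , (λ h → new (h x)) ]′ (used⇒vertical⊎covered G c∈)) ∷ usedCrossings-unique G

  module Sep s = Separation (separation s)

  roots-distinct : verticalComponent (region (i , left)) ≢ verticalComponent (region (i , right))
  roots-distinct eq = Sep.part-on i (verticalComponent-connected (Sep.part i) (Sep.part-band i) eq)

  covered-unique : ∀ {xs} → Growth xs → Unique (covered xs)
  covered-unique start = (roots-distinct ∘ cong verticalComponent ∷ []) ∷ [] ∷ []
  covered-unique (vert G _ new _)          = ∉⇒All≢ new ∷ covered-unique G
  covered-unique (horiz _ G _ _ _ _ new)   = ∉⇒All≢ new ∷ covered-unique G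

  length-covered : ∀ xs → length (covered xs) ≡ 2 + length xs
  length-covered []       = refl
  length-covered (x ∷ xs) = cong suc (length-covered xs)

  -- As in `forest-flow`, the bands of the vertical steps form a forest. The region covered by the
  -- last of them is a leaf, and its indicator isolates that band.
  growth-flow : ∀ {xs} → Growth xs → ∀ {δ} → Balanced (λ c → cornerRegion c top) (λ c → cornerRegion c bottom) δ →
                (∀ c → c ∉ verticalCrossings xs → δ c ≡ 0ℤ) → ∀ c → δ c ≡ 0ℤ
  growth-flow start bal off c = off c λ ()
  growth-flow (horiz x G _ _ _ _ _) bal off rewrite cornerView-horizontal x = growth-flow G bal off
  growth-flow (vert {xs} {c₀} {k₀} G V new opp∈) {δ} bal off rewrite cornerView-vertical V = growth-flow G bal off′
    where
    g : Region → ℤ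
    g ρ = indicator (ρ ≟ᶠ cornerRegion c₀ k₀)
    old : ∀ {ρ} → ρ ∈ covered xs → g ρ ≡ 0ℤ
    old ρ∈ = indicator-no (_ ≟ᶠ cornerRegion c₀ k₀) λ eq → new (subst (_∈ covered xs) eq ρ∈)
    differ : ∀ {k} (V : IsVertical k) → g (cornerRegion c₀ k) ≡ 1ℤ → g (cornerRegion c₀ (opposed V)) ≡ 0ℤ →
             g (cornerRegion c₀ top) ≢ g (cornerRegion c₀ bottom)
    differ top    p q eq with () ← trans (sym p) (trans eq q)
    differ bottom p q eq with () ← trans (sym p) (trans (sym eq) q)
    vertical⊆used : ∀ {c} xs → c ∈ verticalCrossings xs → c ∈ usedCrossings xs
    vertical⊆used ((c , k) ∷ xs) c∈ with cornerView k
    vertical⊆used ((c , k) ∷ xs) (here eq)  | vert _ = here eq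
    vertical⊆used ((c , k) ∷ xs) (there c∈) | vert _ = there (vertical⊆used xs c∈)
    ... | horiz _ = there (vertical⊆used xs c∈)
    δc₀ : δ c₀ ≡ 0ℤ
    δc₀ =
        balanced-at bal g c₀ others (differ V (indicator-yes (cornerRegion c₀ k₀ ≟ᶠ cornerRegion c₀ k₀) refl) (old opp∈))
      where
      others : ∀ c → c ≢ c₀ → δ c ≡ 0ℤ ⊎ g (cornerRegion c top) ≡ g (cornerRegion c bottom)
      others c c≢ with c ∈ᶠ? verticalCrossings xs
      ... | no  c∉ = inj₁ (off c λ { (here p) → c≢ p ; (there q) → c∉ q })
      ... | yes c∈ = let (p , q) = used⇒covered G (vertical⊆used xs c∈) in inj₂ (trans (old p) (sym (old q)))
    off′ : ∀ c → c ∉ verticalCrossings xs → δ c ≡ 0ℤ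
    off′ c c∉ with c ≟ᶠ c₀
    ... | yes refl = δc₀
    ... | no  c≢   = off c λ { (here p) → c≢ p ; (there q) → c∉ q }

-- Extending a growth

plusVertical : ∀ o → IsVertical (plusCorner o)
plusVertical ↗ = top
plusVertical ↖ = bottom

minusVertical : ∀ o → IsVertical (minusCorner o)
minusVertical ↗ = bottom
minusVertical ↖ = top

opposed-plus : ∀ o → opposed (plusVertical o) ≡ minusCorner o
opposed-plus ↗ = refl
opposed-plus ↖ = refl

opposed-minus : ∀ o → opposed (minusVertical o) ≡ plusCorner o
opposed-minus ↗ = refl
opposed-minus ↖ = refl

indicator-difference : ∀ {P Q : Set} (P? : Dec P) (Q? : Dec Q) → indicator P? ℤ.- indicator Q? ≡ 0ℤ →
    (P → Q) × (Q → P)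
indicator-difference (yes p) (yes q) eq = (λ _ → q) , (λ _ → p)
indicator-difference (no ¬p) (no ¬q) eq = (λ p → contradiction p ¬p) , (λ q → contradiction q ¬q)

0<indicator-difference : ∀ {P Q : Set} (P? : Dec P) (Q? : Dec Q) → 0ℤ ℤ.< indicator P? ℤ.- indicator Q? → P × ¬ Q
0<indicator-difference (yes p) (no ¬q) lt = p , ¬q
0<indicator-difference (yes p) (yes q) (ℤ.+<+ ())
0<indicator-difference (no ¬p) (no ¬q) (ℤ.+<+ ())

indicator-difference<0 : ∀ {P Q : Set} (P? : Dec P) (Q? : Dec Q) → indicator P? ℤ.- indicator Q? ℤ.< 0ℤ → ¬ P × Q
indicator-difference<0 (no ¬p) (yes q) lt = ¬p , q
indicator-difference<0 (yes p) (yes q) (ℤ.+<+ ())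
indicator-difference<0 (yes p) (no ¬q) (ℤ.+<+ ())
indicator-difference<0 (no ¬p) (no ¬q) (ℤ.+<+ ())

module Progress (L : Diagram) (i : Diagram.Segment L) (alt : Alternating L)
                (tight : Diagram.regions L ≡ 2 + Diagram.crossings L) where
  open Diagram L
  open Growing L i alt tight public

  _∈ᶜᵒᵛ?_ : ∀ ρ xs → Dec (ρ ∈ covered xs)
  ρ ∈ᶜᵒᵛ? xs = ρ ∈ᶠ? covered xs

  walks⇒regions : ∀ {δ} → Balanced topWalk bottomWalk δ →
      Balanced (λ c → cornerRegion c top) (λ c → cornerRegion c bottom) δ
  walks⇒regions bal g = bal (g ∘ boundaryRegion)

  VerticalStep : (new old : Overstrand → Corner) → List Step → Set
  VerticalStep new old xs =
      ∃ λ c → cornerRegion c (new (over c)) ∉ covered xs × cornerRegion c (old (over c)) ∈ covered xs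

  HorizontalStep : List Step → Crossing → Side → Set
  HorizontalStep xs c x = (¬ (c ∈ verticalCrossings xs)) × cornerRegion c top ∈ covered xs ×
    cornerRegion c (horizontal (opposite x)) ∈ covered xs × ¬ (cornerRegion c (horizontal x) ∈ covered xs)

  -- The bands of one sign form an Eulerian digraph, so a set of regions that
  -- is left by such a band is also entered by one.
  both-directions : ∀ xs c → ¬ ((cornerRegion c top ∈ covered xs → cornerRegion c bottom ∈ covered xs)
                              × (cornerRegion c bottom ∈ covered xs → cornerRegion c top ∈ covered xs)) →
                    VerticalStep plusCorner minusCorner xs × VerticalStep minusCorner plusCorner xs
  both-directions xs c₀ unsat = orient o refl
    where
    o = over c₀
    -- The vertical corners of a crossing `c` have the colour `over c`, so restricting to the
    -- regions of colour `o` singles out the bands of that sign.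
    In : Region → Set
    In ρ = ρ ∈ covered xs × colour ρ ≡ o
    In? : ∀ ρ → Dec (In ρ)
    In? ρ = (ρ ∈ᶜᵒᵛ? xs) ×-dec (colour ρ ≟ᵒ o)
    d : Crossing → ℤ
    d c = indicator (In? (cornerRegion c top)) ℤ.- indicator (In? (cornerRegion c bottom))
    sum-d : sumℤ d ≡ 0ℤ
    sum-d = trans (sumℤ-cong (λ c → sym (ℤₚ.*-identityʳ (d c))))
      (walks⇒regions (strand-balanced left (λ _ → 1ℤ) (λ _ _ → refl)) (λ ρ → indicator (In? ρ)))
    d-c₀ : d c₀ ≢ 0ℤ
    d-c₀ eq = let (p , q) = indicator-difference (In? (cornerRegion c₀ top)) (In? (cornerRegion c₀ bottom)) eq in
      unsat ((λ t → proj₁ (p (t , colour-corner c₀ top))) , (λ b → proj₁ (q (b , colour-corner c₀ bottom))))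
    Cover : Corner → Corner → Set
    Cover new old = ∃ λ c → over c ≡ o × cornerRegion c new ∉ covered xs × cornerRegion c old ∈ covered xs
    up : Cover top bottom
    up = let (c , lt) = sumℤ-negative-term d sum-d c₀ d-c₀
             (p , q , r) = indicator-difference<0 (In? (cornerRegion c top)) (In? (cornerRegion c bottom)) lt
             over≡ = trans (sym (colour-corner c bottom)) r
         in c , over≡ , (λ t → p (t , trans (colour-corner c top) over≡)) , q
    down : Cover bottom top
    down = let (c , lt) = sumℤ-positive-term d sum-d c₀ d-c₀
               ((p , r) , q) = 0<indicator-difference (In? (cornerRegion c top)) (In? (cornerRegion c bottom)) lt
               over≡ = trans (sym (colour-corner c top)) r
           in c , over≡ , (λ t → q (t , trans (colour-corner c bottom) over≡)) , p
    step : ∀ (new old : Overstrand → Corner) → Cover (new o) (old o) → VerticalStep new old xs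
    step new old (c , over≡ , p , q) = c ,
      (λ z → p (subst (λ o → cornerRegion c (new o) ∈ covered xs) over≡ z)) ,
      subst (λ o → cornerRegion c (old o) ∈ covered xs) (sym over≡) q
    orient : ∀ o′ → o ≡ o′ → VerticalStep plusCorner minusCorner xs × VerticalStep minusCorner plusCorner xs
    orient ↗ eq = step plusCorner minusCorner (subst (λ o → Cover (plusCorner o) (minusCorner o)) (sym eq) up)
                , step minusCorner plusCorner (subst (λ o → Cover (minusCorner o) (plusCorner o)) (sym eq) down)
    orient ↖ eq = step plusCorner minusCorner (subst (λ o → Cover (plusCorner o) (minusCorner o)) (sym eq) down)
                , step minusCorner plusCorner (subst (λ o → Cover (minusCorner o) (plusCorner o)) (sym eq) up)

  -- When no step is possible, the Seifert circles with both sides covered are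
  -- joined to the others by bands of vertical steps only; those bands form a
  -- forest, so there are none of them and every circle has both sides covered.
  stuck⇒covered : ∀ {xs} → Growth xs → Saturated xs → (∀ c x → ¬ HorizontalStep xs c x) → ∀ ρ → ρ ∈ covered xs
  stuck⇒covered {xs} G sat stuck = λ ρ → subst (_∈ covered xs) (proj₂ (flank-in ρ)) (all-flanks (proj₁ (flank-in ρ)))
    where
    Inner : Segment → Set
    Inner s = region (s , left) ∈ covered xs × region (s , right) ∈ covered xs
    Inner? : ∀ s → Dec (Inner s)
    Inner? s = (region (s , left) ∈ᶜᵒᵛ? xs) ×-dec (region (s , right) ∈ᶜᵒᵛ? xs)
    q : Segment → ℤ
    q s = indicator (Inner? s)
    covered? : Region → ℤ
    covered? ρ = indicator (ρ ∈ᶜᵒᵛ? xs)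
    covered-invariant : ∀ x → CircleInvariant (λ s → covered? (region (s , x)))
    covered-invariant =
        band-invariant covered? (λ c → indicator-⇔ (cornerRegion c top ∈ᶜᵒᵛ? xs) (cornerRegion c bottom ∈ᶜᵒᵛ? xs) (proj₁ (sat c)) (proj₂ (sat c)))
    transport : ∀ {ρ ρ′} → covered? ρ ≡ covered? ρ′ → ρ ∈ covered xs → ρ′ ∈ covered xs
    transport {ρ} {ρ′} eq p = indicator⁻ (ρ′ ∈ᶜᵒᵛ? xs) (trans (sym eq) (indicator-yes (ρ ∈ᶜᵒᵛ? xs) p))
    q-invariant : CircleInvariant q
    q-invariant c x = indicator-⇔ (Inner? (incoming c x)) (Inner? (outgoing c x))
      (λ (p , r) → transport (covered-invariant left c x) p , transport (covered-invariant right c x) r)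
      (λ (p , r) → transport (sym (covered-invariant left c x)) p , transport (sym (covered-invariant right c x)) r)
    δ : Crossing → ℤ
    δ c = q (outgoing c right) ℤ.- q (outgoing c left)
    right-region : ∀ c → region (outgoing c right , right) ≡ cornerRegion c right
    right-region c = cong boundaryRegion (sym (outer c right))
    left-region : ∀ c → region (outgoing c left , left) ≡ cornerRegion c left
    left-region c = cong boundaryRegion (sym (outer c left))
    top-region : ∀ c → region (outgoing c right , left) ≡ cornerRegion c top
    top-region c = cong boundaryRegion (inner-top c right)
    side-covered : ∀ c x → c ∉ verticalCrossings xs → cornerRegion c top ∈ covered xs →
        cornerRegion c (horizontal (opposite x)) ∈ covered xs → cornerRegion c (horizontal x) ∈ covered xs
    side-covered c x c∉ top∈ opp∈ with cornerRegion c (horizontal x) ∈ᶜᵒᵛ? xs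
    ... | yes p = p
    ... | no ¬p = contradiction (c∉ , top∈ , opp∈ , ¬p) (stuck c x)
    -- If one strand is inner, then the top corner and the horizontal corner beyond that strand are
    -- covered. As no horizontal step is possible at `c`, the other horizontal corner is covered as
    -- well, and the other strand is inner.
    δ-off : ∀ c → c ∉ verticalCrossings xs → δ c ≡ 0ℤ
    δ-off c c∉ = ℤₚ.i≡j⇒i-j≡0 (indicator-⇔ (Inner? (outgoing c right)) (Inner? (outgoing c left))
      (λ (t , r) → let t′ = subst (_∈ covered xs) (top-region c) t in
         subst (_∈ covered xs) (sym (left-region c)) (side-covered c left c∉ t′ (subst (_∈ covered xs) (right-region c) r)) , t′)
      (λ (l , t) → subst (_∈ covered xs) (sym (top-region c)) t ,
         subst (_∈ covered xs) (sym (right-region c)) (side-covered c right c∉ t (subst (_∈ covered xs) (left-region c) l))))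
    q-band : ∀ c → q (outgoing c left) ≡ q (outgoing c right)
    q-band c =
        sym (ℤₚ.i-j≡0⇒i≡j _ _ (growth-flow G (walks⇒regions (band-balanced q q q-invariant q-invariant)) δ-off c))
    q-corner : ∀ c k → q (proj₁ (proj₁ (cornerFlanks c k))) ≡ q (proj₁ (proj₂ (cornerFlanks c k)))
    q-corner c top    = q-band c
    q-corner c bottom = trans (q-invariant c left) (trans (q-band c) (sym (q-invariant c right)))
    q-corner c left   = q-invariant c left
    q-corner c right  = q-invariant c right
    -- Since `q` agrees on the two flanks at each corner it descends to regions. Being a function of
    -- segments, it also agrees across each segment, so it is constant by `connected`.
    Q : Region → ℤ
    Q ρ = q (proj₁ (proj₁ (flank-in ρ)))
    Q-flank : ∀ f → Q (region f) ≡ q (proj₁ f)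
    Q-flank f = region-invariant (q ∘ proj₁) q-corner (proj₂ (flank-in (region f)))
    Q-constant : ∀ ρ ρ′ → Q ρ ≡ Q ρ′
    Q-constant ρ ρ′ = Eq.gfold isEquivalence Q (λ { (s , refl , refl) → trans (Q-flank (s , left)) (sym (Q-flank (s , right))) }) (connected ρ ρ′)
    inner : ∀ s → Inner s
    inner s =
        indicator⁻ (Inner? s) (trans (sym (Q-flank (s , left))) (trans (Q-constant (region (s , left)) (region (i , left)))
      (trans (Q-flank (i , left)) (indicator-yes (Inner? i) (ends-covered G)))))
    all-flanks : ∀ f → region f ∈ covered xs
    all-flanks (s , left)  = proj₁ (inner s)
    all-flanks (s , right) = proj₂ (inner s)

  data Next (xs : List Step) : Set where
    finished : (∀ ρ → ρ ∈ covered xs) → Next xs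
    vertStep : VerticalStep plusCorner minusCorner xs → VerticalStep minusCorner plusCorner xs → Next xs
    horizStep : ∀ x c → Saturated xs → HorizontalStep xs c x → Next xs

  saturated? : ∀ xs → Saturated xs ⊎ ∃ λ c → ¬ ((cornerRegion c top ∈ covered xs → cornerRegion c bottom ∈ covered xs)
                                              × (cornerRegion c bottom ∈ covered xs → cornerRegion c top ∈ covered xs))
  saturated? xs with any? (λ c → ¬? (((cornerRegion c top ∈ᶜᵒᵛ? xs) →-dec (cornerRegion c bottom ∈ᶜᵒᵛ? xs)) ×-dec
                                     ((cornerRegion c bottom ∈ᶜᵒᵛ? xs) →-dec (cornerRegion c top ∈ᶜᵒᵛ? xs))))
  ... | yes found = inj₂ found
  ... | no  none  =
      inj₁ λ c → decidable-stable (((cornerRegion c top ∈ᶜᵒᵛ? xs) →-dec (cornerRegion c bottom ∈ᶜᵒᵛ? xs)) ×-dec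
                                     ((cornerRegion c bottom ∈ᶜᵒᵛ? xs) →-dec (cornerRegion c top ∈ᶜᵒᵛ? xs))) (λ ¬p → none (c , ¬p))

  horizontalStep? : ∀ xs x → (∃ λ c → HorizontalStep xs c x) ⊎ (∀ c → ¬ HorizontalStep xs c x)
  horizontalStep? xs x with any? (λ c → ¬? (c ∈ᶠ? verticalCrossings xs) ×-dec ((cornerRegion c top ∈ᶜᵒᵛ? xs) ×-dec
    ((cornerRegion c (horizontal (opposite x)) ∈ᶜᵒᵛ? xs) ×-dec ¬? (cornerRegion c (horizontal x) ∈ᶜᵒᵛ? xs))))
  ... | yes found = inj₁ found
  ... | no  none  = inj₂ λ c p → none (c , p)

  next : ∀ {xs} → Growth xs → Next xs
  next {xs} G with saturated? xs
  ... | inj₂ (c , unsat) = let (p , m) = both-directions xs c unsat in vertStep p m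
  ... | inj₁ sat with horizontalStep? xs left | horizontalStep? xs right
  ... | inj₁ (c , h) | _            = horizStep left c sat h
  ... | inj₂ _       | inj₁ (c , h) = horizStep right c sat h
  ... | inj₂ noL     | inj₂ noR     = finished (stuck⇒covered G sat λ { c left → noL c ; c right → noR c })

-- Complete growths

sumℕ-update : ∀ {n} (f g : Fin n → ℕ) x → f x ≡ 0 → (∀ j → j ≢ x → g j ≡ f j) → sumℕ g ≡ g x + sumℕ f
sumℕ-update {suc n} f g zero z same =
    cong (g zero +_) (trans (sumℕ-cong (λ j → same (suc j) λ ())) (cong (_+ sumℕ (f ∘ suc)) (sym z)))
sumℕ-update {suc n} f g (suc x) z same =
    trans (cong₂ _+_ (same zero λ ()) (sumℕ-update (f ∘ suc) (g ∘ suc) x z (λ j ne → same (suc j) (ne ∘ suc-injective))))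
  (exchange (f zero) (g (suc x)) (sumℕ (f ∘ suc)))
  where
  exchange : ∀ a b c → a + (b + c) ≡ b + (a + c)
  exchange = solve-∀

sumℕ-zero : ∀ {n} → sumℕ {n} (λ _ → 0) ≡ 0
sumℕ-zero {zero}  = refl
sumℕ-zero {suc n} = sumℕ-zero {n}

sumℕ-mono : ∀ {n} {f g : Fin n → ℕ} → (∀ c → f c ≤ g c) → sumℕ f ≤ sumℕ g
sumℕ-mono {zero}  le = z≤n
sumℕ-mono {suc n} le = ℕₚ.+-mono-≤ (le zero) (sumℕ-mono (le ∘ suc))

vertical-horizontal : ∀ x → vertical (horizontal x) ≡ 0
vertical-horizontal left  = refl
vertical-horizontal right = refl

plus-plusCorner : ∀ o → plus o (plusCorner o) ≡ 1 × minus o (plusCorner o) ≡ 0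
plus-plusCorner ↗ = refl , refl
plus-plusCorner ↖ = refl , refl

minus-minusCorner : ∀ o → plus o (minusCorner o) ≡ 0 × minus o (minusCorner o) ≡ 1
minus-minusCorner ↗ = refl , refl
minus-minusCorner ↖ = refl , refl

plus-horizontal : ∀ o x → plus o (horizontal x) ≡ 0 × minus o (horizontal x) ≡ 0
plus-horizontal ↗ left  = refl , refl
plus-horizontal ↗ right = refl , refl
plus-horizontal ↖ left  = refl , refl
plus-horizontal ↖ right = refl , refl

module CompleteGrowth (L : Diagram) (i : Diagram.Segment L) (alt : Alternating L)
                      (tight : Diagram.regions L ≡ 2 + Diagram.crossings L) where
  open Diagram L
  open Progress L i alt tight public

  stepSum : (Overstrand → Corner → ℕ) → List Step → ℕ
  stepSum F []             = 0
  stepSum F ((c , k) ∷ xs) = F (over c) k + stepSum F xs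

  record Complete (xs : List Step) : Set where
    constructor complete
    field
      growth : Growth xs
      all∈   : ∀ ρ → ρ ∈ covered xs

  module _ (a : ℕ) where

    -- The invariant of the strategy that takes plus corners until there are `a` of them and minus
    -- corners from then on.
    PlusFirst : List Step → Set
    PlusFirst xs = stepSum plus xs ≤ a × (stepSum minus xs ≡ 0 ⊎ stepSum plus xs ≡ a)

    extend : ∀ {xs} → Growth xs → PlusFirst xs → (∀ ρ → ρ ∈ covered xs) ⊎ ∃ λ s → Growth (s ∷ xs) × PlusFirst (s ∷ xs)
    extend {xs} G (p≤a , alt) with next G
    ... | finished all∈ = inj₁ all∈
    ... | horizStep x c sat (c∉ , top∈ , opp∈ , new) = inj₂ ((c , horizontal x) , horiz x G sat c∉ top∈ opp∈ new ,
            subst₂ (λ p m → p + stepSum plus xs ≤ a × (m + stepSum minus xs ≡ 0 ⊎ p + stepSum plus xs ≡ a))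
              (sym (proj₁ (plus-horizontal (over c) x))) (sym (proj₂ (plus-horizontal (over c) x))) (p≤a , alt))
    ... | vertStep (c , new , old) (c′ , new′ , old′) with stepSum plus xs ℕₚ.<? a
    ...   | yes p<a = inj₂ ((c , plusCorner (over c)) ,
              vert G (plusVertical (over c)) new (subst (λ k → cornerRegion c k ∈ covered xs) (sym (opposed-plus (over c))) old) ,
              subst₂ (λ p m → p + stepSum plus xs ≤ a × (m + stepSum minus xs ≡ 0 ⊎ p + stepSum plus xs ≡ a))
                (sym (proj₁ (plus-plusCorner (over c)))) (sym (proj₂ (plus-plusCorner (over c))))
                (p<a , inj₁ ([ id , (λ eq → contradiction eq (ℕₚ.<⇒≢ p<a)) ]′ alt)))
    ...   | no  p≮a = inj₂ ((c′ , minusCorner (over c′)) ,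
              vert G (minusVertical (over c′)) new′ (subst (λ k → cornerRegion c′ k ∈ covered xs) (sym (opposed-minus (over c′))) old′) ,
              subst₂ (λ p m → p + stepSum plus xs ≤ a × (m + stepSum minus xs ≡ 0 ⊎ p + stepSum plus xs ≡ a))
                (sym (proj₁ (minus-minusCorner (over c′)))) (sym (proj₂ (minus-minusCorner (over c′))))
                (p≤a , inj₂ (ℕₚ.≤-antisym p≤a (ℕₚ.≮⇒≥ p≮a))))

    extend* : ∀ fuel {xs} → Growth xs → PlusFirst xs → length xs + fuel ≡ crossings →
        ∃ λ ys → Complete ys × PlusFirst ys
    extend* fuel {xs} G P len with extend G P
    ... | inj₁ all∈ = xs , complete G all∈ , P
    extend* (suc fuel) {xs} G P len | inj₂ (s , G′ , P′) =
        extend* fuel G′ P′ (trans (sym (ℕₚ.+-suc (length xs) fuel)) len)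
    extend* zero {xs} G P len | inj₂ (s , G′ , _) = contradiction (unique⇒length≤ (usedCrossings-unique G′))
      (ℕₚ.<⇒≱ (ℕₚ.≤-reflexive (cong suc (trans (sym len) (trans (ℕₚ.+-identityʳ (length xs)) (sym (length-map proj₁ xs)))))))

    growth-with : ∃ λ ys → Complete ys × PlusFirst ys
    growth-with = extend* crossings start (z≤n , inj₁ refl) refl

  saturated-closed : ∀ {xs} → Saturated xs → ∀ {ρ ρ′} → ρ ∈ covered xs → verticalComponent ρ ≡ verticalComponent ρ′ →
      ρ′ ∈ covered xs
  saturated-closed {xs} sat {ρ} {ρ′} ρ∈ eq =
      indicator⁻ (ρ′ ∈ᶜᵒᵛ? xs) (trans (sym (verticalComponent-connected (λ ρ → indicator (ρ ∈ᶜᵒᵛ? xs))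
    (λ c → indicator-⇔ (cornerRegion c top ∈ᶜᵒᵛ? xs) (cornerRegion c bottom ∈ᶜᵒᵛ? xs) (proj₁ (sat c)) (proj₂ (sat c))) eq)) (indicator-yes (ρ ∈ᶜᵒᵛ? xs) ρ∈))

  covered⇒root : ∀ {xs ρ} → Growth xs → ρ ∈ covered xs → verticalComponent ρ ∈ rootComponents xs
  covered⇒root start (here refl)         = here refl
  covered⇒root start (there (here refl)) = there (here refl)
  covered⇒root (vert {xs} {c} G V _ opp∈) ρ∈ rewrite cornerView-vertical V with ρ∈
  ... | there ρ∈′ = covered⇒root G ρ∈′
  ... | here refl = subst (_∈ rootComponents xs) (same V) (covered⇒root G opp∈)
    where
    same : ∀ {k} (V : IsVertical k) →
        verticalComponent (cornerRegion c (opposed V)) ≡ verticalComponent (cornerRegion c k)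
    same top    = sym (verticalComponent-band c)
    same bottom = verticalComponent-band c
  covered⇒root (horiz x G _ _ _ _ _) ρ∈ rewrite cornerView-horizontal x with ρ∈
  ... | here refl = here refl
  ... | there ρ∈′ = there (covered⇒root G ρ∈′)

  root⇒covered : ∀ {xs l} → Growth xs → l ∈ rootComponents xs → ∃ λ ρ → ρ ∈ covered xs × verticalComponent ρ ≡ l
  root⇒covered start (here refl)         = _ , here refl , refl
  root⇒covered start (there (here refl)) = _ , there (here refl) , refl
  root⇒covered (vert G V _ _) l∈ rewrite cornerView-vertical V = let (ρ , ρ∈ , eq) = root⇒covered G l∈ in ρ , there ρ∈ , eq
  root⇒covered (horiz x G _ _ _ _ _) l∈ rewrite cornerView-horizontal x with l∈
  ... | here refl = _ , here refl , refl
  ... | there l∈′ = let (ρ , ρ∈ , eq) = root⇒covered G l∈′ in ρ , there ρ∈ , eq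

  new-root : ∀ {xs ρ} → Growth xs → Saturated xs → ρ ∉ covered xs → verticalComponent ρ ∉ rootComponents xs
  new-root G sat ρ∉ l∈ = let (ρ′ , ρ′∈ , eq) = root⇒covered G l∈ in ρ∉ (saturated-closed sat ρ′∈ eq)

  roots-unique : ∀ {xs} → Growth xs → Unique (rootComponents xs)
  roots-unique start = (roots-distinct ∷ []) ∷ [] ∷ []
  roots-unique (vert G V _ _) rewrite cornerView-vertical V = roots-unique G
  roots-unique (horiz x G sat _ _ _ new) rewrite cornerView-horizontal x =
      ∉⇒All≢ (new-root G sat new) ∷ roots-unique G

  -- A vertical step covers a region of a component already entered, and a horizontal step opens one
  -- new component. The two initial regions are the two initial roots.
  count-steps : ∀ {xs} → Growth xs → stepSum (λ _ → vertical) xs + length (rootComponents xs) ≡ length (covered xs)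
  count-steps start = refl
  count-steps (vert G V _ _) rewrite cornerView-vertical V | verticalCorner V = cong suc (count-steps G)
  count-steps (horiz {xs} x G _ _ _ _ _) rewrite cornerView-horizontal x | vertical-horizontal x =
    trans (ℕₚ.+-suc (stepSum (λ _ → vertical) xs) _) (cong suc (count-steps G))

  -- A complete growth has opened every component exactly once, so the number of its vertical steps
  -- does not depend on the choices made.
  rank : ∀ {xs} → Complete xs → stepSum (λ _ → vertical) xs + verticalComponents ≡ regions
  rank {xs} (complete G all∈) =
      trans (cong (stepSum (λ _ → vertical) xs +_) (sym (unique∧exhaustive⇒length≡ (roots-unique G) roots∈)))
    (trans (count-steps G) (unique∧exhaustive⇒length≡ (covered-unique G) all∈))
    where
    roots∈ : ∀ l → l ∈ rootComponents xs
    roots∈ l = let (ρ , eq) = Vertical.forest-surjective (Vertical.SpanningForest.forest verticalForest) l in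
      subst (_∈ rootComponents xs) eq (covered⇒root G (all∈ ρ))

  stepSum-plus+minus : ∀ xs → stepSum plus xs + stepSum minus xs ≡ stepSum (λ _ → vertical) xs
  stepSum-plus+minus [] = refl
  stepSum-plus+minus ((c , k) ∷ xs) =
      trans (exchange (plus (over c) k) (stepSum plus xs) (minus (over c) k) (stepSum minus xs))
    (cong₂ _+_ (plus+minus (over c) k) (stepSum-plus+minus xs))
    where
    exchange : ∀ a b c d → a + b + (c + d) ≡ a + c + (b + d)
    exchange = solve-∀

  growth-with-counts : ∀ {a b} → a + b + verticalComponents ≡ regions → ∃ λ xs → Complete xs × stepSum plus xs ≡ a × stepSum minus xs ≡ b
  growth-with-counts {a} {b} eq with growth-with a
  ... | xs , C , p≤a , alt = xs , C , p≡a , m≡b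
    where
    p+m≡a+b : stepSum plus xs + stepSum minus xs ≡ a + b
    p+m≡a+b = trans (stepSum-plus+minus xs) (ℕₚ.+-cancelʳ-≡ verticalComponents _ _ (trans (rank C) (sym eq)))
    p≡a : stepSum plus xs ≡ a
    -- Without minus steps, all the `a + b` vertical steps required by `rank` are plus steps, so
    -- there are at least `a` of them.
    p≡a = [ (λ m≡0 → ℕₚ.≤-antisym p≤a (ℕₚ.≤-trans (ℕₚ.m≤m+n a b) (ℕₚ.≤-reflexive
              (trans (sym p+m≡a+b) (trans (cong (stepSum plus xs +_) m≡0) (ℕₚ.+-identityʳ _)))))) , id ]′ alt
    m≡b : stepSum minus xs ≡ b
    m≡b = ℕₚ.+-cancelˡ-≡ a _ _ (trans (cong (_+ stepSum minus xs) (sym p≡a)) p+m≡a+b)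

  -- A vertical step stays within a part, and a horizontal step passes only over the circle recorded
  -- for it. The label can therefore not change before the circle of `s` is recorded.
  part-covered : ∀ s {xs ρ} → Growth xs → circle s ∉ crossedCircles xs → ρ ∈ covered xs →
      Sep.part s ρ ≡ Sep.part s (region (i , left))
  part-covered s start c∉ (here refl)         = refl
  part-covered s start c∉ (there (here refl)) = sym (Sep.part-off s i (λ eq → c∉ (here (sym eq))))
  part-covered s (vert {c = c} G V _ opp∈) c∉ ρ∈ rewrite cornerView-vertical V with ρ∈
  ... | there ρ∈′ = part-covered s G c∉ ρ∈′
  ... | here refl = trans (same V) (part-covered s G c∉ opp∈)
    where
    same : ∀ {k} (V : IsVertical k) → Sep.part s (cornerRegion c k) ≡ Sep.part s (cornerRegion c (opposed V))
    same top    = Sep.part-band s c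
    same bottom = sym (Sep.part-band s c)
  part-covered s (horiz {c = c} x G _ _ top∈ _ _) c∉ ρ∈ rewrite cornerView-horizontal x with ρ∈
  ... | there ρ∈′ = part-covered s G (c∉ ∘ there) ρ∈′
  ... | here refl =
      trans (across x (Sep.part-off s (outgoing c x) (λ eq → c∉ (here (sym eq))))) (part-covered s G (c∉ ∘ there) top∈)
    where
    across : ∀ x → Sep.part s (region (outgoing c x , left)) ≡ Sep.part s (region (outgoing c x , right)) →
             Sep.part s (cornerRegion c (horizontal x)) ≡ Sep.part s (cornerRegion c top)
    across left  eq = trans (cong (Sep.part s ∘ boundaryRegion) (outer c left)) eq
    across right eq =
        trans (cong (Sep.part s ∘ boundaryRegion) (outer c right)) (trans (sym eq) (cong (Sep.part s ∘ boundaryRegion) (inner-top c right)))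

  -- Otherwise all regions would have one label by `part-covered`, including those on the two sides
  -- of `s`.
  all-crossed : ∀ {xs} → Complete xs → ∀ s → circle s ∈ crossedCircles xs
  all-crossed {xs} (complete G all∈) s with circle s ∈ᶠ? crossedCircles xs
  ... | yes c∈ = c∈
  ... | no  c∉ =
      contradiction (trans (part-covered s G c∉ (all∈ _)) (sym (part-covered s G c∉ (all∈ _)))) (Sep.part-on s)

-- Exponents of states

horizontal-injective : ∀ x y → horizontal x ≡ horizontal y → x ≡ y
horizontal-injective left  left  _ = refl
horizontal-injective right right _ = refl

module Exponents (L : Diagram) (i : Diagram.Segment L) (alt : Alternating L)
                 (tight : Diagram.regions L ≡ 2 + Diagram.crossings L) where
  open Diagram L
  open CompleteGrowth L i alt tight public

  depth-new : ∀ {xs c} x → depth ((c , horizontal x) ∷ xs) (verticalComponent (cornerRegion c (horizontal x))) ≡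
                           suc (depth xs (verticalComponent (cornerRegion c top)))
  depth-new {xs} {c} x rewrite cornerView-horizontal x with verticalComponent (cornerRegion c (horizontal x)) ≟ᶠ verticalComponent (cornerRegion c (horizontal x))
  ... | yes _ = refl
  ... | no ne = contradiction refl ne

  depth-old : ∀ {xs c} x {l} → l ≢ verticalComponent (cornerRegion c (horizontal x)) →
      depth ((c , horizontal x) ∷ xs) l ≡ depth xs l
  depth-old {xs} {c} x {l} ne rewrite cornerView-horizontal x with l ≟ᶠ verticalComponent (cornerRegion c (horizontal x))
  ... | yes eq = contradiction eq ne
  ... | no  _  = refl

  component-invariant : ∀ x → CircleInvariant (λ s → verticalComponent (region (s , x)))
  component-invariant = band-invariant verticalComponent verticalComponent-band

  component-circle : ∀ x {s s′} → circle s ≡ circle s′ →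
      verticalComponent (region (s , x)) ≡ verticalComponent (region (s′ , x))
  component-circle x = circle-connected (λ s → verticalComponent (region (s , x))) (component-invariant x)

  Shallow : List Step → Segment → Side → Set
  Shallow xs s x = verticalComponent (region (s , x)) ∈ rootComponents xs ×
    depth xs (verticalComponent (region (s , x))) ≤ suc (depth xs (verticalComponent (region (s , opposite x))))

  side-cases : ∀ c y x →
      region (outgoing c y , x) ≡ cornerRegion c (horizontal y) × region (outgoing c y , opposite x) ≡ cornerRegion c top
                       ⊎ region (outgoing c y , x) ≡ cornerRegion c top × region (outgoing c y , opposite x) ≡ cornerRegion c (horizontal y)
  side-cases c left  left  = inj₁ (cong boundaryRegion (sym (outer c left)) , refl)
  side-cases c left  right = inj₂ (refl , cong boundaryRegion (sym (outer c left)))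
  side-cases c right left  =
      inj₂ (cong boundaryRegion (inner-top c right) , cong boundaryRegion (sym (outer c right)))
  side-cases c right right =
      inj₁ (cong boundaryRegion (sym (outer c right)) , cong boundaryRegion (inner-top c right))

  -- When a circle is crossed, its far side becomes one deeper than its near side, and later steps
  -- change neither depth because they open other components. At the circle of `i` both depths are
  -- 0.
  shallow : ∀ {xs s} → Growth xs → circle s ∈ crossedCircles xs → ∀ x → Shallow xs s x
  shallow {s = s} start (here eq) x = subst (_∈ rootComponents []) (sym (component-circle x eq)) (root x) , z≤n
    where
    root : ∀ x → verticalComponent (region (i , x)) ∈ rootComponents []
    root left  = here refl
    root right = there (here refl)
  shallow (vert G V _ _) s∈ x rewrite cornerView-vertical V = shallow G s∈ x
  shallow {s = s} (horiz {xs} {c} y G sat _ top∈ _ new) s∈ x = cases (subst (circle s ∈_) crossed s∈)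
    where
    crossed : crossedCircles ((c , horizontal y) ∷ xs) ≡ circle (outgoing c y) ∷ crossedCircles xs
    crossed rewrite cornerView-horizontal y = refl
    fresh : verticalComponent (cornerRegion c (horizontal y)) ∉ rootComponents xs
    fresh = new-root G sat new
    root-new : verticalComponent (cornerRegion c (horizontal y)) ∈ rootComponents ((c , horizontal y) ∷ xs)
    root-new rewrite cornerView-horizontal y = here refl
    root-old : ∀ {l} → l ∈ rootComponents xs → l ∈ rootComponents ((c , horizontal y) ∷ xs)
    root-old l∈ rewrite cornerView-horizontal y = there l∈
    old : ∀ {l} → l ∈ rootComponents xs → depth ((c , horizontal y) ∷ xs) l ≡ depth xs l
    old l∈ = depth-old y λ { refl → fresh l∈ }
    top-root : verticalComponent (cornerRegion c top) ∈ rootComponents xs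
    top-root = covered⇒root G top∈
    Goal : Fin verticalComponents → Fin verticalComponents → Set
    Goal l l′ =
        l ∈ rootComponents ((c , horizontal y) ∷ xs) × depth ((c , horizontal y) ∷ xs) l ≤ suc (depth ((c , horizontal y) ∷ xs) l′)
    new-top : Goal (verticalComponent (cornerRegion c (horizontal y))) (verticalComponent (cornerRegion c top))
    new-top = root-new , ℕₚ.≤-reflexive (trans (depth-new y) (cong suc (sym (old top-root))))
    top-new : Goal (verticalComponent (cornerRegion c top)) (verticalComponent (cornerRegion c (horizontal y)))
    top-new = root-old top-root , ℕₚ.≤-trans (ℕₚ.≤-reflexive (old top-root))
      (ℕₚ.≤-trans (ℕₚ.n≤1+n _) (ℕₚ.≤-trans (ℕₚ.n≤1+n _) (ℕₚ.≤-reflexive (cong suc (sym (depth-new y))))))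
    cases : circle s ∈ circle (outgoing c y) ∷ crossedCircles xs → Shallow ((c , horizontal y) ∷ xs) s x
    cases (here eq) = subst₂ Goal (sym (component-circle x eq)) (sym (component-circle (opposite x) eq))
      ([ (λ (p , q) → subst₂ Goal (cong verticalComponent (sym p)) (cong verticalComponent (sym q)) new-top)
       , (λ (p , q) → subst₂ Goal (cong verticalComponent (sym p)) (cong verticalComponent (sym q)) top-new) ]′ (side-cases c y x))
    cases (there s∈) = let (l∈ , le) = shallow G s∈ x ; (l′∈ , _) = shallow G s∈ (opposite x) in
      root-old l∈ , subst₂ _≤_ (sym (old l∈)) (cong suc (sym (old l′∈))) le

  horizontal-depth : ∀ {xs c x} → Growth xs → (c , horizontal x) ∈ xs →
                     depth xs (verticalComponent (cornerRegion c (horizontal x))) ≡ suc (depth xs (verticalComponent (cornerRegion c top)))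
  horizontal-depth {x = x} (vert G V _ _) (here eq) = contradiction eq (differ V x)
    where
    differ : ∀ {c c′ k} → IsVertical k → ∀ x → (c , horizontal x) ≢ (c′ , k)
    differ top    left  ()
    differ top    right ()
    differ bottom left  ()
    differ bottom right ()
  horizontal-depth (vert G V _ _) (there s∈) rewrite cornerView-vertical V = horizontal-depth G s∈
  horizontal-depth {x = x} (horiz {xs} {c₀} y G sat _ top∈ _ new) (here eq)
    with refl ← cong proj₁ eq | refl ← horizontal-injective x y (cong proj₂ eq) =
    trans (depth-new y) (cong suc (sym (depth-old y λ p → new-root G sat new (subst (_∈ rootComponents xs) p (covered⇒root G top∈)))))
  horizontal-depth {c = c} {x} (horiz {xs} y G sat _ _ _ new) (there s∈) =
    trans (depth-old y (λ p → fresh (step-covered s∈) p)) (trans (horizontal-depth G s∈) (cong suc (sym (depth-old y (fresh (proj₁ (used⇒covered G (∈-map⁺ proj₁ s∈))))))))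
    where
    fresh : ∀ {ρ} → ρ ∈ covered xs → verticalComponent ρ ≢ _
    fresh ρ∈ p = new-root G sat new (subst (_∈ rootComponents xs) p (covered⇒root G ρ∈))

  contribution : (Overstrand → Corner → ℕ) → List Step → Crossing → ℕ
  contribution F [] c = 0
  contribution F ((c′ , k) ∷ xs) c with c ≟ᶠ c′
  ... | yes _ = F (over c) k
  ... | no  _ = contribution F xs c

  cornerOf : List Step → Crossing → Corner
  cornerOf [] c = top
  cornerOf ((c′ , k) ∷ xs) c with c ≟ᶠ c′
  ... | yes _ = k
  ... | no  _ = cornerOf xs c

  cornerOf-unique : ∀ {xs c k} → Unique (usedCrossings xs) → (c , k) ∈ xs → cornerOf xs c ≡ k
  cornerOf-unique {(c′ , _) ∷ xs} {c} u s∈ with c ≟ᶠ c′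
  cornerOf-unique u (here refl) | yes _ = refl
  cornerOf-unique u (here refl) | no ne = contradiction refl ne
  cornerOf-unique (c≢ ∷ u) (there s∈) | yes refl = contradiction refl (All.lookup c≢ (∈-map⁺ proj₁ s∈))
  cornerOf-unique (_ ∷ u)  (there s∈) | no _ = cornerOf-unique u s∈

  cornerOf∈ : ∀ {xs c} → c ∈ usedCrossings xs → (c , cornerOf xs c) ∈ xs
  cornerOf∈ {(c′ , k) ∷ xs} {c} c∈ with c ≟ᶠ c′
  ... | yes refl = here refl
  cornerOf∈ (here eq)  | no ne = contradiction eq ne
  cornerOf∈ (there c∈) | no ne = there (cornerOf∈ c∈)

  contribution-unused : ∀ F {xs c} → c ∉ usedCrossings xs → contribution F xs c ≡ 0
  contribution-unused F {[]} c∉ = refl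
  contribution-unused F {(c′ , k) ∷ xs} {c} c∉ with c ≟ᶠ c′
  ... | yes eq = contradiction (here eq) c∉
  ... | no  _  = contribution-unused F (c∉ ∘ there)

  contribution-used : ∀ F {xs c} → c ∈ usedCrossings xs → contribution F xs c ≡ F (over c) (cornerOf xs c)
  contribution-used F {(c′ , k) ∷ xs} {c} c∈ with c ≟ᶠ c′
  ... | yes _ = refl
  contribution-used F (here eq)  | no ne = contradiction eq ne
  contribution-used F (there c∈) | no ne = contribution-used F c∈

  sum-contribution : ∀ F {xs} → Unique (usedCrossings xs) → sumℕ (contribution F xs) ≡ stepSum F xs
  sum-contribution F {[]} u = sumℕ-zero {crossings}
  sum-contribution F {(c , k) ∷ xs} (c≢ ∷ u) = trans
    (sumℕ-update (contribution F xs) (contribution F ((c , k) ∷ xs)) c (contribution-unused F λ c∈ → All.lookup c≢ c∈ refl) elsewhere)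
    (cong₂ _+_ at (sum-contribution F u))
    where
    elsewhere : ∀ j → j ≢ c → contribution F ((c , k) ∷ xs) j ≡ contribution F xs j
    elsewhere j ne with j ≟ᶠ c
    ... | yes eq = contradiction eq ne
    ... | no  _  = refl
    at : contribution F ((c , k) ∷ xs) c ≡ F (over c) k
    at with c ≟ᶠ c
    ... | yes _ = refl
    ... | no ne = contradiction refl ne

  module FromGrowth {xs : List Step} (C : Complete xs) where
    open Complete C

    -- `covered xs` lists all `2 + crossings` regions once, two of them initially, so the steps are
    -- as many as the crossings.
    all-used : ∀ c → c ∈ usedCrossings xs
    all-used = unique∧length≡⇒exhaustive (usedCrossings-unique growth) (trans (length-map proj₁ xs)
      (ℕₚ.+-cancelˡ-≡ 2 _ _ (trans (sym (length-covered xs)) (trans (unique∧exhaustive⇒length≡ (covered-unique growth) all∈) tight))))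

    corners : Vec Corner crossings
    corners = tabulate (cornerOf xs)

    step : ∀ c → (c , Vec.lookup corners c) ∈ xs
    step c = subst (λ k → (c , k) ∈ xs) (sym (lookup∘tabulate (cornerOf xs) c)) (cornerOf∈ (all-used c))

    step≡ : ∀ {c k} → (c , k) ∈ xs → Vec.lookup corners c ≡ k
    step≡ {c} s∈ = trans (lookup∘tabulate (cornerOf xs) c) (cornerOf-unique (usedCrossings-unique growth) s∈)

    sum-corners : ∀ F → sumℕ (λ c → F (over c) (Vec.lookup corners c)) ≡ stepSum F xs
    sum-corners F =
        trans (sumℕ-cong (λ c → trans (cong (F (over c)) (lookup∘tabulate (cornerOf xs) c)) (sym (contribution-used F (all-used c)))))
      (sum-contribution F (usedCrossings-unique growth))

    isState : IsState L i corners
    isState = (λ c → present growth (step c)) , λ ρ present-ρ → unique-use ρ (reached (all∈ ρ) present-ρ)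
      where
      avoid : ∀ {xs ρ} → Growth xs → ρ ∉ covered xs → Present L i ρ
      avoid G ρ∉ = (λ { refl → ρ∉ (proj₁ (ends-covered G)) }) , (λ { refl → ρ∉ (proj₂ (ends-covered G)) })
      present : ∀ {xs s} → Growth xs → s ∈ xs → Present L i (stepRegion s)
      present (vert G _ new _)        (here refl) = avoid G new
      present (vert G _ _ _)          (there s∈)  = present G s∈
      present (horiz _ G _ _ _ _ new) (here refl) = avoid G new
      present (horiz _ G _ _ _ _ _)   (there s∈)  = present G s∈
      reached : ∀ {xs ρ} → ρ ∈ covered xs → Present L i ρ → ∃ λ s → s ∈ xs × stepRegion s ≡ ρ
      reached {[]} (here eq)         (l , _) = contradiction eq l
      reached {[]} (there (here eq)) (_ , r) = contradiction eq r
      reached {s ∷ xs} (here eq)  _ = s , here refl , sym eq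
      reached {s ∷ xs} (there ρ∈) P = let (s′ , s∈ , eq) = reached ρ∈ P in s′ , there s∈ , eq
      injective : ∀ {xs s s′} → Unique (covered xs) → s ∈ xs → s′ ∈ xs → stepRegion s ≡ stepRegion s′ → s ≡ s′
      injective (_ ∷ _)  (here refl) (here refl) eq = refl
      injective (n ∷ _)  (here refl) (there s′∈) eq = contradiction eq (All.lookup n (step-covered s′∈))
      injective (n ∷ _)  (there s∈)  (here refl) eq = contradiction (sym eq) (All.lookup n (step-covered s∈))
      injective (_ ∷ u)  (there s∈)  (there s′∈) eq = injective u s∈ s′∈ eq
      unique-use : ∀ ρ → (∃ λ s → s ∈ xs × stepRegion s ≡ ρ) → _
      unique-use ρ ((c , k) , s∈ , eq) = c , trans (cong (cornerRegion c) (step≡ s∈)) eq ,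
        λ {c′} eq′ → cong proj₁ (injective (covered-unique growth) s∈ (step c′) (trans eq (sym eq′)))

    state : State
    state = corners , isState

    -- The depth is a dual solution for the problem of maximizing the number
    -- of vertical corners, with equality at every corner of this state.
    private
      h : Region → ℕ
      h ρ = depth xs (verticalComponent ρ)

      bound : ∀ c k → vertical k + h (cornerRegion c k) ≤ 1 + h (cornerRegion c top)
      bound c top    = ℕₚ.≤-refl
      bound c bottom = ℕₚ.≤-reflexive (cong (suc ∘ depth xs) (sym (verticalComponent-band c)))
      bound c left   = subst (λ ρ → h ρ ≤ 1 + h (cornerRegion c top)) (cong boundaryRegion (sym (outer c left)))
        (proj₂ (shallow {s = outgoing c left} growth (all-crossed C (outgoing c left)) left))
      bound c right  =
          subst₂ (λ ρ ρ′ → h ρ ≤ 1 + h ρ′) (cong boundaryRegion (sym (outer c right))) (cong boundaryRegion (inner-top c right))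
        (proj₂ (shallow {s = outgoing c right} growth (all-crossed C (outgoing c right)) right))

      exact : ∀ {c} k → (c , k) ∈ xs → vertical k + h (cornerRegion c k) ≡ 1 + h (cornerRegion c top)
      exact top    s∈ = refl
      exact {c} bottom s∈ = cong (suc ∘ depth xs) (sym (verticalComponent-band c))
      exact left   s∈ = horizontal-depth {x = left} growth s∈
      exact right  s∈ = horizontal-depth {x = right} growth s∈

    -- Weak duality: sum `bound` over the corners of `S` and `exact` over those of `state`. The two
    -- sums of `h` cancel because both states use the same regions.
    verticalCount-maximal : ∀ (S : State) → verticalCount (proj₁ S) ≤ verticalCount corners
    verticalCount-maximal S@(σ , _) = ℕₚ.+-cancelʳ-≤ (sumℕ (h ∘ used S)) _ _ (begin
      verticalCount σ + sumℕ (h ∘ used S)                       ≡⟨ sumℕ-+ (λ c → vertical (Vec.lookup σ c)) (h ∘ used S) ⟨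
      sumℕ (λ c → vertical (Vec.lookup σ c) + h (used S c))     ≤⟨ sumℕ-mono (λ c → bound c (Vec.lookup σ c)) ⟩
      sumℕ (λ c → 1 + h (cornerRegion c top))                   ≡⟨ sumℕ-cong (λ c → exact (Vec.lookup corners c) (step c)) ⟨
      sumℕ (λ c → vertical (Vec.lookup corners c) + h (used state c))
                                                                ≡⟨ sumℕ-+ (λ c → vertical (Vec.lookup corners c)) (h ∘ used state) ⟩
      verticalCount corners + sumℕ (h ∘ used state)             ≡⟨ cong (verticalCount corners +_) (sum-used state S h) ⟩
      verticalCount corners + sumℕ (h ∘ used S)                 ∎)
      where open ℕₚ.≤-Reasoning

  exponents-attained : ∀ {a b} → a + b + verticalComponents ≡ regions → ∃ λ S → exponent S ≡ ⁺ a ℤ.- ⁺ b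
  exponents-attained {a} {b} eq = let (xs , C , p , m) = growth-with-counts {a} {b} eq in FromGrowth.state C ,
    cong₂ (λ a b → ⁺ a ℤ.- ⁺ b) (trans (FromGrowth.sum-corners C plus) p) (trans (FromGrowth.sum-corners C minus) m)

  -- The number of vertical corners of `S` is at most that of a grown state `M`, and has the same
  -- parity by `exponent-sign`. Half of the deficit, added to both counts, preserves the difference.
  exponents-bounded : ∀ S → ∃₂ λ a b → a + b + verticalComponents ≡ regions × exponent S ≡ ⁺ a ℤ.- ⁺ b
  exponents-bounded S@(σ , _) = shift parity
    where
    -- Only the total number of vertical corners of this state matters, so the target 0 is an
    -- arbitrary choice.
    grown : ∃ λ xs → Complete xs × PlusFirst 0 xs
    grown = growth-with 0
    C = proj₁ (proj₂ grown)
    M = FromGrowth.state C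
    τ = proj₁ M
    V≤V : plusCount σ + minusCount σ ≤ plusCount τ + minusCount τ
    V≤V =
        subst₂ _≤_ (sym (plusCount+minusCount σ)) (sym (plusCount+minusCount τ)) (FromGrowth.verticalCount-maximal C S)
    rank-τ : plusCount τ + minusCount τ + verticalComponents ≡ regions
    rank-τ =
        trans (cong (_+ verticalComponents) (trans (plusCount+minusCount τ) (FromGrowth.sum-corners C (λ _ → vertical)))) (rank C)
    parity : ∃ λ z → ⁺ (plusCount τ + minusCount τ) ≡ ⁺ (plusCount σ + minusCount σ) ℤ.+ (z ℤ.+ z)
    -- The witness comes from p + m = (p - m + 2β) + 2(m - β), where the first bracket is the same
    -- for both states.
    parity =
        ⁺ minusCount τ ℤ.- signSum τ ℤ.- ⁺ minusCount σ ℤ.+ signSum σ , double {⁺ plusCount τ} {⁺ minusCount τ} {⁺ plusCount σ} {⁺ minusCount σ} {signSum τ} {signSum σ} (exponent-sign M S)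
      where
      solve₁ : ∀ p m b → p ℤ.+ m ≡ (p ℤ.- m ℤ.+ (b ℤ.+ b)) ℤ.+ ((m ℤ.- b) ℤ.+ (m ℤ.- b))
      solve₁ = ℤ-Solver.solve-∀
      solve₂ : ∀ p m b m′ b′ → (p ℤ.- m ℤ.+ (b ℤ.+ b)) ℤ.+ ((m′ ℤ.- b′) ℤ.+ (m′ ℤ.- b′)) ≡
               p ℤ.+ m ℤ.+ ((m′ ℤ.- b′ ℤ.- m ℤ.+ b) ℤ.+ (m′ ℤ.- b′ ℤ.- m ℤ.+ b))
      solve₂ = ℤ-Solver.solve-∀
      double : ∀ {p m p′ m′ b b′} → p ℤ.- m ℤ.+ (b ℤ.+ b) ≡ p′ ℤ.- m′ ℤ.+ (b′ ℤ.+ b′) →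
               p ℤ.+ m ≡ p′ ℤ.+ m′ ℤ.+ ((m ℤ.- b ℤ.- m′ ℤ.+ b′) ℤ.+ (m ℤ.- b ℤ.- m′ ℤ.+ b′))
      double {p} {m} {p′} {m′} {b} {b′} eq =
          trans (solve₁ p m b) (trans (cong (λ t → t ℤ.+ ((m ℤ.- b) ℤ.+ (m ℤ.- b))) eq) (solve₂ p′ m′ b′ m b))
    shift : (∃ λ z → ⁺ (plusCount τ + minusCount τ) ≡ ⁺ (plusCount σ + minusCount σ) ℤ.+ (z ℤ.+ z)) →
            ∃₂ λ a b → a + b + verticalComponents ≡ regions × exponent S ≡ ⁺ a ℤ.- ⁺ b
    shift (⁺ k , eq) = plusCount σ + k , minusCount σ + k ,
      trans (cong (_+ verticalComponents) (trans (exchange (plusCount σ) (minusCount σ) k) (sym (ℤₚ.+-injective eq)))) rank-τ ,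
      cancel (⁺ plusCount σ) (⁺ minusCount σ) (⁺ k)
      where
      exchange : ∀ p m k → p + k + (m + k) ≡ p + m + (k + k)
      exchange = solve-∀
      cancel : ∀ p m k → p ℤ.- m ≡ (p ℤ.+ k) ℤ.- (m ℤ.+ k)
      cancel = ℤ-Solver.solve-∀
    shift (-[1+ k ] , eq) = contradiction (ℤₚ.≤-reflexive eq) (ℤₚ.<⇒≱
      (ℤₚ.<-≤-trans (ℤₚ.+-monoʳ-< (⁺ (plusCount σ + minusCount σ)) ℤ.-<+)
        (ℤₚ.≤-trans (ℤₚ.≤-reflexive (ℤₚ.+-identityʳ _)) (ℤ.+≤+ V≤V))))

-- The two sides of a Seifert circle

iterate-suc : ∀ {A : Set} (f : A → A) x k → iterate f x (suc k) ≡ f (iterate f x k)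
iterate-suc f x zero    = refl
iterate-suc f x (suc k) = iterate-suc f (f x) k

iterate-cancel : ∀ {A : Set} {f : A → A} → Injective _≡_ _≡_ f → ∀ {x} i d → iterate f x i ≡ iterate f x (i + d) →
    x ≡ iterate f x d
iterate-cancel f-inj zero d eq = eq
iterate-cancel {f = f} f-inj {x} (suc i) d eq =
  iterate-cancel f-inj i d (f-inj (trans (sym (iterate-suc f x i)) (trans eq (iterate-suc f x (i + d)))))

iterate-returns : ∀ {A : Set} {N} → A ↔ Fin N → ∀ {f : A → A} → Injective _≡_ _≡_ f → ∀ x →
    ∃ λ k → iterate f x (suc k) ≡ x
iterate-returns enum {f} f-inj x with pigeonhole (ℕₚ.n<1+n _) (λ j → Inverse.to enum (iterate f x (toℕ j)))
... | i , j , i<j , eq with ℕₚ.m≤n⇒∃[o]m+o≡n i<j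
... | k , i+k≡j = k , sym (iterate-cancel f-inj (toℕ i) (suc k)
  (trans (↔-injective enum eq) (cong (iterate f x) (trans (sym i+k≡j) (sym (ℕₚ.+-suc (toℕ i) k))))))

module OnCircle (L : Diagram) (C : SeifertCircle L) where
  open Diagram L
  base : Segment
  base = SeifertCircle.base C
  open Planarity L base public
  open VerticalGraph L public

  next : Segment → Segment
  next = nextSegment {L}

  next-injective : Injective _≡_ _≡_ next
  next-injective {inj₁ e} {inj₁ e′} eq = cong inj₁ (↔-injective arc (inj₁-injective eq))
  next-injective {inj₂ j} {inj₂ j′} eq = eq

  ∈ᶜ-next : ∀ {s} → s ∈ᶜ C → next s ∈ᶜ C
  ∈ᶜ-next (k , refl) = suc k , iterate-suc next base k

  ∈ᶜ-previous : ∀ {s} → next s ∈ᶜ C → s ∈ᶜ C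
  ∈ᶜ-previous {s} (suc k , eq) = k , next-injective (trans (sym (iterate-suc next base k)) eq)
  -- Here `next s` is `base`, whose predecessor on the orbit is found by going around once.
  ∈ᶜ-previous {s} (zero , eq)  = let (k , eq′) = iterate-returns segments next-injective base in
    k , next-injective (trans (sym (iterate-suc next base k)) (trans eq′ eq))

  ∈ᶜ⇒circle : ∀ {s} → s ∈ᶜ C → circle s ≡ circle base
  ∈ᶜ⇒circle (k , refl) = go k
    where
    go : ∀ k → circle (iterate next base k) ≡ circle base
    go zero    = refl
    go (suc k) =
        trans (cong circle (iterate-suc next base k)) (trans (sym (next-invariant circle circle-invariant (iterate next base k))) (go k))

  circle⇒∈ᶜ : ∀ {s} → circle s ≡ circle base → s ∈ᶜ C
  circle⇒∈ᶜ {s} eq =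
      walk (Circles.forest-complete (Circles.SpanningForest.forest circleForest) {base} {s} (sym eq)) (0 , refl)
    where
    walk : ∀ {a b} → EqClosure (Circles.Via _) a b → a ∈ᶜ C → b ∈ᶜ C
    walk ε a∈ = a∈
    walk (fwd (s , _ , refl , refl) ◅ p) a∈ = walk p (∈ᶜ-next a∈)
    walk (bwd (s , _ , refl , refl) ◅ p) a∈ = walk p (∈ᶜ-previous a∈)

  sides-distinct : ∀ s → region (s , left) ≢ region (s , right)
  sides-distinct s eq = Separation.part-on (separation s) (cong (Separation.part (separation s)) eq)

  -- If both strands lay on one circle, its left side would have the label of the top corner at the
  -- right strand. At the left strand the top corner is on its right side, so the circle would not
  -- separate.
  strands-distinct : ∀ c → circle (outgoing c left) ≢ circle (outgoing c right)
  strands-distinct c eq = Separation.part-on (separation (outgoing c left)) (trans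
    (circle-connected (λ s → part (region (s , left))) (band-invariant part (Separation.part-band (separation (outgoing c left))) left) eq)
    (cong (part ∘ boundaryRegion) (inner-top c right)))
    where part = Separation.part (separation (outgoing c left))

  Linked : Region → Region → Set
  Linked = EqClosure (AdjacentOffC C)

  link : ∀ {s} → circle s ≢ circle base → Linked (region (s , left)) (region (s , right))
  link {s} ne = Eq.return (s , (λ s∈ → ne (∈ᶜ⇒circle s∈)) , refl , refl)

  link-top : ∀ c x → circle (outgoing c x) ≢ circle base → Linked (cornerRegion c top) (cornerRegion c (horizontal x))
  link-top c left  ne =
      subst (Linked (cornerRegion c top)) (cong boundaryRegion (sym (outer c left))) (Eq.symmetric _ (link ne))
  link-top c right ne =
      subst₂ Linked (cong boundaryRegion (inner-top c right)) (cong boundaryRegion (sym (outer c right))) (link ne)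

  link-bottom : ∀ c x → circle (outgoing c x) ≢ circle base →
      Linked (cornerRegion c bottom) (cornerRegion c (horizontal x))
  link-bottom c left  ne = Eq.symmetric _ (link (ne ∘ trans (sym (circle-invariant c left))))
  link-bottom c right ne =
      subst (λ ρ → Linked ρ (cornerRegion c right)) (cong boundaryRegion (inner-bottom c right)) (link (ne ∘ trans (sym (circle-invariant c right))))

  off-strand : ∀ c → ∃ λ x → circle (outgoing c x) ≢ circle base
  off-strand c with circle (outgoing c left) ≟ᶠ circle base
  ... | no  ne = left , ne
  ... | yes eq = right , λ eq′ → strands-distinct c (trans eq (sym eq′))

  -- The strands lie on different circles, so one of them is off `C`. Crossing it before and after
  -- `c` leads around the crossing through the horizontal corner beyond it.
  link-vertical : ∀ c → Linked (cornerRegion c top) (cornerRegion c bottom)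
  link-vertical c = let (x , ne) = off-strand c in Eq.transitive _ (link-top c x ne) (Eq.symmetric _ (link-bottom c x ne))

  -- Following `C`, the region on the side `x` changes only from the bottom to the top corner of a
  -- crossing, and `link-vertical` joins these off `C`.
  on-side : ∀ x {s} → s ∈ᶜ C → Component C x (region (s , x))
  on-side x (k , refl) = go k
    where
    turn : ∀ x c y → Component C x (region (incoming c y , x)) → Component C x (region (outgoing c y , x))
    turn left  c left  p = subst (Component C left) (cong boundaryRegion (outer c left)) p
    turn right c right p = subst (Component C right) (cong boundaryRegion (outer c right)) p
    turn right c left  p = Eq.transitive _ p (Eq.symmetric _ (link-vertical c))
    turn left  c right p = subst (Component C left) (cong boundaryRegion (sym (inner-top c right)))
      (Eq.transitive _ (subst (Component C left) (cong boundaryRegion (inner-bottom c right)) p) (Eq.symmetric _ (link-vertical c)))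
    step : ∀ s → Component C x (region (s , x)) → Component C x (region (next s , x))
    step (inj₂ j) p = p
    step (inj₁ e) p =
        turn x (proj₁ (to e)) (proj₂ (to e)) (subst (λ e → Component C x (region (inj₁ e , x))) (sym (Inverse.strictlyInverseʳ arc e)) p)
    go : ∀ k → Component C x (region (iterate next base k , x))
    go zero    = ε
    go (suc k) = subst (λ s → Component C x (region (s , x))) (sym (iterate-suc next base k)) (step _ (go k))

  side-of : ∀ ρ → Component C left ρ ⊎ Component C right ρ
  side-of ρ = walk (connected (region (base , left)) ρ) (inj₁ ε)
    where
    cross : ∀ s x → Component C left (region (s , x)) ⊎ Component C right (region (s , x)) →
            Component C left (region (s , opposite x)) ⊎ Component C right (region (s , opposite x))
    cross s x p with circle s ≟ᶠ circle base
    cross s left  p | yes eq = inj₂ (on-side right (circle⇒∈ᶜ eq))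
    cross s right p | yes eq = inj₁ (on-side left (circle⇒∈ᶜ eq))
    cross s left  (inj₁ p) | no ne = inj₁ (Eq.transitive _ p (link ne))
    cross s left  (inj₂ p) | no ne = inj₂ (Eq.transitive _ p (link ne))
    cross s right (inj₁ p) | no ne = inj₁ (Eq.transitive _ p (Eq.symmetric _ (link ne)))
    cross s right (inj₂ p) | no ne = inj₂ (Eq.transitive _ p (Eq.symmetric _ (link ne)))
    walk : ∀ {ρ ρ′} → EqClosure Adjacent ρ ρ′ → Component C left ρ ⊎ Component C right ρ →
        Component C left ρ′ ⊎ Component C right ρ′
    walk ε p = p
    walk (fwd (s , refl , refl) ◅ q) p = walk q (cross s left p)
    walk (bwd (s , refl , refl) ◅ q) p = walk q (cross s right p)

  sideOf : ∀ d ρ → Component C d ρ ⊎ Component C (opposite d) ρ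
  sideOf left  ρ = side-of ρ
  sideOf right ρ = [ inj₂ , inj₁ ]′ (side-of ρ)

  sidePart : Region → Fin (Separation.parts (separation base))
  sidePart = Separation.part (separation base)

  Component-part : ∀ {d ρ} → Component C d ρ → sidePart (region (base , d)) ≡ sidePart ρ
  Component-part = Eq.gfold isEquivalence sidePart
    λ { (s , s∉ , refl , refl) → Separation.part-off (separation base) s (λ eq → s∉ (circle⇒∈ᶜ eq)) }

  disjoint-part : ∀ d {ρ ρ′} → Component C d ρ → Component C (opposite d) ρ′ → sidePart ρ ≢ sidePart ρ′
  disjoint-part left  p q eq =
      Separation.part-on (separation base) (trans (Component-part p) (trans eq (sym (Component-part q))))
  disjoint-part right p q eq =
      Separation.part-on (separation base) (trans (Component-part q) (trans (sym eq) (sym (Component-part p))))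

  disjoint : ∀ d {ρ} → Component C d ρ → Component C (opposite d) ρ → ⊥
  disjoint d p q = disjoint-part d p q refl

  -- The two vertical corners and the horizontal corner beyond a strand off `C` lie on one side. If
  -- this is not `d`, only the remaining corner can lie on `d`, too few for two distinct regions.
  belongs⇒top : ∀ {d c} → BelongsTo C d c → Component C d (cornerRegion c top)
  belongs⇒top {d} {c} (k , k′ , ne , p , q) with sideOf d (cornerRegion c top)
  ... | inj₁ top∈ = top∈
  ... | inj₂ top∈ = let (x , off) = off-strand c in
    contradiction (cong (cornerRegion c) (trans (only x off k p) (sym (only x off k′ q)))) ne
    where
    impossible : ∀ {k x : Corner} {ρ} → Linked (cornerRegion c top) ρ → Component C d ρ → k ≡ x
    impossible l p = ⊥-elim (disjoint d p (Eq.transitive _ top∈ l))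
    only : ∀ x → circle (outgoing c x) ≢ circle base → ∀ k → Component C d (cornerRegion c k) →
        k ≡ horizontal (opposite x)
    only x     off top    p = impossible ε p
    only x     off bottom p = impossible (link-vertical c) p
    only left  off left   p = impossible (link-top c left off) p
    only left  off right  p = refl
    only right off left   p = refl
    only right off right  p = impossible (link-top c right off) p

  top⇒belongs : ∀ {d c} → Component C d (cornerRegion c top) → BelongsTo C d c
  top⇒belongs {d} {c} p = let (x , off) = off-strand c in
    top , horizontal x , distinct x , p , Eq.transitive _ p (link-top c x off)
    where
    distinct : ∀ x → cornerRegion c top ≢ cornerRegion c (horizontal x)
    distinct left  eq = sides-distinct (outgoing c left) (trans (cong boundaryRegion (sym (outer c left))) (sym eq))
    distinct right eq =
        sides-distinct (outgoing c right) (trans (cong boundaryRegion (inner-top c right)) (trans eq (cong boundaryRegion (outer c right))))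

-- The two diagrams of a Murasugi sum

⊎-injective⇒≤ : ∀ {a b c d} {f : Fin a ⊎ Fin b → Fin c ⊎ Fin d} → Injective _≡_ _≡_ f → a + b ≤ c + d
⊎-injective⇒≤ {a} {b} {c} {d} {f} f-inj = injective⇒≤ {f = Inverse.from +↔⊎ ∘ f ∘ Inverse.to (+↔⊎ {a} {b})} λ eq →
  ↔-injective (+↔⊎ {a} {b}) (f-inj (↔-injective (↔-sym (+↔⊎ {c} {d})) eq))

-- The classes of π are the classes of cls on P, and one further class Q.
record Collapses {A : Set} {v v′ : ℕ} (cls : A → Fin v) (P Q : A → Set) (π : A → Fin v′) : Set where
  field
    surjective : ∀ k → ∃ λ a → π a ≡ k
    preserves  : ∀ {a b} → P a → P b → cls a ≡ cls b → π a ≡ π b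
    reflects   : ∀ {a b} → P a → P b → π a ≡ π b → cls a ≡ cls b
    separates  : ∀ {a b} → P a → Q b → π a ≢ π b
    merges     : ∀ {a b} → Q a → Q b → π a ≡ π b

-- Each quotient keeps the classes of one side and adds a single class for the collapsed other side.
-- These two additional classes account for the 2, and are the images of `Fin 2` under `cut`.
glue-count : ∀ {A : Set} {v v′ v″} {cls : A → Fin v} {P Q : A → Set} {π′ : A → Fin v′} {π″ : A → Fin v″} →
             (∀ k → ∃ λ a → cls a ≡ k) → (∀ a → P a ⊎ Q a) → (∀ {a b} → P a → Q b → cls a ≢ cls b) → ∃ P → ∃ Q →
             Collapses cls P Q π′ → Collapses cls Q P π″ → v + 2 ≡ v′ + v″
glue-count {A} {v} {v′} {v″} {cls} {P} {Q} {π′} {π″} surj split apart (p₀ , Pp₀) (q₀ , Qq₀) C′ C″ =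
  ℕₚ.≤-antisym (⊎-injective⇒≤ {f = cut} cut-injective) (⊎-injective⇒≤ {f = glue} glue-injective)
  where
  module C′ = Collapses C′
  module C″ = Collapses C″
  rep : Fin v → A
  rep k = proj₁ (surj k)
  image : ∀ a → P a ⊎ Q a → Fin v′ ⊎ Fin v″
  image a (inj₁ _) = inj₁ (π′ a)
  image a (inj₂ _) = inj₂ (π″ a)
  cut : Fin v ⊎ Fin 2 → Fin v′ ⊎ Fin v″
  cut (inj₁ k)             = image (rep k) (split (rep k))
  cut (inj₂ zero)          = inj₁ (π′ q₀)
  cut (inj₂ (suc zero))    = inj₂ (π″ p₀)
  image-injective : ∀ {a b} s t → image a s ≡ image b t → cls a ≡ cls b
  image-injective (inj₁ p) (inj₁ q) eq = C′.reflects p q (inj₁-injective eq)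
  image-injective (inj₂ p) (inj₂ q) eq = C″.reflects p q (inj₂-injective eq)
  image≢₀ : ∀ {a} s → image a s ≢ inj₁ (π′ q₀)
  image≢₀ (inj₁ p) eq = C′.separates p Qq₀ (inj₁-injective eq)
  image≢₁ : ∀ {a} s → image a s ≢ inj₂ (π″ p₀)
  image≢₁ (inj₂ q) eq = C″.separates q Pp₀ (inj₂-injective eq)
  cut-injective : Injective _≡_ _≡_ cut
  cut-injective {inj₁ k} {inj₁ l} eq =
      cong inj₁ (trans (sym (proj₂ (surj k))) (trans (image-injective (split (rep k)) (split (rep l)) eq) (proj₂ (surj l))))
  cut-injective {inj₁ k} {inj₂ zero} eq = ⊥-elim (image≢₀ (split (rep k)) eq)
  cut-injective {inj₁ k} {inj₂ (suc zero)} eq = ⊥-elim (image≢₁ (split (rep k)) eq)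
  cut-injective {inj₂ zero} {inj₁ l} eq = ⊥-elim (image≢₀ (split (rep l)) (sym eq))
  cut-injective {inj₂ (suc zero)} {inj₁ l} eq = ⊥-elim (image≢₁ (split (rep l)) (sym eq))
  cut-injective {inj₂ zero} {inj₂ zero} eq = refl
  cut-injective {inj₂ zero} {inj₂ (suc zero)} ()
  cut-injective {inj₂ (suc zero)} {inj₂ zero} ()
  cut-injective {inj₂ (suc zero)} {inj₂ (suc zero)} eq = refl
  image′ : ∀ a → P a ⊎ Q a → Fin v ⊎ Fin 2
  image′ a (inj₁ _) = inj₁ (cls a)
  image′ a (inj₂ _) = inj₂ zero
  image″ : ∀ a → P a ⊎ Q a → Fin v ⊎ Fin 2
  image″ a (inj₁ _) = inj₂ (suc zero)
  image″ a (inj₂ _) = inj₁ (cls a)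
  rep′ : Fin v′ → A
  rep′ k = proj₁ (C′.surjective k)
  rep″ : Fin v″ → A
  rep″ k = proj₁ (C″.surjective k)
  glue : Fin v′ ⊎ Fin v″ → Fin v ⊎ Fin 2
  glue (inj₁ k) = image′ (rep′ k) (split (rep′ k))
  glue (inj₂ k) = image″ (rep″ k) (split (rep″ k))
  image′-injective : ∀ {a b} s t → image′ a s ≡ image′ b t → π′ a ≡ π′ b
  image′-injective (inj₁ p) (inj₁ q) eq = C′.preserves p q (inj₁-injective eq)
  image′-injective (inj₂ p) (inj₂ q) eq = C′.merges p q
  image″-injective : ∀ {a b} s t → image″ a s ≡ image″ b t → π″ a ≡ π″ b
  image″-injective (inj₁ p) (inj₁ q) eq = C″.merges p q
  image″-injective (inj₂ p) (inj₂ q) eq = C″.preserves p q (inj₁-injective eq)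
  image′≢image″ : ∀ {a b} s t → image′ a s ≢ image″ b t
  image′≢image″ (inj₁ p) (inj₂ q) eq = apart p q (inj₁-injective eq)
  image′≢image″ (inj₁ _) (inj₁ _) ()
  image′≢image″ (inj₂ _) (inj₁ _) ()
  image′≢image″ (inj₂ _) (inj₂ _) ()
  glue-injective : Injective _≡_ _≡_ glue
  glue-injective {inj₁ k} {inj₁ l} eq = cong inj₁ (trans (sym (proj₂ (C′.surjective k)))
    (trans (image′-injective (split (rep′ k)) (split (rep′ l)) eq) (proj₂ (C′.surjective l))))
  glue-injective {inj₂ k} {inj₂ l} eq = cong inj₂ (trans (sym (proj₂ (C″.surjective k)))
    (trans (image″-injective (split (rep″ k)) (split (rep″ l)) eq) (proj₂ (C″.surjective l))))
  glue-injective {inj₁ k} {inj₂ l} eq = ⊥-elim (image′≢image″ (split (rep′ k)) (split (rep″ l)) eq)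
  glue-injective {inj₂ k} {inj₁ l} eq = ⊥-elim (image′≢image″ (split (rep′ l)) (split (rep″ k)) (sym eq))

-- Smoothing continues an arriving understrand by the leaving overstrand. Together with alternation,
-- this makes all segments of a Seifert circle leave over, or none.
leavesOver-next : ∀ {L} → Alternating L → ∀ e → LeavesOver L e ⇔ LeavesOver L (Diagram.to L e)
leavesOver-next {L} alt e = mk⇔
  (λ p → [ id , (λ q → contradiction q (Equivalence.to (alt e) p)) ]′ (overHead⊎overTail _ _))
  (λ p → Equivalence.from (alt e) λ q → overHead≢overTail _ (trans (sym p) q))

module PartFacts {L : Diagram} {C : SeifertCircle L} {L′ : Diagram} {d : Side} (P : Part L L′ C d) where
  open Diagram L
  open OnCircle L C public
  open Part P
  private
    module L′ = Diagram L′
    module V′ = VerticalGraph L′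

  belongs : ∀ c′ → Component C d (cornerRegion (crossingOf c′) top)
  belongs c′ = belongs⇒top (Equivalence.from (crossingOf-image (crossingOf c′)) (c′ , refl))

  crossing-of : ∀ {c} → Component C d (cornerRegion c top) → ∃ λ c′ → crossingOf c′ ≡ c
  crossing-of {c} p = Equivalence.to (crossingOf-image c) (top⇒belongs p)

  merge-opposite : ∀ {ρ₁ ρ₂} → Component C (opposite d) ρ₁ → Component C (opposite d) ρ₂ → regionOf ρ₁ ≡ regionOf ρ₂
  merge-opposite p q = Equivalence.from (regionOf-merges _ _) (inj₂ (p , q))

  regionOf-reflects : ∀ {ρ₁ ρ₂} → Component C d ρ₁ → regionOf ρ₁ ≡ regionOf ρ₂ → ρ₁ ≡ ρ₂
  regionOf-reflects p eq with Equivalence.to (regionOf-merges _ _) eq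
  ... | inj₁ eq′     = eq′
  ... | inj₂ (q , _) = ⊥-elim (disjoint d p q)

  -- A smoothed crossing has its top and bottom corners on the side `opposite d`, where `regionOf`
  -- merges them. So a flank passing the crossing stays within one region of `L′`.
  smoothed-region : ∀ {e f} → SmoothedArc C d e f → ∀ x →
      regionOf (region (inj₁ e , x)) ≡ regionOf (region (inj₁ (from f) , x))
  smoothed-region {e} (arrive _) x =
      cong (λ e → regionOf (region (inj₁ e , x))) (sym (Inverse.strictlyInverseʳ arc e))
  smoothed-region {e} (smooth _ ¬b rest) x =
      trans (cong (λ e → regionOf (region (inj₁ e , x))) (sym (Inverse.strictlyInverseʳ arc e)))
    (trans (turn (proj₁ (to e)) (proj₂ (to e)) ¬b x) (smoothed-region rest x))
    where
    turn : ∀ c y → ¬ BelongsTo C d c → ∀ x →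
        regionOf (region (incoming c y , x)) ≡ regionOf (region (outgoing c y , x))
    turn c y ¬b x = cases x y
      where
      top∈ : Component C (opposite d) (cornerRegion c top)
      top∈ = [ (λ p → contradiction (top⇒belongs p) ¬b) , id ]′ (sideOf d (cornerRegion c top))
      vertical-merge : regionOf (cornerRegion c bottom) ≡ regionOf (cornerRegion c top)
      vertical-merge = merge-opposite (Eq.transitive _ top∈ (link-vertical c)) top∈
      cases : ∀ x y → regionOf (region (incoming c y , x)) ≡ regionOf (region (outgoing c y , x))
      cases left  left  = cong (regionOf ∘ boundaryRegion) (outer c left)
      cases right right = cong (regionOf ∘ boundaryRegion) (outer c right)
      cases right left  = vertical-merge
      cases left  right =
          trans (cong (regionOf ∘ boundaryRegion) (inner-bottom c right)) (trans vertical-merge (cong (regionOf ∘ boundaryRegion) (sym (inner-top c right))))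

  top-region : ∀ c′ → L′.cornerRegion c′ top ≡ regionOf (cornerRegion (crossingOf c′) top)
  top-region c′ = region-preserved (inj₁ (c′ , left)) right

  -- The incoming segment of `L′` is named by its start, which in `L` may lie several smoothed
  -- crossings before `c′`; `smoothed-region` carries the region along.
  bottom-region : ∀ c′ → L′.cornerRegion c′ bottom ≡ regionOf (cornerRegion (crossingOf c′) bottom)
  bottom-region c′ = trans (region-preserved (inj₁ e′) right) (smoothed-region
    (subst (λ f → SmoothedArc C d (endOf e′) (endOf f)) (Inverse.strictlyInverseˡ L′.arc (c′ , left)) (arc-smoothed e′)) right)
    where e′ = L′.from (c′ , left)

  -- A smoothed arc follows a Seifert circle through the smoothed crossings, so `leavesOver-next`
  -- reduces its condition to that of its last segment in `L`.
  alternating-part : Alternating L → Alternating L′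
  alternating-part alt e′ = mk⇔
    (λ p q → Equivalence.to along (Equivalence.to leaves p) (arrives q))
    (λ nq → Equivalence.from leaves (Equivalence.from along (nq ∘ arrives⁻)))
    where
    overs = over-preserved
    leaves : LeavesOver L′ e′ ⇔ LeavesOver L (endOf e′)
    leaves = mk⇔ (λ p → trans p (cong overHead (overs _))) (λ p → trans p (cong overHead (sym (overs _))))
    arrives : ArrivesOver L′ (L′.to e′) → ArrivesOver L (endOf (L′.to e′))
    arrives p = trans p (cong overTail (overs _))
    arrives⁻ : ArrivesOver L (endOf (L′.to e′)) → ArrivesOver L′ (L′.to e′)
    arrives⁻ p = trans p (cong overTail (sym (overs _)))
    smoothed : ∀ {e f} → SmoothedArc C d e f → LeavesOver L e ⇔ (¬ ArrivesOver L f)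
    smoothed {e} (arrive _) = alt e
    smoothed {e} (smooth _ _ rest) = mk⇔
      (Equivalence.to (smoothed rest) ∘ Equivalence.to (leavesOver-next {L} alt e))
      (Equivalence.from (leavesOver-next {L} alt e) ∘ Equivalence.from (smoothed rest))
    along : LeavesOver L (endOf e′) ⇔ (¬ ArrivesOver L (endOf (L′.to e′)))
    along = smoothed (arc-smoothed e′)

  region-collapses : Collapses id (Component C d) (Component C (opposite d)) regionOf
  region-collapses = record
    { surjective = regionOf-surjective
    ; preserves  = λ _ _ → cong regionOf
    ; reflects   = λ p _ → regionOf-reflects p
    ; separates  = λ p q eq → disjoint d p (subst (Component C (opposite d)) (sym (regionOf-reflects p eq)) q)
    ; merges     = merge-opposite
    }

  private
    π : Region → Fin V′.verticalComponents
    π ρ = V′.verticalComponent (regionOf ρ)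

    π-band : ∀ c → π (cornerRegion c top) ≡ π (cornerRegion c bottom)
    π-band c with sideOf d (cornerRegion c top)
    ... | inj₂ q = cong V′.verticalComponent (merge-opposite q (Eq.transitive _ q (link-vertical c)))
    ... | inj₁ p with crossing-of p
    ... | c′ , refl =
        trans (cong V′.verticalComponent (sym (top-region c′))) (trans (V′.verticalComponent-band c′) (cong V′.verticalComponent (bottom-region c′)))

    origin : L′.Region → Region
    origin ρ′ = proj₁ (regionOf-surjective ρ′)

    -- A partial inverse to the map that `regionOf` induces on vertical components, with `nothing`
    -- for the merged region. Its invariance under the bands of `L′` shows that `L′` joins no
    -- components that were apart.
    trace : ∀ ρ → Component C d ρ ⊎ Component C (opposite d) ρ → Maybe (Fin verticalComponents)
    trace ρ (inj₁ _) = just (verticalComponent ρ)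
    trace ρ (inj₂ _) = nothing

    trace′ : L′.Region → Maybe (Fin verticalComponents)
    trace′ ρ′ = trace (origin ρ′) (sideOf d (origin ρ′))

    trace-inside : ∀ {ρ} → Component C d ρ → trace′ (regionOf ρ) ≡ just (verticalComponent ρ)
    trace-inside {ρ} p with regionOf-reflects p (sym (proj₂ (regionOf-surjective (regionOf ρ)))) | sideOf d (origin (regionOf ρ))
    ... | eq | inj₁ _ = cong (just ∘ verticalComponent) (sym eq)
    ... | eq | inj₂ q = ⊥-elim (disjoint d p (subst (Component C (opposite d)) (sym eq) q))

    trace-outside : ∀ {ρ} → Component C (opposite d) ρ → trace′ (regionOf ρ) ≡ nothing
    trace-outside {ρ} q with sideOf d (origin (regionOf ρ))
    ... | inj₂ _ = refl
    ... | inj₁ p =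
        ⊥-elim (disjoint d p (subst (Component C (opposite d)) (sym (regionOf-reflects p (proj₂ (regionOf-surjective (regionOf ρ))))) q))

    trace-band : ∀ c′ → trace′ (L′.cornerRegion c′ top) ≡ trace′ (L′.cornerRegion c′ bottom)
    trace-band c′ = begin
      trace′ (L′.cornerRegion c′ top)              ≡⟨ cong trace′ (top-region c′) ⟩
      trace′ (regionOf (cornerRegion c top))       ≡⟨ trace-inside (belongs c′) ⟩
      just (verticalComponent (cornerRegion c top)) ≡⟨ cong just (verticalComponent-band c) ⟩
      just (verticalComponent (cornerRegion c bottom)) ≡⟨ trace-inside (Eq.transitive _ (belongs c′) (link-vertical c)) ⟨
      trace′ (regionOf (cornerRegion c bottom))    ≡⟨ cong trace′ (bottom-region c′) ⟨
      trace′ (L′.cornerRegion c′ bottom)           ∎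
      where
      open ≡-Reasoning
      c = crossingOf c′

    trace-π : ∀ {ρ₁ ρ₂} → π ρ₁ ≡ π ρ₂ → trace′ (regionOf ρ₁) ≡ trace′ (regionOf ρ₂)
    trace-π = V′.verticalComponent-connected trace′ trace-band

  component-collapses : Collapses verticalComponent (Component C d) (Component C (opposite d)) π
  component-collapses = record
    { surjective = λ k → let (ρ′ , eq) = V′.Vertical.forest-surjective (V′.Vertical.SpanningForest.forest V′.verticalForest) k
                             (ρ , eq′) = regionOf-surjective ρ′ in ρ , trans (cong V′.verticalComponent eq′) eq
    ; preserves  = λ _ _ → verticalComponent-connected π π-band
    ; reflects   = λ p q eq → just-injective (trans (sym (trace-inside p)) (trans (trace-π eq) (trace-inside q)))
    ; separates  = λ p q eq → just≢nothing (trans (sym (trace-inside p)) (trans (trace-π eq) (trace-outside q)))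
    ; merges     = λ p q → cong V′.verticalComponent (merge-opposite p q)
    }
    where
    just≢nothing : ∀ {A : Set} {a : A} → just a ≢ nothing
    just≢nothing ()

-- Supports

-- Equal exponents come with equal signs.
Coherent : Laurent → Set
Coherent p = ∃ λ κ → ∀ {m} → m ∈ p → ∃ λ β → proj₁ m ≡ sgn β × proj₂ m ℤ.+ (β ℤ.+ β) ≡ κ

double-injective : ∀ β β′ → β ℤ.+ β ≡ β′ ℤ.+ β′ → β ≡ β′
double-injective β β′ eq = ℤₚ.*-cancelˡ-≡ (⁺ 2) β β′ (trans (double β) (trans eq (sym (double β′))))
  where
  double : ∀ b → ⁺ 2 ℤ.* b ≡ b ℤ.+ b
  double = ℤ-Solver.solve-∀

sum-constant : ∀ {u : ℤ} {qs} → All (_≡ u) qs → foldr ℤ._+_ 0ℤ qs ≡ ⁺ length qs ℤ.* u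
sum-constant {u} [] = sym (ℤₚ.*-zeroˡ u)
sum-constant {u} {_ ∷ qs} (refl ∷ all) = trans (cong (ℤ._+_ u) (sum-constant all)) (sym (ℤₚ.suc-* (⁺ length qs) u))

HasExponent : Laurent → ℤ → Set
HasExponent p e = ∃ λ m → m ∈ p × proj₂ m ≡ e

support⇒exponent : ∀ p {e} → Support p e → HasExponent p e
support⇒exponent p {e} s = nonempty (filter (λ m → proj₂ m ℤₚ.≟ e) p) refl
  where
  nonempty : ∀ ms → filter (λ m → proj₂ m ℤₚ.≟ e) p ≡ ms → HasExponent p e
  nonempty [] eq = contradiction (cong (foldr ℤ._+_ 0ℤ ∘ map proj₁) eq) s
  nonempty (m ∷ ms) eq = let (m∈ , m≡) = ∈-filter⁻ (λ m → proj₂ m ℤₚ.≟ e) {xs = p} (subst (m ∈_) (sym eq) (here refl)) in m , m∈ , m≡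

-- All monomials with exponent `e` have the same sign, so the coefficient is their positive number
-- times a unit.
exponent⇒support : ∀ {p} → Coherent p → ∀ {e} → HasExponent p e → Support p e
exponent⇒support {p} (κ , coh) {e} ((a , .e) , m∈ , refl) zero-coeff =
  [ (λ len≡0 → length≢0 (∈-map⁺ proj₁ (∈-filter⁺ E? m∈ refl)) (ℤₚ.+-injective len≡0))
  , (λ a≡0 → unit≢0 (sgn-unit β) (trans (sym a≡) a≡0)) ]′
  (ℤₚ.i*j≡0⇒i≡0∨j≡0 (⁺ length (map proj₁ (filter E? p))) (trans (sym (sum-constant constant)) zero-coeff))
  where
  E? : ∀ (m : Monomial) → Dec (proj₂ m ≡ e)
  E? m = proj₂ m ℤₚ.≟ e
  β = proj₁ (coh m∈)
  a≡ : a ≡ sgn β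
  a≡ = proj₁ (proj₂ (coh m∈))
  length≢0 : ∀ {q : ℤ} {qs} → q ∈ qs → length qs ≢ 0
  length≢0 (here _) ()
  unit≢0 : ∀ {u} → u ≡ 1ℤ ⊎ u ≡ -1ℤ → u ≢ 0ℤ
  unit≢0 (inj₁ refl) ()
  unit≢0 (inj₂ refl) ()
  same : ∀ {q} → q ∈ map proj₁ (filter E? p) → q ≡ a
  same q∈ with ∈-map⁻ proj₁ q∈
  ... | (_ , e′) , m′∈ , refl with ∈-filter⁻ E? {xs = p} m′∈
  ... | m′∈p , refl = let (β′ , a′≡ , κ≡) = coh m′∈p in trans a′≡ (trans
    (cong sgn (double-injective β′ β (ℤ-cancelˡ e _ _ (trans κ≡ (sym (proj₂ (proj₂ (coh m∈)))))))) (sym a≡))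
  constant : All (_≡ a) (map proj₁ (filter E? p))
  constant = All.tabulate same

⊛-coherent : ∀ {p q} → Coherent p → Coherent q → Coherent (p ⊛ q)
⊛-coherent {p} {q} (κ , coh) (κ′ , coh′) = κ ℤ.+ κ′ , product
  where
  shuffle : ∀ e e′ b b′ → (e ℤ.+ e′) ℤ.+ ((b ℤ.+ b′) ℤ.+ (b ℤ.+ b′)) ≡ (e ℤ.+ (b ℤ.+ b)) ℤ.+ (e′ ℤ.+ (b′ ℤ.+ b′))
  shuffle = ℤ-Solver.solve-∀
  product : ∀ {m} → m ∈ p ⊛ q → ∃ λ β → proj₁ m ≡ sgn β × proj₂ m ℤ.+ (β ℤ.+ β) ≡ κ ℤ.+ κ′
  product m∈ with ∈-cartesianProductWith⁻ _·_ p q m∈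
  ... | (a , e) , (b , e′) , m₁∈ , m₂∈ , refl = let (β , a≡ , κ≡) = coh m₁∈ ; (β′ , b≡ , κ′≡) = coh′ m₂∈ in
    β ℤ.+ β′ , trans (cong₂ ℤ._*_ a≡ b≡) (sym (sgn-+ β β′)) , trans (shuffle e e′ β β′) (cong₂ ℤ._+_ κ≡ κ′≡)

∈-cornerAssignments : ∀ {n} (σ : Vec Corner n) → σ ∈ cornerAssignments n
∈-cornerAssignments Vec.[]      = here refl
∈-cornerAssignments (k Vec.∷ σ) = ∈-cartesianProductWith⁺ Vec._∷_ (corner∈ k) (∈-cornerAssignments σ)
  where
  corner∈ : ∀ k → k ∈ top ∷ bottom ∷ left ∷ right ∷ []
  corner∈ top    = here refl
  corner∈ bottom = there (here refl)
  corner∈ left   = there (there (here refl))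
  corner∈ right  = there (there (there (here refl)))

module StateSum (L : Diagram) (i : Diagram.Segment L) where
  open Diagram L
  open States L i

  state⇒monomial : (S : State) → stateWeight L i (proj₁ S) ∈ Δ̃ L i
  state⇒monomial (σ , isS) = ∈-map⁺ (stateWeight L i) (∈-filter⁺ (isState? L i) (∈-cornerAssignments σ) isS)

  monomial⇒state : ∀ {m} → m ∈ Δ̃ L i → ∃ λ (S : State) → m ≡ stateWeight L i (proj₁ S)
  monomial⇒state m∈ with ∈-map⁻ (stateWeight L i) m∈
  ... | σ , σ∈ , eq = (σ , proj₂ (∈-filter⁻ (isState? L i) {xs = cornerAssignments crossings} σ∈)) , eq

  -- A state reaches each present region from a crossing, so there are at most `2 + crossings`
  -- regions; the opposite inequality holds for every diagram with a segment.
  state⇒tight : State → regions ≡ 2 + crossings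
  state⇒tight (σ , _ , unique) = ℕₚ.≤-antisym
    (ℕₚ.≤-trans (exhaustive⇒≤length {xs = region (i , left) ∷ region (i , right) ∷ map (usedRegion L i σ) (allFin crossings)} listed)
      (ℕₚ.≤-reflexive (cong (2 +_) (trans (length-map _ (allFin crossings)) (length-allFin crossings)))))
    (Planarity.2+crossings≤regions L i)
    where
    listed : ∀ ρ → ρ ∈ region (i , left) ∷ region (i , right) ∷ map (usedRegion L i σ) (allFin crossings)
    listed ρ with ρ ≟ᶠ region (i , left) | ρ ≟ᶠ region (i , right)
    ... | yes eq | _      = here eq
    ... | no _   | yes eq = there (here eq)
    ... | no l   | no r   = let (c , eq , _) = unique ρ (l , r) in
      there (there (subst (_∈ map (usedRegion L i σ) (allFin crossings)) eq (∈-map⁺ (usedRegion L i σ) (∈-allFin c))))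

  support⇒tight : ∀ {e} → HasExponent (Δ̃ L i) e → regions ≡ 2 + crossings
  support⇒tight (_ , m∈ , _) = state⇒tight (proj₁ (monomial⇒state m∈))

  module _ (alt : Alternating L) (tight : regions ≡ 2 + crossings) where
    open Exponents L i alt tight using (exponent; exponent-sign; exponents-attained; exponents-bounded)

    abstract
      attained : ∀ {a b} → a + b + VerticalGraph.verticalComponents L ≡ regions → HasExponent (Δ̃ L i) (⁺ a ℤ.- ⁺ b)
      attained {a} {b} eq = let (S , e≡) = exponents-attained {a} {b} eq in
        _ , state⇒monomial S , trans (cong proj₂ (stateWeight≡ (proj₁ S))) e≡

      bounded : ∀ {e} → HasExponent (Δ̃ L i) e →
          ∃₂ λ a b → a + b + VerticalGraph.verticalComponents L ≡ regions × e ≡ ⁺ a ℤ.- ⁺ b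
      bounded (m , m∈ , refl) = let (S , m≡) = monomial⇒state m∈ ; (a , b , eq , e≡) = exponents-bounded S in
        a , b , eq , trans (cong proj₂ (trans m≡ (stateWeight≡ (proj₁ S)))) e≡

      coherent : Coherent (Δ̃ L i)
      coherent = exponent S₀ ℤ.+ (signSum (proj₁ S₀) ℤ.+ signSum (proj₁ S₀)) , λ m∈ → let (S , m≡) = monomial⇒state m∈ ; eq = trans m≡ (stateWeight≡ (proj₁ S)) in
        signSum (proj₁ S) , cong proj₁ eq , trans (cong (ℤ._+ (signSum (proj₁ S) ℤ.+ signSum (proj₁ S))) (cong proj₂ eq)) (exponent-sign S S₀)
        where
        -- Any state determines the constant κ; this one has no minus corners.
        S₀ : State
        S₀ = let (m , rank) = VerticalGraph.vertical-rank L in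
            proj₁ (exponents-attained {m} {0} (trans (cong (_+ VerticalGraph.verticalComponents L) (ℕₚ.+-identityʳ m)) rank))

-- This makes the exponents belonging to `m + n` sums of those belonging to `m` and `n`. The first
-- summand takes as much of `a` as fits into `m`.
split-sum : ∀ {a b m n} → a + b ≡ m + n →
    ∃₂ λ a′ a″ → ∃₂ λ b′ b″ → a′ + a″ ≡ a × b′ + b″ ≡ b × a′ + b′ ≡ m × a″ + b″ ≡ n
split-sum {a} {b} {m} {n} eq with ℕₚ.≤-total a m
... | inj₁ a≤m with ℕₚ.m≤n⇒∃[o]m+o≡n a≤m
... | k , refl =
    a , 0 , k , n , ℕₚ.+-identityʳ a , sym (ℕₚ.+-cancelˡ-≡ a _ _ (trans eq (ℕₚ.+-assoc a k n))) , refl , refl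
split-sum {a} {b} {m} {n} eq | inj₂ m≤a with ℕₚ.m≤n⇒∃[o]m+o≡n m≤a
... | k , refl =
    m , k , 0 , b , refl , refl , ℕₚ.+-identityʳ m , ℕₚ.+-cancelˡ-≡ m _ _ (trans (sym (ℕₚ.+-assoc m k b)) eq)

-- Additivity and comparison of the supports

module MurasugiSum {L L′ L″ : Diagram} {C : SeifertCircle L} {d : Side}
                   (P′ : Part L L′ C d) (P″ : Part L L″ C (opposite d)) where
  private
    module L  = Diagram L
    module L′ = Diagram L′
    module L″ = Diagram L″
    module F′ = PartFacts P′
    module F″ = PartFacts P″
    open VerticalGraph L  using () renaming (verticalComponents to v)
    open VerticalGraph L′ using () renaming (verticalComponents to v′)
    open VerticalGraph L″ using () renaming (verticalComponents to v″)
  open OnCircle L C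

  private
    reside : ∀ {v v″ : ℕ} {cls : L.Region → Fin v} {π : L.Region → Fin v″} →
             Collapses cls (Component C (opposite d)) (Component C (opposite (opposite d))) π →
             Collapses cls (Component C (opposite d)) (Component C d) π
    reside {cls = cls} {π} =
        subst (λ x → Collapses cls (Component C (opposite d)) (Component C x) π) (opposite-involutive d)

  regions-count : L.regions + 2 ≡ L′.regions + L″.regions
  regions-count = glue-count {cls = id} (λ ρ → ρ , refl) (sideOf d) (λ { p q refl → disjoint d p q }) (_ , ε) (_ , ε)
    F′.region-collapses (reside F″.region-collapses)

  -- The vertical components are cut by `C` like the regions, with the same surplus 2. The surpluses
  -- cancel in `regions` minus components, so the number of vertical steps in a complete growth is
  -- additive.
  components-count : v + 2 ≡ v′ + v″
  components-count =
      glue-count (Vertical.forest-surjective (Vertical.SpanningForest.forest verticalForest)) (sideOf d)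
    (λ p q eq → disjoint-part d p q (verticalComponent-connected sidePart (Separation.part-band (separation base)) eq)) (_ , ε) (_ , ε)
    F′.component-collapses (reside F″.component-collapses)

  crossings-count : L.crossings ≡ L′.crossings + L″.crossings
  crossings-count = ℕₚ.≤-antisym
    (subst (_≤ L′.crossings + L″.crossings) (ℕₚ.+-identityʳ L.crossings) (⊎-injective⇒≤ {b = 0} {f = find} (λ {x} {y} → find-injective {x} {y})))
    (subst (L′.crossings + L″.crossings ≤_) (ℕₚ.+-identityʳ L.crossings) (⊎-injective⇒≤ {d = 0} {f = inj₁ ∘ include} (include-injective ∘ inj₁-injective)))
    where
    include : L′.Crossing ⊎ L″.Crossing → L.Crossing
    include = [ Part.crossingOf P′ , Part.crossingOf P″ ]′
    include-injective : Injective _≡_ _≡_ include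
    include-injective {inj₁ _} {inj₁ _} eq = cong inj₁ (Part.crossingOf-injective P′ eq)
    include-injective {inj₂ _} {inj₂ _} eq = cong inj₂ (Part.crossingOf-injective P″ eq)
    include-injective {inj₁ c} {inj₂ c′} eq =
        ⊥-elim (disjoint d (F′.belongs c) (subst (λ c → Component C (opposite d) (L.cornerRegion c top)) (sym eq) (F″.belongs c′)))
    include-injective {inj₂ c} {inj₁ c′} eq =
        ⊥-elim (disjoint d (F′.belongs c′) (subst (λ c → Component C (opposite d) (L.cornerRegion c top)) eq (F″.belongs c)))
    find′ : ∀ c → ∃ λ x → include x ≡ c
    find′ c with sideOf d (L.cornerRegion c top)
    ... | inj₁ p = let (c′ , eq) = F′.crossing-of p in inj₁ c′ , eq
    ... | inj₂ p = let (c″ , eq) = F″.crossing-of p in inj₂ c″ , eq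
    find : L.Crossing ⊎ Fin 0 → L′.Crossing ⊎ L″.Crossing
    find (inj₁ c) = proj₁ (find′ c)
    find-injective : Injective _≡_ _≡_ find
    find-injective {inj₁ c} {inj₁ c′} eq =
        cong inj₁ (trans (sym (proj₂ (find′ c))) (trans (cong include eq) (proj₂ (find′ c′))))

  -- The excess of `regions` over `2 + crossings` is additive and nonnegative on both parts, so it
  -- vanishes on each if it vanishes on `L`.
  tight-parts : L.regions ≡ 2 + L.crossings → 2 + L′.crossings ≤ L′.regions → 2 + L″.crossings ≤ L″.regions →
                L′.regions ≡ 2 + L′.crossings × L″.regions ≡ 2 + L″.crossings
  tight-parts tight le′ le″ =
    ℕₚ.≤-antisym (ℕₚ.+-cancelʳ-≤ L″.regions _ _ (ℕₚ.≤-trans (ℕₚ.≤-reflexive total) (ℕₚ.+-monoʳ-≤ (2 + L′.crossings) le″))) le′ ,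
    ℕₚ.≤-antisym (ℕₚ.+-cancelˡ-≤ L′.regions _ _ (ℕₚ.≤-trans (ℕₚ.≤-reflexive total) (ℕₚ.+-monoˡ-≤ (2 + L″.crossings) le′))) le″
    where
    shuffle : ∀ n n′ → 2 + (n + n′) + 2 ≡ (2 + n) + (2 + n′)
    shuffle = solve-∀
    total : L′.regions + L″.regions ≡ (2 + L′.crossings) + (2 + L″.crossings)
    total =
        trans (sym regions-count) (trans (cong (_+ 2) (trans tight (cong (2 +_) crossings-count))) (shuffle L′.crossings L″.crossings))

  tight-sum : L′.regions ≡ 2 + L′.crossings → L″.regions ≡ 2 + L″.crossings → L.regions ≡ 2 + L.crossings
  tight-sum t′ t″ =
      ℕₚ.+-cancelʳ-≡ 2 _ _ (trans regions-count (trans (cong₂ _+_ t′ t″) (trans (shuffle L′.crossings L″.crossings) (cong (λ n → 2 + n + 2) (sym crossings-count)))))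
    where
    shuffle : ∀ n n′ → (2 + n) + (2 + n′) ≡ 2 + (n + n′) + 2
    shuffle = solve-∀

  module _ (alt : Alternating L) (i : L.Segment) (i′ : L′.Segment) (i″ : L″.Segment) where
    private
      module S  = StateSum L i
      module S′ = StateSum L′ i′
      module S″ = StateSum L″ i″
      alt′ = F′.alternating-part alt
      alt″ = F″.alternating-part alt

      exchange : ∀ a b c d → a + b + (c + d) ≡ (a + c) + (b + d)
      exchange = solve-∀

      difference : ∀ a b c d → (a ℤ.+ b) ℤ.- (c ℤ.+ d) ≡ (a ℤ.- c) ℤ.+ (b ℤ.- d)
      difference = ℤ-Solver.solve-∀

    exponent⇒product : ∀ {e} → HasExponent (Δ̃ L i) e → L′.regions ≡ 2 + L′.crossings →
        L″.regions ≡ 2 + L″.crossings →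
                       HasExponent (Δ̃ L′ i′ ⊛ Δ̃ L″ i″) e
    exponent⇒product h t′ t″ =
      let (a , b , eq , e≡) = S.bounded alt (S.support⇒tight h) h
          (m′ , rank′) = VerticalGraph.vertical-rank L′
          (m″ , rank″) = VerticalGraph.vertical-rank L″
      in subst (HasExponent (Δ̃ L′ i′ ⊛ Δ̃ L″ i″)) (sym e≡) (multiply {a} {b} rank′ rank″ (split-sum {a} {b} {m′} {m″} (total {a} {b} {m′} {m″} eq rank′ rank″)))
      where
      total : ∀ {a b m′ m″} → a + b + v ≡ L.regions → m′ + v′ ≡ L′.regions → m″ + v″ ≡ L″.regions → a + b ≡ m′ + m″
      total {a} {b} {m′} {m″} eq rank′ rank″ = ℕₚ.+-cancelʳ-≡ (v′ + v″) _ _ (begin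
        a + b + (v′ + v″)        ≡⟨ cong (a + b +_) components-count ⟨
        a + b + (v + 2)          ≡⟨ ℕₚ.+-assoc (a + b) v 2 ⟨
        a + b + v + 2            ≡⟨ cong (_+ 2) eq ⟩
        L.regions + 2            ≡⟨ regions-count ⟩
        L′.regions + L″.regions  ≡⟨ cong₂ _+_ rank′ rank″ ⟨
        (m′ + v′) + (m″ + v″)    ≡⟨ exchange m′ v′ m″ v″ ⟩
        (m′ + m″) + (v′ + v″)    ∎)
        where open ≡-Reasoning
      multiply : ∀ {a b m′ m″} → m′ + v′ ≡ L′.regions → m″ + v″ ≡ L″.regions →
                 (∃₂ λ a′ a″ → ∃₂ λ b′ b″ → a′ + a″ ≡ a × b′ + b″ ≡ b × a′ + b′ ≡ m′ × a″ + b″ ≡ m″) →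
                 HasExponent (Δ̃ L′ i′ ⊛ Δ̃ L″ i″) (⁺ a ℤ.- ⁺ b)
      multiply rank′ rank″ (a′ , a″ , b′ , b″ , refl , refl , eq′ , eq″) =
        let (m₁ , m₁∈ , e₁) = S′.attained alt′ t′ {a′} {b′} (trans (cong (_+ v′) eq′) rank′)
            (m₂ , m₂∈ , e₂) = S″.attained alt″ t″ {a″} {b″} (trans (cong (_+ v″) eq″) rank″)
        in m₁ · m₂ , ∈-cartesianProductWith⁺ _·_ m₁∈ m₂∈ , trans (cong₂ ℤ._+_ e₁ e₂) (sym (difference (⁺ a′) (⁺ a″) (⁺ b′) (⁺ b″)))

    product⇒exponent : ∀ {e} → HasExponent (Δ̃ L′ i′ ⊛ Δ̃ L″ i″) e →
        L.regions ≡ 2 + L.crossings × HasExponent (Δ̃ L i) e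
    product⇒exponent (m , m∈ , e≡) =
      let (m₁ , m₂ , m₁∈ , m₂∈ , m≡) = ∈-cartesianProductWith⁻ _·_ (Δ̃ L′ i′) (Δ̃ L″ i″) m∈
          h₁ = m₁ , m₁∈ , refl
          h₂ = m₂ , m₂∈ , refl
          t′ = S′.support⇒tight h₁
          t″ = S″.support⇒tight h₂
          (a′ , b′ , eq′ , e₁) = S′.bounded alt′ t′ h₁
          (a″ , b″ , eq″ , e₂) = S″.bounded alt″ t″ h₂
      in tight-sum t′ t″ , subst (HasExponent (Δ̃ L i))
        (trans (difference (⁺ a′) (⁺ a″) (⁺ b′) (⁺ b″)) (trans (sym (cong₂ ℤ._+_ e₁ e₂)) (trans (cong proj₂ (sym m≡)) e≡)))
        (S.attained alt (tight-sum t′ t″) {a′ + a″} {b′ + b″} (total a′ a″ b′ b″ eq′ eq″))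
      where
      total : ∀ a′ a″ b′ b″ → a′ + b′ + v′ ≡ L′.regions → a″ + b″ + v″ ≡ L″.regions →
          (a′ + a″) + (b′ + b″) + v ≡ L.regions
      total a′ a″ b′ b″ eq′ eq″ = ℕₚ.+-cancelʳ-≡ 2 _ _ (begin
        (a′ + a″) + (b′ + b″) + v + 2            ≡⟨ ℕₚ.+-assoc ((a′ + a″) + (b′ + b″)) v 2 ⟩
        (a′ + a″) + (b′ + b″) + (v + 2)          ≡⟨ cong₂ _+_ (exchange a′ a″ b′ b″) components-count ⟩
        (a′ + b′) + (a″ + b″) + (v′ + v″)        ≡⟨ exchange (a′ + b′) (a″ + b″) v′ v″ ⟩
        (a′ + b′ + v′) + (a″ + b″ + v″)          ≡⟨ cong₂ _+_ eq′ eq″ ⟩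
        L′.regions + L″.regions                  ≡⟨ regions-count ⟨
        L.regions + 2                            ∎)
        where open ≡-Reasoning

    same-support : Support (Δ̃ L i) ≐ Support (Δ̃ L′ i′ ⊛ Δ̃ L″ i″)
    same-support = ⊆ , ⊇
      where
      product-coherent : L′.regions ≡ 2 + L′.crossings → L″.regions ≡ 2 + L″.crossings →
          Coherent (Δ̃ L′ i′ ⊛ Δ̃ L″ i″)
      product-coherent t′ t″ = ⊛-coherent (S′.coherent alt′ t′) (S″.coherent alt″ t″)
      ⊆ : ∀ {e} → Support (Δ̃ L i) e → Support (Δ̃ L′ i′ ⊛ Δ̃ L″ i″) e
      ⊆ s = let h = support⇒exponent (Δ̃ L i) s
                (t′ , t″) =
                    tight-parts (S.support⇒tight h) (Planarity.2+crossings≤regions L′ i′) (Planarity.2+crossings≤regions L″ i″)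
            in exponent⇒support (product-coherent t′ t″) (exponent⇒product h t′ t″)
      ⊇ : ∀ {e} → Support (Δ̃ L′ i′ ⊛ Δ̃ L″ i″) e → Support (Δ̃ L i) e
      ⊇ s = let (tight , h) = product⇒exponent (support⇒exponent (Δ̃ L′ i′ ⊛ Δ̃ L″ i″) s) in exponent⇒support (S.coherent alt tight) h

theorem1p4 : (L L′ L″ : Diagram) (C : SeifertCircle L) →
    Alternating L → Type2 C → IsMurasugiSum L C L′ L″ →
    (i : Diagram.Segment L) (i′ : Diagram.Segment L′) (i″ : Diagram.Segment L″) →
    Support (Δ̃ L i) ≐ Support (Δ̃ L′ i′ ⊛ Δ̃ L″ i″)
theorem1p4 L L′ L″ C alt _ sum = MurasugiSum.same-support (IsMurasugiSum.first sum) (IsMurasugiSum.second sum) alt
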